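{- Let either $r_1,r_2\in\{\frac12,\frac13,\frac14,\frac16\}$ or $(r_1,r_2)\in\{(\frac15,\frac25),(\frac18,\frac38),(\frac1{10},\frac3{10}),(\frac1{12},\frac5{12})\}$, and let $d$ be the least common denominator of $r_1,r_2$. For $N=1,2,\dots$ put $$H(N)=\sum_{k=0}^{N-1}\frac{(r_1)_k(1-r_1)_k(r_2)_k(1-r_2)_k}{k!^4}.$$ Let $p$ be a prime with $p\nmid d$ such that $H(p)\not\equiv0\pmod p$. Then for all $s=1,2,\dots$, $$\frac{H(p^{s+1})}{H(p^s)}\equiv\frac{H(p^s)}{H(p^{s-1})}\pmod{p^3}.$$
   Context: Here $(a)_k=a(a+1)\cdots(a+k-1)$ is the shifted factorial. Congruences modulo powers of $p$ between rational numbers are understood in the ring $\mathbb Z_{(p)}$ of rationals with denominator prime to $p$ (equivalently, in $\mathbb Z_p$). -}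

module Defs where

open import Data.Fin.Base using (toℕ)
open import Data.Integer.Base using (+_)
open import Data.List.Base using (List; []; _∷_)
open import Data.List.Membership.Propositional using (_∈_)
open import Data.List.Relation.Unary.All using (All; []; _∷_; lookup; all?)
open import Data.Nat.Base as ℕ using (ℕ; zero; suc; _!)
open import Data.Nat.Coprimality using (Coprime)
open import Data.Nat.LCM using (lcm)
open import Data.Nat.Properties using (m^n≢0; _!≢0)
open import Data.Product.Base using (Σ-syntax; _×_; _,_)
open import Data.Rational.Base
open import Data.Rational.Properties
open import Data.Sum.Base using (_⊎_; inj₁; inj₂)
open import Relation.Binary.PropositionalEquality.Core using (_≡_; subst)
open import Relation.Nullary.Decidable using (from-yes; _×-dec_)

open import Algebra.Properties.CommutativeMonoid.Sum +-0-commutativeMonoid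
  using (sum; sum-syntax)

ratios : List ℚ
ratios = + 1 / 2 ∷ + 1 / 3 ∷ + 1 / 4 ∷ + 1 / 6 ∷ []

pairs : List (ℚ × ℚ)
pairs = (+ 1 / 5  , + 2 / 5)
      ∷ (+ 1 / 8  , + 3 / 8)
      ∷ (+ 1 / 10 , + 3 / 10)
      ∷ (+ 1 / 12 , + 5 / 12)
      ∷ []

Admissible : ℚ → ℚ → Set
Admissible r₁ r₂ = (r₁ ∈ ratios × r₂ ∈ ratios) ⊎ (r₁ , r₂) ∈ pairs

leastCommonDenominator : ℚ → ℚ → ℕ
leastCommonDenominator x y = lcm (↧ₙ x) (↧ₙ y)

ℕ→ℚ : ℕ → ℚ
ℕ→ℚ n = + n / 1

poch : ℚ → ℕ → ℚ
poch a zero    = 1ℚ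
poch a (suc k) = poch a k * (a + ℕ→ℚ k)

term : ℚ → ℚ → ℕ → ℚ
term r₁ r₂ k =
  poch r₁ k * poch (1ℚ - r₁) k * poch r₂ k * poch (1ℚ - r₂) k
    * (+ 1 / ((k !) ℕ.^ 4)) {{m^n≢0 (k !) 4 {{k !≢0}}}}

H : ℚ → ℚ → ℕ → ℚ
H r₁ r₂ N = ∑[ k < N ] term r₁ r₂ (toℕ k)

infix 4 _∈ℤ₍_₎ _≡_[ℤ₍_₎mod_]

-- ↧ₙ x is the denominator of x in lowest terms, ℚ being normalised.
_∈ℤ₍_₎ : ℚ → ℕ → Set
x ∈ℤ₍ p ₎ = Coprime p (↧ₙ x)

-- Congruence in the ring ℤ₍ p ₎ modulo the ideal generated by m; that x and y
-- belong to the ring is part of the relation.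
record _≡_[ℤ₍_₎mod_] (x y : ℚ) (p m : ℕ) : Set where
  field
    x-integral : x ∈ℤ₍ p ₎
    y-integral : y ∈ℤ₍ p ₎
    difference : Σ[ z ∈ ℚ ] (z ∈ℤ₍ p ₎ × x - y ≡ ℕ→ℚ m * z)

-- H r₁ r₂ N is positive for N ≥ 1, so that dividing by it makes sense.

InUnitInterval : ℚ → Set
InUnitInterval r = 0ℚ < r × r < 1ℚ

ratios-inUnitInterval : All InUnitInterval ratios
ratios-inUnitInterval = from-yes (all? (λ r → (0ℚ <? r) ×-dec (r <? 1ℚ)) ratios)

pairs-inUnitInterval : All (λ (r₁ , r₂) → InUnitInterval r₁ × InUnitInterval r₂) pairs
pairs-inUnitInterval = from-yes
  (all? (λ (r₁ , r₂) → ((0ℚ <? r₁) ×-dec (r₁ <? 1ℚ)) ×-dec ((0ℚ <? r₂) ×-dec (r₂ <? 1ℚ))) pairs)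

admissible-inUnitInterval : ∀ {r₁ r₂} → Admissible r₁ r₂ →
                            InUnitInterval r₁ × InUnitInterval r₂
admissible-inUnitInterval (inj₁ (r₁∈ , r₂∈)) =
  lookup ratios-inUnitInterval r₁∈ , lookup ratios-inUnitInterval r₂∈
admissible-inUnitInterval (inj₂ r∈) = lookup pairs-inUnitInterval r∈

poch-positive : ∀ {a} → Positive a → ∀ k → Positive (poch a k)
poch-positive     a>0 zero    = _
poch-positive {a} a>0 (suc k) =
  pos*pos⇒pos (poch a k) {{poch-positive a>0 k}} (a + ℕ→ℚ k)
    {{pos+nonNeg⇒pos a {{a>0}} (ℕ→ℚ k) {{normalize-nonNeg k 1}}}}

1-r-positive : ∀ {r} → r < 1ℚ → Positive (1ℚ - r)
1-r-positive {r} r<1 =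
  positive (subst (_< 1ℚ - r) (+-inverseʳ r) (+-monoˡ-< (- r) r<1))

term-positive : ∀ {r₁ r₂} → InUnitInterval r₁ → InUnitInterval r₂ →
                ∀ k → Positive (term r₁ r₂ k)
term-positive {r₁} {r₂} (0<r₁ , r₁<1) (0<r₂ , r₂<1) k =
  pos*pos⇒pos (a * b * c * d) {{abcd}} ((+ 1 / ((k !) ℕ.^ 4)) {{nz}})
    {{normalize-pos 1 ((k !) ℕ.^ 4) {{nz}}}}
  where
  a = poch r₁ k
  b = poch (1ℚ - r₁) k
  c = poch r₂ k
  d = poch (1ℚ - r₂) k
  nz : ℕ.NonZero ((k !) ℕ.^ 4)
  nz = m^n≢0 (k !) 4 {{k !≢0}}
  ab : Positive (a * b)
  ab = pos*pos⇒pos a {{poch-positive (positive 0<r₁) k}}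
                   b {{poch-positive (1-r-positive r₁<1) k}}
  abc : Positive (a * b * c)
  abc = pos*pos⇒pos (a * b) {{ab}} c {{poch-positive (positive 0<r₂) k}}
  abcd : Positive (a * b * c * d)
  abcd = pos*pos⇒pos (a * b * c) {{abc}} d {{poch-positive (1-r-positive r₂<1) k}}

sum-nonNegative : ∀ n (f : ℕ → ℚ) → (∀ k → Positive (f k)) →
                  NonNegative (∑[ k < n ] f (toℕ k))
sum-nonNegative zero    f f>0 = _
sum-nonNegative (suc n) f f>0 =
  pos⇒nonNeg (f 0 + s)
    {{pos+nonNeg⇒pos (f 0) {{f>0 0}} s {{sum-nonNegative n (λ k → f (suc k)) (λ k → f>0 (suc k))}}}}
  where s = ∑[ k < n ] f (suc (toℕ k))

sum-positive : ∀ n .{{_ : ℕ.NonZero n}} (f : ℕ → ℚ) → (∀ k → Positive (f k)) →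
               Positive (∑[ k < n ] f (toℕ k))
sum-positive (suc n) f f>0 =
  pos+nonNeg⇒pos (f 0) {{f>0 0}} (∑[ k < n ] f (suc (toℕ k)))
    {{sum-nonNegative n (λ k → f (suc k)) (λ k → f>0 (suc k))}}

H≢0 : ∀ {r₁ r₂} → Admissible r₁ r₂ → ∀ N .{{_ : ℕ.NonZero N}} → NonZero (H r₁ r₂ N)
H≢0 {r₁} {r₂} adm N = pos⇒nonZero (H r₁ r₂ N)
  {{sum-positive N (term r₁ r₂) (let (i₁ , i₂) = admissible-inUnitInterval adm in term-positive i₁ i₂)}}

{-# OPTIONS --safe #-}
module Submission where

-- Write A k for the summand, and r + m = p u with 0 ≤ m < p; the two u are the two r up to order and
-- reflection, so they give the same A.  The factorization of (r)_x (1-r)_x (x+δ)(x+δ-1)⋯(x+δ-m), δ = p u,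
-- yields for x = a + p b that A x / A b is integral and, modulo p³, equal up to sign to a product of two terms
--   (1 - δ² ∑_{i≤x, p∤i} 1/i²) q(a + e) / ∏_{j≠a} (a + e - j),    e = p (b + u),
-- with q a product of p - 1 linear factors that depends neither on a nor on b.  Lagrange interpolation of q at
-- 0, …, p - 1 turns the sum over a of these products into sums of the type
--   ∑_a e₁ e₂ / ((a - i + e₁) (a - j + e₂)),
-- which partial fractions evaluate modulo p³: for i ≠ j they depend on e₂ - e₁ only, for i = j on e₁ e₂ σ₂ with
-- σ₂ = ∑_{0<i<p} 1/i².  Since p divides σ₂ (or A b cancels the term, if p ≤ 3), the sum of A x / A b over a is
-- congruent to its value H(p) at b = 0, whence H(p N) ≡ H(p) H(N) modulo p³.

open import Defs
open import Algebra.Bundles using (CommutativeMonoid; CommutativeRing)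
open import Algebra.Core using (Op₂)
open import Data.Bool.Base using (true; false; if_then_else_)
open import Data.Fin.Base using (Fin; toℕ; fromℕ<)
open import Data.Fin.Properties as Finₚ using (toℕ-fromℕ<; toℕ<n)
open import Data.Integer.Base as ℤ using (ℤ; +_; -[1+_])
import Data.Integer.Divisibility.Signed as Signed
import Data.Integer.Properties as ℤₚ
open import Data.List.Membership.Propositional using (_∈_)
open import Data.List.Relation.Unary.All using (All; all?; lookup)
open import Data.Maybe.Base using (Maybe; just; nothing)
open import Data.Nat.Base as ℕ using (ℕ; zero; suc; _∸_; z≤n; s≤s; _^_; _≤_; _!)
open import Data.Nat.Coprimality using (Coprime; coprime?)
open import Data.Nat.Divisibility using (_∣_; _∣?_; _∤_; divides; ∣-refl; ∣-trans; ∣⇒≤; ∣1⇒≡1; ∣m∣n⇒∣m+n; ∣n⇒∣m*n)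
open import Data.Nat.DivMod using (_/_; _%_; m≡m%n+[m/n]*n; m%n<n; m/n<m; %-distribˡ-*; m%n%n≡m%n; %-congʳ)
open import Data.Nat.Induction using (<-rec)
open import Data.Nat.LCM using (m∣lcm[m,n]; n∣lcm[m,n])
open import Data.Nat.Primality using (Prime; prime⇒nonZero; prime⇒irreducible; euclidsLemma; ¬prime[0]; ¬prime[1])
open import Data.Nat.Properties as ℕₚ using (m^n≢0)
open import Data.Nat.Tactic.RingSolver using (solve-∀)
open import Data.Product.Base using (∃; _,_; _×_; proj₁; proj₂)
open import Data.Rational.Base as ℚ using (ℚ; mkℚ; 0ℚ; 1ℚ; ↥_; ↧_; ↧ₙ_; 1/_; _÷_)
import Data.Rational.Properties as ℚₚ
import Data.Rational.Unnormalised.Base as ℚᵘ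
import Data.Rational.Unnormalised.Properties as ℚᵘₚ
open import Data.Sum.Base using (_⊎_; inj₁; inj₂)
open import Function.Base using (_∘_)
open import Level using (0ℓ)
open import Relation.Binary.PropositionalEquality as ≡ using (_≡_; _≢_)
open import Relation.Nullary using (¬_; Dec; yes; no; contradiction)
open import Relation.Nullary.Decidable using (from-yes; _×-dec_; _⊎-dec_; _→-dec_)

open import Algebra.Properties.CommutativeMonoid.Sum ℚₚ.+-0-commutativeMonoid using (sum)

-- The parameters enter through one property: multiplication by the inverse of `p` modulo 1 permutes
-- `r₁`, `1 - r₁`, `r₂`, `1 - r₂`. The multiples of `p` inside the Pochhammer symbols of
-- `A (a + p b)` then rebuild `A b` itself rather than a term with other parameters.
--
-- The obstacle is that `p` is a zero divisor modulo `p³`, while both sides of the factorization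
-- carry powers of `p`. Such factors are cancelled in the ring of `p`-integral rationals, where `p`
-- is regular; identities stay cross-multiplied until only units remain to be divided by, and the
-- reduction modulo `p³` comes after that. Integrality of `A k` is not read off from the formula; it
-- comes out of the same factorization, by recursion on the base `p` digits of `k`.
--
-- The congruence for `H(p N)` makes each `H(p^{t+1})` congruent to `H(p) H(p^t)`. As `H(p)` is a
-- unit, so is every `H(p^t)`, and both quotients in the theorem are congruent to `H(p)`.

module Iterate {A : Set} (_∙_ : Op₂ A) (ε : A) where

  big : ℕ → (ℕ → A) → A
  big zero    f = ε
  big (suc n) f = big n f ∙ f n

-- Depending on the raw operations only, these mean the same in a ring and in its quotients.
module Ops {A : Set} (_+_ _*_ : Op₂ A) (0# 1# : A) where

  open Iterate _+_ 0# public using () renaming (big to ∑)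
  open Iterate _*_ 1# public using () renaming (big to ∏)

  -- The separate case makes fromℕ 1 definitionally 1#, as the constants of the ring solver need.
  fromℕ : ℕ → A
  fromℕ 0             = 0#
  fromℕ 1             = 1#
  fromℕ (suc (suc n)) = 1# + fromℕ (suc n)

  pow : A → ℕ → A
  pow x n = ∏ n (λ _ → x)

  kronecker : ℕ → ℕ → A
  kronecker zero    zero    = 1#
  kronecker zero    (suc j) = 0#
  kronecker (suc i) zero    = 0#
  kronecker (suc i) (suc j) = kronecker i j

  -- For a ≤ P: the product over the k with 1 ≤ k ≤ b (1 + P) + a that 1 + P does not divide.
  ∏-coprime : ℕ → ℕ → ℕ → (ℕ → A) → A
  ∏-coprime P b a f =
    ∏ b (λ n → ∏ P (λ i → f (n ℕ.* suc P ℕ.+ suc i))) * ∏ a (λ i → f (b ℕ.* suc P ℕ.+ suc i))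

  -- Replaces division by the factor of index `i`, which may not be invertible: at `y = a + e` with
  -- `e` a multiple of `p`, the factor `y - a` is `e`.
  omit : ℕ → ℕ → A → A
  omit zero    zero    x = 1#
  omit zero    (suc j) x = x
  omit (suc i) zero    x = x
  omit (suc i) (suc j) x = omit i j x

module RingOps (R : CommutativeRing 0ℓ 0ℓ) where
  open CommutativeRing R
  open Ops _+_ _*_ 0# 1# public

-- Finite sums and products in a commutative monoid

module IterateProperties (M : CommutativeMonoid 0ℓ 0ℓ) where

  open CommutativeMonoid M
  open Iterate _∙_ ε
  open import Algebra.Properties.CommutativeSemigroup commutativeSemigroup using (interchange)
  open import Relation.Binary.Reasoning.Setoid setoid

  big-cong : ∀ n {f g} → (∀ i → i ℕ.< n → f i ≈ g i) → big n f ≈ big n g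
  big-cong zero    f≈g = refl
  big-cong (suc n) f≈g = ∙-cong (big-cong n λ i i<n → f≈g i (ℕₚ.m<n⇒m<1+n i<n)) (f≈g n ℕₚ.≤-refl)

  big-∙ : ∀ n {f g} → big n (λ i → f i ∙ g i) ≈ big n f ∙ big n g
  big-∙ zero    = sym (identityˡ ε)
  big-∙ (suc n) = trans (∙-congʳ (big-∙ n)) (interchange _ _ _ _)

  big-ε : ∀ n → big n (λ _ → ε) ≈ ε
  big-ε zero    = refl
  big-ε (suc n) = trans (identityʳ _) (big-ε n)

  big-comm : ∀ m n (f : ℕ → ℕ → Carrier) → big m (λ i → big n (f i)) ≈ big n (λ j → big m (λ i → f i j))
  big-comm zero    n f = sym (big-ε n)
  big-comm (suc m) n f = trans (∙-congʳ (big-comm m n f)) (sym (big-∙ n))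

  big-+ : ∀ m n f → big (m ℕ.+ n) f ≈ big m f ∙ big n (λ i → f (m ℕ.+ i))
  big-+ m zero    f rewrite ℕₚ.+-identityʳ m = sym (identityʳ _)
  big-+ m (suc n) f rewrite ℕₚ.+-suc m n = trans (∙-congʳ (big-+ m n f)) (assoc _ _ _)

  big-suc : ∀ n f → big (suc n) f ≈ f 0 ∙ big n (f ∘ suc)
  big-suc n f = trans (big-+ 1 n f) (∙-congʳ (identityˡ _))

  big-* : ∀ n m f → big (n ℕ.* m) f ≈ big n (λ b → big m (λ i → f (b ℕ.* m ℕ.+ i)))
  big-* zero    m f = refl
  big-* (suc n) m f = begin
    big (m ℕ.+ n ℕ.* m) f     ≡⟨ ≡.cong (λ k → big k f) (ℕₚ.+-comm m (n ℕ.* m)) ⟩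
    big (n ℕ.* m ℕ.+ m) f     ≈⟨ big-+ (n ℕ.* m) m f ⟩
    big (n ℕ.* m) f ∙ _       ≈⟨ ∙-congʳ (big-* n m f) ⟩
    _                         ∎

-- A ring solver with integer coefficients

module IntegerCoefficients (R : CommutativeRing 0ℓ 0ℓ) where

  open CommutativeRing R
  open RingOps R using (fromℕ)
  open import Algebra.Properties.Ring ring
  open import Relation.Binary.Reasoning.Setoid setoid
  open import Algebra.Solver.Ring.AlmostCommutativeRing
    using (fromCommutativeRing; _-Raw-AlmostCommutative⟶_)

  fromℕ-suc : ∀ n → fromℕ (suc n) ≈ 1# + fromℕ n
  fromℕ-suc zero    = sym (+-identityʳ 1#)
  fromℕ-suc (suc n) = refl

  fromℕ-+ : ∀ m n → fromℕ (m ℕ.+ n) ≈ fromℕ m + fromℕ n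
  fromℕ-+ zero    n = sym (+-identityˡ _)
  fromℕ-+ (suc m) n = begin
    fromℕ (suc (m ℕ.+ n))     ≈⟨ fromℕ-suc (m ℕ.+ n) ⟩
    1# + fromℕ (m ℕ.+ n)      ≈⟨ +-congˡ (fromℕ-+ m n) ⟩
    1# + (fromℕ m + fromℕ n)  ≈⟨ +-assoc _ _ _ ⟨
    1# + fromℕ m + fromℕ n    ≈⟨ +-congʳ (fromℕ-suc m) ⟨
    fromℕ (suc m) + fromℕ n   ∎

  fromℕ-* : ∀ m n → fromℕ (m ℕ.* n) ≈ fromℕ m * fromℕ n
  fromℕ-* zero    n = sym (zeroˡ _)
  fromℕ-* (suc m) n = begin
    fromℕ (n ℕ.+ m ℕ.* n)               ≈⟨ fromℕ-+ n (m ℕ.* n) ⟩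
    fromℕ n + fromℕ (m ℕ.* n)           ≈⟨ +-cong (sym (*-identityˡ _)) (fromℕ-* m n) ⟩
    1# * fromℕ n + fromℕ m * fromℕ n    ≈⟨ distribʳ _ _ _ ⟨
    (1# + fromℕ m) * fromℕ n            ≈⟨ *-congʳ (fromℕ-suc m) ⟨
    fromℕ (suc m) * fromℕ n             ∎

  private
    fromℤ : ℤ → Carrier
    fromℤ (+ n)    = fromℕ n
    fromℤ -[1+ n ] = - fromℕ (suc n)

    fromℤ-⊖ : ∀ m n → fromℤ (m ℤ.⊖ n) ≈ fromℕ m - fromℕ n
    fromℤ-⊖ m       zero    = trans (sym (+-identityʳ _)) (+-congˡ (sym -0#≈0#))
    fromℤ-⊖ zero    (suc n) = sym (+-identityˡ _)
    fromℤ-⊖ (suc m) (suc n) = begin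
      fromℤ (suc m ℤ.⊖ suc n)                  ≡⟨ ≡.cong fromℤ (ℤₚ.[1+m]⊖[1+n]≡m⊖n m n) ⟩
      fromℤ (m ℤ.⊖ n)                          ≈⟨ fromℤ-⊖ m n ⟩
      fromℕ m - fromℕ n                        ≈⟨ +-congʳ (xyx⁻¹≈y 1# (fromℕ m)) ⟨
      1# + fromℕ m + - 1# + - fromℕ n          ≈⟨ +-assoc _ _ _ ⟩
      1# + fromℕ m + (- 1# + - fromℕ n)        ≈⟨ +-congˡ (-‿+-comm 1# (fromℕ n)) ⟩
      1# + fromℕ m - (1# + fromℕ n)            ≈⟨ +-cong (fromℕ-suc m) (-‿cong (fromℕ-suc n)) ⟨
      fromℕ (suc m) - fromℕ (suc n)            ∎

    fromℤ-+ : ∀ i j → fromℤ (i ℤ.+ j) ≈ fromℤ i + fromℤ j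
    fromℤ-+ (+ m)    (+ n)    = fromℕ-+ m n
    fromℤ-+ (+ m)    -[1+ n ] = fromℤ-⊖ m (suc n)
    fromℤ-+ -[1+ m ] (+ n)    = trans (fromℤ-⊖ n (suc m)) (+-comm _ _)
    fromℤ-+ -[1+ m ] -[1+ n ] = begin
      - fromℕ (suc (suc (m ℕ.+ n)))        ≡⟨ ≡.cong (λ k → - fromℕ (suc k)) (ℕₚ.+-suc m n) ⟨
      - fromℕ (suc m ℕ.+ suc n)            ≈⟨ -‿cong (fromℕ-+ (suc m) (suc n)) ⟩
      - (fromℕ (suc m) + fromℕ (suc n))    ≈⟨ -‿+-comm _ _ ⟨
      - fromℕ (suc m) + - fromℕ (suc n)    ∎

    fromℤ-neg : ∀ i → fromℤ (ℤ.- i) ≈ - fromℤ i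
    fromℤ-neg (+ zero)  = sym -0#≈0#
    fromℤ-neg (+ suc n) = refl
    fromℤ-neg -[1+ n ]  = sym (-‿involutive _)

    fromℤ-*-+ : ∀ m j → fromℤ (+ m ℤ.* j) ≈ fromℕ m * fromℤ j
    fromℤ-*-+ m (+ n)    = trans (reflexive (≡.cong fromℤ (≡.sym (ℤₚ.pos-* m n)))) (fromℕ-* m n)
    fromℤ-*-+ m -[1+ n ] = begin
      fromℤ (+ m ℤ.* -[1+ n ])          ≡⟨ ≡.cong fromℤ (ℤₚ.neg-distribʳ-* (+ m) (+ suc n)) ⟨
      fromℤ (ℤ.- (+ m ℤ.* + suc n))     ≈⟨ fromℤ-neg (+ m ℤ.* + suc n) ⟩
      - fromℤ (+ m ℤ.* + suc n)         ≈⟨ -‿cong (fromℤ-*-+ m (+ suc n)) ⟩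
      - (fromℕ m * fromℕ (suc n))       ≈⟨ -‿distribʳ-* _ _ ⟩
      fromℕ m * - fromℕ (suc n)         ∎

    fromℤ-* : ∀ i j → fromℤ (i ℤ.* j) ≈ fromℤ i * fromℤ j
    fromℤ-* (+ m)    j = fromℤ-*-+ m j
    fromℤ-* -[1+ m ] j = begin
      fromℤ (-[1+ m ] ℤ.* j)            ≡⟨ ≡.cong fromℤ (ℤₚ.neg-distribˡ-* (+ suc m) j) ⟨
      fromℤ (ℤ.- (+ suc m ℤ.* j))       ≈⟨ fromℤ-neg (+ suc m ℤ.* j) ⟩
      - fromℤ (+ suc m ℤ.* j)           ≈⟨ -‿cong (fromℤ-*-+ (suc m) j) ⟩
      - (fromℕ (suc m) * fromℤ j)       ≈⟨ -‿distribˡ-* _ _ ⟩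
      - fromℕ (suc m) * fromℤ j         ∎

    fromℤ-morphism : ℤ.+-*-rawRing -Raw-AlmostCommutative⟶ fromCommutativeRing R
    fromℤ-morphism = record
      { ⟦_⟧    = fromℤ
      ; +-homo = fromℤ-+
      ; *-homo = fromℤ-*
      ; -‿homo = fromℤ-neg
      ; 0-homo = refl
      ; 1-homo = refl
      }

    _coeff≟_ : ∀ i j → Maybe (fromℤ i ≈ fromℤ j)
    i coeff≟ j with i ℤₚ.≟ j
    ... | yes i≡j = just (reflexive (≡.cong fromℤ i≡j))
    ... | no  _   = nothing

  open import Algebra.Solver.Ring ℤ.+-*-rawRing (fromCommutativeRing R) fromℤ-morphism _coeff≟_ public
    using (solve; _:=_; _:+_; _:*_; _:-_; :-_; con)

-- Sums, products, Kronecker symbols and units in a commutative ring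

module RingProperties (R : CommutativeRing 0ℓ 0ℓ) where

  open CommutativeRing R
  open RingOps R
  open IntegerCoefficients R public
  open import Algebra.Properties.Ring ring using (-0#≈0#; -‿+-comm)
  open import Relation.Binary.Reasoning.Setoid setoid
  open IterateProperties +-commutativeMonoid public using ()
    renaming ( big-cong to ∑-cong; big-∙ to ∑-distrib-+; big-ε to ∑-zero; big-comm to ∑-comm
             ; big-+ to ∑-split; big-suc to ∑-suc; big-* to ∑-blocks )
  open IterateProperties *-commutativeMonoid public using ()
    renaming ( big-cong to ∏-cong; big-∙ to ∏-distrib-*; big-ε to ∏-one
             ; big-+ to ∏-split; big-suc to ∏-suc; big-* to ∏-blocks )

  *-distribˡ-∑ : ∀ n c f → c * ∑ n f ≈ ∑ n (λ i → c * f i)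
  *-distribˡ-∑ zero    c f = zeroʳ c
  *-distribˡ-∑ (suc n) c f = trans (distribˡ _ _ _) (+-congʳ (*-distribˡ-∑ n c f))

  *-distribʳ-∑ : ∀ n c f → ∑ n f * c ≈ ∑ n (λ i → f i * c)
  *-distribʳ-∑ zero    c f = zeroˡ c
  *-distribʳ-∑ (suc n) c f = trans (distribʳ _ _ _) (+-congʳ (*-distribʳ-∑ n c f))

  ∑-neg : ∀ n f → ∑ n (λ i → - f i) ≈ - ∑ n f
  ∑-neg zero    f = sym -0#≈0#
  ∑-neg (suc n) f = trans (+-congʳ (∑-neg n f)) (-‿+-comm _ _)

  ∑-cong′ : ∀ n {f g} → (∀ i → f i ≈ g i) → ∑ n f ≈ ∑ n g
  ∑-cong′ n f≈g = ∑-cong n λ i _ → f≈g i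

  ∑-* : ∀ m n f g → ∑ m f * ∑ n g ≈ ∑ m (λ i → ∑ n (λ j → f i * g j))
  ∑-* m n f g = trans (*-distribʳ-∑ m _ _) (∑-cong′ m λ i → *-distribˡ-∑ n _ _)

  -- The cofactor c is what a hypothesis is multiplied by in a polynomial identity left to the solver.
  relation : ∀ {x y a b} c → a ≈ b → x ≈ y + (a - b) * c → x ≈ y
  relation {x} {y} {a} {b} c a≈b eq = begin
    x                  ≈⟨ eq ⟩
    y + (a - b) * c    ≈⟨ +-congˡ (*-congʳ (+-congʳ a≈b)) ⟩
    y + (b - b) * c    ≈⟨ +-congˡ (*-congʳ (-‿inverseʳ b)) ⟩
    y + 0# * c         ≈⟨ +-congˡ (zeroˡ c) ⟩
    y + 0#             ≈⟨ +-identityʳ y ⟩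
    y                  ∎

  kronecker-sym : ∀ i j → kronecker i j ≈ kronecker j i
  kronecker-sym zero    zero    = refl
  kronecker-sym zero    (suc j) = refl
  kronecker-sym (suc i) zero    = refl
  kronecker-sym (suc i) (suc j) = kronecker-sym i j

  kronecker-refl : ∀ i → kronecker i i ≈ 1#
  kronecker-refl zero    = refl
  kronecker-refl (suc i) = kronecker-refl i

  kronecker-≢ : ∀ {i j} → i ≢ j → kronecker i j ≈ 0#
  kronecker-≢ {zero}  {zero}  i≢j = contradiction ≡.refl i≢j
  kronecker-≢ {zero}  {suc j} i≢j = refl
  kronecker-≢ {suc i} {zero}  i≢j = refl
  kronecker-≢ {suc i} {suc j} i≢j = kronecker-≢ (i≢j ∘ ≡.cong suc)

  kronecker-subst : ∀ i j (f : ℕ → Carrier) → kronecker i j * f i ≈ kronecker i j * f j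
  kronecker-subst i j f with i ℕₚ.≟ j
  ... | yes ≡.refl = refl
  ... | no  i≢j    = trans (trans (*-congʳ (kronecker-≢ i≢j)) (zeroˡ _))
                           (sym (trans (*-congʳ (kronecker-≢ i≢j)) (zeroˡ _)))

  ∑-kronecker : ∀ n i (f : ℕ → Carrier) → i ℕ.< n → ∑ n (λ a → kronecker a i * f a) ≈ f i
  ∑-kronecker (suc n) zero f _ = begin
    ∑ (suc n) (λ a → kronecker a 0 * f a)                 ≈⟨ ∑-suc n _ ⟩
    1# * f 0 + ∑ n (λ a → 0# * f (suc a))                 ≈⟨ +-cong (*-identityˡ _) (∑-cong′ n λ a → zeroˡ _) ⟩
    f 0 + ∑ n (λ _ → 0#)                                  ≈⟨ +-congˡ (∑-zero n) ⟩
    f 0 + 0#                                              ≈⟨ +-identityʳ _ ⟩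
    f 0                                                   ∎
  ∑-kronecker (suc n) (suc i) f (s≤s i<n) = begin
    ∑ (suc n) (λ a → kronecker a (suc i) * f a)           ≈⟨ ∑-suc n _ ⟩
    0# * f 0 + ∑ n (λ a → kronecker a i * f (suc a))      ≈⟨ +-cong (zeroˡ _) (∑-kronecker n i (f ∘ suc) i<n) ⟩
    0# + f (suc i)                                        ≈⟨ +-identityˡ _ ⟩
    f (suc i)                                             ∎

  omit-refl : ∀ i x → omit i i x ≈ 1#
  omit-refl zero    x = refl
  omit-refl (suc i) x = omit-refl i x

  omit-≢ : ∀ {i j} x → i ≢ j → omit i j x ≈ x
  omit-≢ {zero}  {zero}  x i≢j = contradiction ≡.refl i≢j
  omit-≢ {zero}  {suc j} x i≢j = refl
  omit-≢ {suc i} {zero}  x i≢j = refl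
  omit-≢ {suc i} {suc j} x i≢j = omit-≢ x (i≢j ∘ ≡.cong suc)

  ∏-omit-outside : ∀ n i f → n ℕ.≤ i → ∏ n (λ j → omit i j (f j)) ≈ ∏ n f
  ∏-omit-outside n i f n≤i = ∏-cong n λ j j<n → omit-≢ (f j) (≡.≢-sym (ℕₚ.<⇒≢ (ℕₚ.<-≤-trans j<n n≤i)))

  ∏-omit : ∀ n i f → i ℕ.< n → ∏ n (λ j → omit i j (f j)) * f i ≈ ∏ n f
  ∏-omit (suc n) i f (s≤s i≤n) with ℕₚ.m≤n⇒m<n∨m≡n i≤n
  ... | inj₂ ≡.refl = *-congʳ (begin
    ∏ n (λ j → omit n j (f j)) * omit n n (f n)  ≈⟨ *-cong (∏-omit-outside n n f ℕₚ.≤-refl) (omit-refl n (f n)) ⟩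
    ∏ n f * 1#                                   ≈⟨ *-identityʳ _ ⟩
    ∏ n f                                        ∎)
  ... | inj₁ i<n = begin
    ∏ n (λ j → omit i j (f j)) * omit i n (f n) * f i   ≈⟨ *-congʳ (*-congˡ (omit-≢ (f n) (ℕₚ.<⇒≢ i<n))) ⟩
    ∏ n (λ j → omit i j (f j)) * f n * f i              ≈⟨ solve 3 (λ x y z → x :* y :* z := x :* z :* y) refl _ (f n) (f i) ⟩
    ∏ n (λ j → omit i j (f j)) * f i * f n              ≈⟨ *-congʳ (∏-omit n i f i<n) ⟩
    ∏ n f * f n                                         ∎

  IsUnit : Carrier → Set
  IsUnit x = ∃ λ y → x * y ≈ 1#

  unit-1 : IsUnit 1#
  unit-1 = 1# , *-identityˡ 1#

  unit-* : ∀ {x y} → IsUnit x → IsUnit y → IsUnit (x * y)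
  unit-* {x} {y} (v , xv≈1) (w , yw≈1) = v * w , relation (y * w) xv≈1 (relation 1# yw≈1
    (solve 4 (λ x y v w → x :* y :* (v :* w) := con (+ 1) :+ (x :* v :- con (+ 1)) :* (y :* w) :+ (y :* w :- con (+ 1)) :* con (+ 1)) refl x y v w))

  unit-∏ : ∀ n f → (∀ i → i ℕ.< n → IsUnit (f i)) → IsUnit (∏ n f)
  unit-∏ zero    f f-unit = unit-1
  unit-∏ (suc n) f f-unit = unit-* (unit-∏ n f λ i i<n → f-unit i (ℕₚ.m<n⇒m<1+n i<n)) (f-unit n ℕₚ.≤-refl)

  unit-resp : ∀ {x y} → x ≈ y → IsUnit x → IsUnit y
  unit-resp x≈y (v , xv≈1) = v , trans (*-congʳ (sym x≈y)) xv≈1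

  unit-cancelʳ : ∀ {x y u} → IsUnit u → x * u ≈ y * u → x ≈ y
  unit-cancelʳ {x} {y} {u} (v , uv≈1) xu≈yu =
    relation (y - x) uv≈1 (relation v xu≈yu
    (solve 4 (λ x y u v → x := y :+ (u :* v :- con (+ 1)) :* (y :- x) :+ (x :* u :- y :* u) :* v) refl x y u v))

-- Quotients by a principal ideal

module Quotient (R : CommutativeRing 0ℓ 0ℓ) (c : CommutativeRing.Carrier R) where

  open CommutativeRing R
  open RingProperties R

  infix 4 _≋_
  -- The multiple of `c` is kept as data: it ends up as the witness of the congruence between
  -- rationals.
  record _≋_ (x y : Carrier) : Set where
    constructor mod
    field
      quotient : Carrier
      equality : x ≈ y + c * quotient

  ≈⇒≋ : ∀ {x y} → x ≈ y → x ≋ y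
  ≈⇒≋ {x} {y} x≈y = mod 0# (trans x≈y (solve 2 (λ y c → y := y :+ c :* con (+ 0)) refl y c))

  ≋-sym : ∀ {x y} → x ≋ y → y ≋ x
  ≋-sym {x} {y} (mod q e) = mod (- q)
    (relation 1# (sym e) (solve 4 (λ x y c q → y := x :+ c :* (:- q) :+ (y :+ c :* q :- x) :* con (+ 1)) refl x y c q))

  ≋-trans : ∀ {x y z} → x ≋ y → y ≋ z → x ≋ z
  ≋-trans {x} {y} {z} (mod q e) (mod r f) = mod (q + r)
    (trans e (relation 1# f (solve 5 (λ y z c q r → y :+ c :* q := z :+ c :* (q :+ r) :+ (y :- (z :+ c :* r)) :* con (+ 1)) refl y z c q r)))

  +-cong-≋ : ∀ {x x′ y y′} → x ≋ x′ → y ≋ y′ → x + y ≋ x′ + y′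
  +-cong-≋ {x} {x′} {y} {y′} (mod q e) (mod r f) = mod (q + r)
    (trans (+-cong e f) (solve 5 (λ x y c q r → x :+ c :* q :+ (y :+ c :* r) := x :+ y :+ c :* (q :+ r)) refl x′ y′ c q r))

  *-cong-≋ : ∀ {x x′ y y′} → x ≋ x′ → y ≋ y′ → x * y ≋ x′ * y′
  *-cong-≋ {x} {x′} {y} {y′} (mod q e) (mod r f) = mod (q * y′ + x′ * r + c * q * r)
    (trans (*-cong e f) (solve 5 (λ x y c q r → (x :+ c :* q) :* (y :+ c :* r)
      := x :* y :+ c :* (q :* y :+ x :* r :+ c :* q :* r)) refl x′ y′ c q r))

  neg-cong-≋ : ∀ {x x′} → x ≋ x′ → - x ≋ - x′
  neg-cong-≋ {x} {x′} (mod q e) = mod (- q)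
    (trans (-‿cong e) (solve 3 (λ x c q → :- (x :+ c :* q) := :- x :+ c :* (:- q)) refl x′ c q))

  quotientRing : CommutativeRing 0ℓ 0ℓ
  quotientRing = record
    { Carrier = Carrier ; _≈_ = _≋_ ; _+_ = _+_ ; _*_ = _*_ ; -_ = -_ ; 0# = 0# ; 1# = 1#
    ; isCommutativeRing = record
      { isRing = record
        { +-isAbelianGroup = record
          { isGroup = record
            { isMonoid = record
              { isSemigroup = record
                { isMagma = record
                  { isEquivalence = record { refl = ≈⇒≋ refl ; sym = ≋-sym ; trans = ≋-trans }
                  ; ∙-cong = +-cong-≋ }
                ; assoc = λ x y z → ≈⇒≋ (+-assoc x y z) }
              ; identity = (λ x → ≈⇒≋ (+-identityˡ x)) , (λ x → ≈⇒≋ (+-identityʳ x)) }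
            ; inverse = (λ x → ≈⇒≋ (-‿inverseˡ x)) , (λ x → ≈⇒≋ (-‿inverseʳ x))
            ; ⁻¹-cong = neg-cong-≋ }
          ; comm = λ x y → ≈⇒≋ (+-comm x y) }
        ; *-cong = *-cong-≋
        ; *-assoc = λ x y z → ≈⇒≋ (*-assoc x y z)
        ; *-identity = (λ x → ≈⇒≋ (*-identityˡ x)) , (λ x → ≈⇒≋ (*-identityʳ x))
        ; distrib = (λ x y z → ≈⇒≋ (distribˡ x y z)) , (λ x y z → ≈⇒≋ (distribʳ x y z)) }
      ; *-comm = λ x y → ≈⇒≋ (*-comm x y) } }

-- Sums and products modulo p³

private
  -- For `p = 2 h + 1`: doubling the residue `h + j + 1` gives `2 j + 1` plus one full period.
  ℕ-solve : ∀ h j → 2 ℕ.* suc (h ℕ.+ j) ≡ suc (j ℕ.* 2 ℕ.+ 0) ℕ.+ suc (h ℕ.* 2)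
  ℕ-solve = solve-∀

-- The model is the ring of `p`-integral rationals modulo `p³`. The convention `ι 0 ≈ 0` lets
-- formulas in inverses of differences cover the case of a zero difference, with a Kronecker symbol
-- as the only correction.
record CubeZero (B : CommutativeRing 0ℓ 0ℓ) (P : ℕ) : Set where
  open CommutativeRing B
  open RingOps B
  field
    π         : Carrier
    π³≈0      : π * π * π ≈ 0#
    fromℕ-p   : fromℕ (suc P) ≈ π
    ι         : ℕ → Carrier
    ι-zero    : ι 0 ≈ 0#
    ι-inverse : ∀ n → n ℕ.< P → fromℕ (suc n) * ι (suc n) ≈ 1#

module Modular (B : CommutativeRing 0ℓ 0ℓ) (P : ℕ) (cubeZero : CubeZero B P) where

  open CommutativeRing B
  open RingOps B
  open CubeZero cubeZero
  open RingProperties B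
  open import Relation.Binary.Reasoning.Setoid setoid

  p : ℕ
  p = suc P

  -- The inverse of a - i, with κ a a = 0; congruences modulo π are equalities multiplied by π * π.
  κ : ℕ → ℕ → Carrier
  κ a i = ι (a ∸ i) - ι (i ∸ a)

  σ₂ : Carrier
  σ₂ = ∑ p (λ a → κ a 0 * κ a 0)

  -- The quotient of ∏_{j≠i} (a + e - j) by ∏_{j≠a} (a + e - j), which is e / (a - i + e) for i ≠ a, when e³ = 0.
  w : ℕ → ℕ → Carrier → Carrier
  w a i e = kronecker a i + (κ a i * e - κ a i * κ a i * e * e)

  κ-antisym : ∀ a i → κ a i ≈ - κ i a
  κ-antisym a i = solve 2 (λ x y → x :- y := :- (y :- x)) refl (ι (a ∸ i)) (ι (i ∸ a))

  κ-difference : ∀ a i → a ℕ.< p → i ℕ.< p → κ a i * (fromℕ a - fromℕ i) ≈ 1# - kronecker a i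
  κ-difference zero    zero    _ _ = solve 1 (λ x → (x :- x) :* (con (+ 0) :- con (+ 0)) := con (+ 1) :- con (+ 1)) refl (ι 0)
  κ-difference zero    (suc i) _ (s≤s i<P) = relation 1# (ι-inverse i i<P) (relation (- fromℕ (suc i)) ι-zero
    (solve 3 (λ z x y → (z :- x) :* (con (+ 0) :- y)
      := con (+ 1) :- con (+ 0) :+ (y :* x :- con (+ 1)) :* con (+ 1) :+ (z :- con (+ 0)) :* (:- y)) refl (ι 0) (ι (suc i)) (fromℕ (suc i))))
  κ-difference (suc a) zero    (s≤s a<P) _ = relation 1# (ι-inverse a a<P) (relation (- fromℕ (suc a)) ι-zero
    (solve 3 (λ z x y → (x :- z) :* (y :- con (+ 0))
      := con (+ 1) :- con (+ 0) :+ (y :* x :- con (+ 1)) :* con (+ 1) :+ (z :- con (+ 0)) :* (:- y)) refl (ι 0) (ι (suc a)) (fromℕ (suc a))))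
  κ-difference (suc a) (suc i) (s≤s a<P) (s≤s i<P) = begin
    κ a i * (fromℕ (suc a) - fromℕ (suc i))       ≈⟨ *-congˡ (+-cong (fromℕ-suc a) (-‿cong (fromℕ-suc i))) ⟩
    κ a i * (1# + fromℕ a - (1# + fromℕ i))       ≈⟨ solve 3 (λ k x y → k :* (con (+ 1) :+ x :- (con (+ 1) :+ y)) := k :* (x :- y)) refl (κ a i) (fromℕ a) (fromℕ i) ⟩
    κ a i * (fromℕ a - fromℕ i)                   ≈⟨ κ-difference a i (ℕₚ.m<n⇒m<1+n a<P) (ℕₚ.m<n⇒m<1+n i<P) ⟩
    1# - kronecker a i                            ∎

  κ-zero : ∀ a → κ a 0 ≈ ι a
  κ-zero a rewrite ℕₚ.0∸n≡0 a = relation (- 1#) ι-zero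
    (solve 2 (λ x z → x :- z := x :+ (z :- con (+ 0)) :* (:- con (+ 1))) refl (ι a) (ι 0))

  ι-reflect : ∀ m n → m ℕ.< P → n ℕ.< P → suc m ℕ.+ suc n ≡ p → π * π * ι (suc m) ≈ - (π * π * ι (suc n))
  ι-reflect m n m<P n<P m+n≡p =
    relation (ι (suc m) * ι (suc n)) π³≈0
    (relation (- (π * π * ι (suc m))) (ι-inverse n n<P)
    (relation (- (π * π * ι (suc n))) (ι-inverse m m<P)
    (relation (π * π * ι (suc m) * ι (suc n)) M+N≈π
    (solve 5 (λ t x y M N → t :* t :* x :=
        :- (t :* t :* y) :+ (t :* t :* t :- con (+ 0)) :* (x :* y)
        :+ (N :* y :- con (+ 1)) :* (:- (t :* t :* x)) :+ (M :* x :- con (+ 1)) :* (:- (t :* t :* y))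
        :+ (M :+ N :- t) :* (t :* t :* x :* y)) refl π (ι (suc m)) (ι (suc n)) (fromℕ (suc m)) (fromℕ (suc n))))))
    where
    M+N≈π : fromℕ (suc m) + fromℕ (suc n) ≈ π
    M+N≈π = trans (sym (fromℕ-+ (suc m) (suc n))) (trans (reflexive (≡.cong fromℕ m+n≡p)) fromℕ-p)

  -- The differences `0 - (i + 1)` and `P - i` are equal modulo `p`, hence so are their inverses;
  -- `ι-reflect` is the case of opposite residues.
  κ-wrap : ∀ i → i ℕ.< P → π * π * κ 0 (suc i) ≈ π * π * κ P i
  κ-wrap i i<P with ℕₚ.m≤n⇒∃[o]m+o≡n i<P
  ... | n , ≡.refl = begin
    π * π * (ι 0 - ι (suc i))                             ≈⟨ relation (π * π) ι-zero (solve 3 (λ t z x → t :* t :* (z :- x) := :- (t :* t :* x) :+ (z :- con (+ 0)) :* (t :* t)) refl π (ι 0) (ι (suc i))) ⟩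
    - (π * π * ι (suc i))                                 ≈⟨ ι-reflect n i (s≤s (ℕₚ.m≤n+m n i)) (s≤s (ℕₚ.m≤m+n i n)) (≡.cong suc (≡.trans (ℕₚ.+-suc n i) (≡.cong suc (ℕₚ.+-comm n i)))) ⟨
    π * π * ι (suc n)                                     ≈⟨ relation (π * π) ι-zero (solve 3 (λ t z x → t :* t :* x := t :* t :* (x :- z) :+ (z :- con (+ 0)) :* (t :* t)) refl π (ι 0) (ι (suc n))) ⟩
    π * π * (ι (suc n) - ι 0)                             ≡⟨ ≡.cong₂ (λ k l → π * π * (ι k - ι l)) (≡.sym (≡.trans (≡.cong (_∸ i) (≡.sym (ℕₚ.+-suc i n))) (ℕₚ.m+n∸m≡n i (suc n)))) (≡.sym (ℕₚ.m≤n⇒m∸n≡0 (ℕₚ.≤-trans (ℕₚ.m≤m+n i n) (ℕₚ.n≤1+n _)))) ⟩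
    π * π * (ι (suc (i ℕ.+ n) ∸ i) - ι (i ∸ suc (i ℕ.+ n)))   ∎

  -- A sum over a complete residue system is invariant under translation: raising `i` by one lowers
  -- `a` by one, and only the summand leaving at one end has to be matched with the one entering at
  -- the other.
  ∑-translate : ∀ (f : ℕ → ℕ → Carrier) → (∀ a i → f (suc a) (suc i) ≈ f a i) →
                (∀ i → i ℕ.< P → f 0 (suc i) ≈ f P i) →
                ∀ i → i ℕ.< p → ∑ p (λ a → f a i) ≈ ∑ p (λ a → f a 0)
  ∑-translate f shift wrap zero    _         = refl
  ∑-translate f shift wrap (suc i) (s≤s i<P) = begin
    ∑ (suc P) (λ a → f a (suc i))                         ≈⟨ ∑-suc P _ ⟩
    f 0 (suc i) + ∑ P (λ a → f (suc a) (suc i))           ≈⟨ +-cong (wrap i i<P) (∑-cong′ P λ a → shift a i) ⟩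
    f P i + ∑ P (λ a → f a i)                             ≈⟨ +-comm _ _ ⟩
    ∑ (suc P) (λ a → f a i)                               ≈⟨ ∑-translate f shift wrap i (ℕₚ.m<n⇒m<1+n i<P) ⟩
    ∑ (suc P) (λ a → f a 0)                               ∎

  ∑κ : ∀ i → i ℕ.< p → π * π * ∑ p (λ a → κ a i) ≈ π * π * ∑ p (λ a → κ a 0)
  ∑κ i i<p = begin
    π * π * ∑ p (λ a → κ a i)          ≈⟨ *-distribˡ-∑ p _ _ ⟩
    ∑ p (λ a → π * π * κ a i)          ≈⟨ ∑-translate (λ a i → π * π * κ a i) (λ _ _ → refl) κ-wrap i i<p ⟩
    ∑ p (λ a → π * π * κ a 0)          ≈⟨ *-distribˡ-∑ p _ _ ⟨
    π * π * ∑ p (λ a → κ a 0)          ∎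

  ∑κ² : ∀ i → i ℕ.< p → π * π * ∑ p (λ a → κ a i * κ a i) ≈ π * π * σ₂
  ∑κ² i i<p = begin
    π * π * ∑ p (λ a → κ a i * κ a i)      ≈⟨ *-distribˡ-∑ p _ _ ⟩
    ∑ p (λ a → π * π * (κ a i * κ a i))    ≈⟨ ∑-translate (λ a i → π * π * (κ a i * κ a i)) (λ _ _ → refl) wrap i i<p ⟩
    ∑ p (λ a → π * π * (κ a 0 * κ a 0))    ≈⟨ *-distribˡ-∑ p _ _ ⟨
    π * π * σ₂                             ∎
    where
    wrap : ∀ i → i ℕ.< P → π * π * (κ 0 (suc i) * κ 0 (suc i)) ≈ π * π * (κ P i * κ P i)
    wrap i i<P = relation (κ 0 (suc i) + κ P i) (κ-wrap i i<P)
      (solve 3 (λ t x y → t :* t :* (x :* x) := t :* t :* (y :* y) :+ (t :* t :* x :- t :* t :* y) :* (x :+ y)) refl π (κ 0 (suc i)) (κ P i))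

  -- Partial fractions for `1 / ((a - i) (a - j))`. The last summand repairs the cases `a = i` and
  -- `a = j`, where the left side is zero by convention and the middle one contributes
  -- `- κ i j * κ i j`; the first takes over when `i = j`.
  κ-product : ∀ a i j → a ℕ.< p → i ℕ.< p → j ℕ.< p →
    κ a i * κ a j ≈ kronecker i j * (κ a i * κ a i) + κ i j * (κ a i - κ a j)
                    + κ i j * κ i j * (kronecker a i + kronecker a j)
  κ-product a i j a<p i<p j<p =
    relation (- (κ a i * κ a j)) (κ-difference i j i<p j<p)
    (relation (κ i j * κ a i) (κ-difference a j a<p j<p)
    (relation (- (κ i j * κ a j)) (κ-difference a i a<p i<p)
    (relation (- κ i j) (trans (kronecker-subst a j (λ b → κ b i)) (*-congˡ (κ-antisym j i)))
    (relation (κ i j) (kronecker-subst a i (λ b → κ b j))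
    (relation (κ a i) (sym (kronecker-subst i j (λ b → κ a b)))
    (solve 9 (λ x y k A I J K Kai Kaj → x :* y :=
       K :* (x :* x) :+ k :* (x :- y) :+ k :* k :* (Kai :+ Kaj)
       :+ (k :* (I :- J) :- (con (+ 1) :- K)) :* (:- (x :* y))
       :+ (y :* (A :- J) :- (con (+ 1) :- Kaj)) :* (k :* x)
       :+ (x :* (A :- I) :- (con (+ 1) :- Kai)) :* (:- (k :* y))
       :+ (Kaj :* x :- Kaj :* (:- k)) :* (:- k)
       :+ (Kai :* y :- Kai :* k) :* k
       :+ (K :* y :- K :* x) :* x) refl
       (κ a i) (κ a j) (κ i j) (fromℕ a) (fromℕ i) (fromℕ j) (kronecker i j) (kronecker a i) (kronecker a j)))))))

  ∑-kronecker-1 : ∀ i → i ℕ.< p → ∑ p (λ a → kronecker a i) ≈ 1#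
  ∑-kronecker-1 i i<p = trans (∑-cong′ p λ a → sym (*-identityʳ _)) (∑-kronecker p i (λ _ → 1#) i<p)

  -- The linear sums left by partial fractions cancel, being independent of `i` modulo `π`; what
  -- remains off the diagonal comes from the two repaired positions `a = i` and `a = j`.
  ∑κκ : ∀ i j → i ℕ.< p → j ℕ.< p →
    π * π * ∑ p (λ a → κ a i * κ a j) ≈ π * π * (kronecker i j * σ₂ + (κ i j * κ i j + κ i j * κ i j))
  ∑κκ i j i<p j<p = begin
    π * π * ∑ p (λ a → κ a i * κ a j)
      ≈⟨ *-congˡ (∑-cong p λ a a<p → κ-product a i j a<p i<p j<p) ⟩
    π * π * ∑ p (λ a → K * (κ a i * κ a i) + k * (κ a i - κ a j) + k * k * (kronecker a i + kronecker a j))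
      ≈⟨ *-congˡ (trans (∑-distrib-+ p) (+-cong (trans (∑-distrib-+ p)
           (+-cong (sym (*-distribˡ-∑ p K _)) (trans (sym (*-distribˡ-∑ p k _)) (*-congˡ (trans (∑-distrib-+ p) (+-congˡ (∑-neg p _)))))))
           (trans (sym (*-distribˡ-∑ p (k * k) _)) (*-congˡ (trans (∑-distrib-+ p) (+-cong (∑-kronecker-1 i i<p) (∑-kronecker-1 j j<p))))))) ⟩
    π * π * (K * ∑ p (λ a → κ a i * κ a i) + k * (∑ p (λ a → κ a i) - ∑ p (λ a → κ a j)) + k * k * (1# + 1#))
      ≈⟨ relation K (∑κ² i i<p) (relation k (∑κ i i<p) (relation (- k) (∑κ j j<p)
          (solve 8 (λ t K k S s x y z → t :* t :* (K :* S :+ k :* (x :- y) :+ k :* k :* (con (+ 1) :+ con (+ 1)))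
             := t :* t :* (K :* s :+ (k :* k :+ k :* k)) :+ (t :* t :* S :- t :* t :* s) :* K
                :+ (t :* t :* x :- t :* t :* z) :* k :+ (t :* t :* y :- t :* t :* z) :* (:- k)) refl
             π K k (∑ p (λ a → κ a i * κ a i)) σ₂ (∑ p (λ a → κ a i)) (∑ p (λ a → κ a j)) (∑ p (λ a → κ a 0))))) ⟩
    π * π * (K * σ₂ + (k * k + k * k)) ∎
    where
    K k : Carrier
    K = kronecker i j
    k = κ i j

  -- Write `e₁ = π t₁` and `e₂ = π t₂`. Off the diagonal, the summands `a = i` and `a = j` give
  -- `- κ² (e₁² + e₂²)` in second order and `∑κκ` gives `2 κ² e₁ e₂`. Together they form a square in
  -- `e₂ - e₁`, so that a common shift of `t₁` and `t₂` is seen on the diagonal alone.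
  ∑ww : ∀ i j t₁ t₂ → i ℕ.< p → j ℕ.< p →
    ∑ p (λ a → w a i (π * t₁) * w a j (π * t₂)) ≈
      kronecker i j * (1# + π * π * (t₁ * t₂ * σ₂)) + κ i j * (π * (t₂ - t₁)) - κ i j * κ i j * (π * (t₂ - t₁)) * (π * (t₂ - t₁))
  ∑ww i j t₁ t₂ i<p j<p = begin
    ∑ p (λ a → w a i (π * t₁) * w a j (π * t₂))
      ≈⟨ ∑-cong′ p (λ a → relation (- (κ a i * κ a j * κ a j * t₁ * t₂ * t₂ + κ a i * κ a i * κ a j * t₁ * t₁ * t₂) + π * κ a i * κ a i * κ a j * κ a j * t₁ * t₁ * t₂ * t₂) π³≈0
          (solve 7 (λ t t₁ t₂ x y X Y →
            (X :+ (x :* (t :* t₁) :- x :* x :* (t :* t₁) :* (t :* t₁))) :* (Y :+ (y :* (t :* t₂) :- y :* y :* (t :* t₂) :* (t :* t₂)))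
            := X :* (Y :+ (y :* (t :* t₂) :- y :* y :* (t :* t₂) :* (t :* t₂)))
               :+ Y :* (x :* (t :* t₁) :- x :* x :* (t :* t₁) :* (t :* t₁)) :+ t :* t :* t₁ :* t₂ :* (x :* y)
               :+ (t :* t :* t :- con (+ 0)) :* (:- (x :* y :* y :* t₁ :* t₂ :* t₂ :+ x :* x :* y :* t₁ :* t₁ :* t₂) :+ t :* x :* x :* y :* y :* t₁ :* t₁ :* t₂ :* t₂))
           refl π t₁ t₂ (κ a i) (κ a j) (kronecker a i) (kronecker a j))) ⟩
    ∑ p (λ a → kronecker a i * w a j (π * t₂) + kronecker a j * v a + π * π * t₁ * t₂ * (κ a i * κ a j))
      ≈⟨ trans (∑-distrib-+ p) (+-cong (trans (∑-distrib-+ p)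
           (+-cong (∑-kronecker p i (λ a → w a j (π * t₂)) i<p) (∑-kronecker p j v j<p))) (sym (*-distribˡ-∑ p _ _))) ⟩
    w i j (π * t₂) + v j + π * π * t₁ * t₂ * T
      ≈⟨ relation (t₁ * t₂) (∑κκ i j i<p j<p) (relation (π * t₁ - (κ j i - κ i j) * (π * t₁) * (π * t₁)) (κ-antisym j i)
         (solve 8 (λ t t₁ t₂ K k l s T →
           K :+ (k :* (t :* t₂) :- k :* k :* (t :* t₂) :* (t :* t₂)) :+ (l :* (t :* t₁) :- l :* l :* (t :* t₁) :* (t :* t₁)) :+ t :* t :* t₁ :* t₂ :* T
           := K :* (con (+ 1) :+ t :* t :* (t₁ :* t₂ :* s)) :+ k :* (t :* (t₂ :- t₁)) :- k :* k :* (t :* (t₂ :- t₁)) :* (t :* (t₂ :- t₁))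
              :+ (t :* t :* T :- t :* t :* (K :* s :+ (k :* k :+ k :* k))) :* (t₁ :* t₂)
              :+ (l :- :- k) :* (t :* t₁ :- (l :- k) :* (t :* t₁) :* (t :* t₁)))
           refl π t₁ t₂ (kronecker i j) (κ i j) (κ j i) σ₂ T)) ⟩
    _ ∎
    where
    v : ℕ → Carrier
    v a = κ a i * (π * t₁) - κ a i * κ a i * (π * t₁) * (π * t₁)
    T : Carrier
    T = ∑ p (λ a → κ a i * κ a j)

  interpolate : (ℕ → Carrier) → Carrier → ℕ → Carrier
  interpolate c e a = ∑ p (λ i → c i * w a i e)

  ∑-interpolate : ∀ c c′ e e′ →
    ∑ p (λ a → interpolate c e a * interpolate c′ e′ a)
      ≈ ∑ p (λ i → ∑ p (λ j → c i * c′ j * ∑ p (λ a → w a i e * w a j e′)))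
  ∑-interpolate c c′ e e′ = begin
    ∑ p (λ a → interpolate c e a * interpolate c′ e′ a)
      ≈⟨ ∑-cong′ p (λ a → ∑-* p p _ _) ⟩
    ∑ p (λ a → ∑ p (λ i → ∑ p (λ j → c i * w a i e * (c′ j * w a j e′))))
      ≈⟨ ∑-comm p p _ ⟩
    ∑ p (λ i → ∑ p (λ a → ∑ p (λ j → c i * w a i e * (c′ j * w a j e′))))
      ≈⟨ ∑-cong′ p (λ i → ∑-comm p p _) ⟩
    ∑ p (λ i → ∑ p (λ j → ∑ p (λ a → c i * w a i e * (c′ j * w a j e′))))
      ≈⟨ ∑-cong′ p (λ i → ∑-cong′ p (λ j → trans
           (∑-cong′ p λ a → solve 4 (λ c w d v → c :* w :* (d :* v) := c :* d :* (w :* v)) refl (c i) (w a i e) (c′ j) (w a j e′))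
           (sym (*-distribˡ-∑ p _ _)))) ⟩
    _ ∎

  ∑ww-shift : ∀ i j β u₁ u₂ → i ℕ.< p → j ℕ.< p →
    ∑ p (λ a → w a i (π * (β + u₁)) * w a j (π * (β + u₂)))
      ≈ ∑ p (λ a → w a i (π * (0# + u₁)) * w a j (π * (0# + u₂)))
        + kronecker j i * (π * π * σ₂ * (β * (β + u₁ + u₂)))
  ∑ww-shift i j β u₁ u₂ i<p j<p = begin
    _ ≈⟨ ∑ww i j (β + u₁) (β + u₂) i<p j<p ⟩
    _ ≈⟨ relation (- (π * π * σ₂ * (β * (β + u₁ + u₂)))) (kronecker-sym j i)
         (solve 8 (λ t b u₁ u₂ K L k s →
           K :* (con (+ 1) :+ t :* t :* ((b :+ u₁) :* (b :+ u₂) :* s)) :+ k :* (t :* (b :+ u₂ :- (b :+ u₁))) :- k :* k :* (t :* (b :+ u₂ :- (b :+ u₁))) :* (t :* (b :+ u₂ :- (b :+ u₁)))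
           := K :* (con (+ 1) :+ t :* t :* ((con (+ 0) :+ u₁) :* (con (+ 0) :+ u₂) :* s)) :+ k :* (t :* (con (+ 0) :+ u₂ :- (con (+ 0) :+ u₁))) :- k :* k :* (t :* (con (+ 0) :+ u₂ :- (con (+ 0) :+ u₁))) :* (t :* (con (+ 0) :+ u₂ :- (con (+ 0) :+ u₁)))
              :+ L :* (t :* t :* s :* (b :* (b :+ u₁ :+ u₂))) :+ (L :- K) :* (:- (t :* t :* s :* (b :* (b :+ u₁ :+ u₂)))))
         refl π β u₁ u₂ (kronecker i j) (kronecker j i) (κ i j) σ₂) ⟩
    _ ≈⟨ +-congʳ (∑ww i j (0# + u₁) (0# + u₂) i<p j<p) ⟨
    _ ∎

  ∑-interpolate-shift : ∀ c c′ β u₁ u₂ →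
    ∑ p (λ a → interpolate c (π * (β + u₁)) a * interpolate c′ (π * (β + u₂)) a)
      ≈ ∑ p (λ a → interpolate c (π * (0# + u₁)) a * interpolate c′ (π * (0# + u₂)) a)
        + π * π * σ₂ * (β * (β + u₁ + u₂)) * ∑ p (λ a → c a * c′ a)
  ∑-interpolate-shift c c′ β u₁ u₂ = begin
    _ ≈⟨ ∑-interpolate c c′ _ _ ⟩
    _ ≈⟨ ∑-cong p (λ i i<p → ∑-cong p (λ j j<p → trans (*-congˡ (∑ww-shift i j β u₁ u₂ i<p j<p))
           (solve 5 (λ c d S k x → c :* d :* (S :+ k :* x) := c :* d :* S :+ k :* (c :* d :* x)) refl (c i) (c′ j) _ (kronecker j i) X))) ⟩
    ∑ p (λ i → ∑ p (λ j → c i * c′ j * S₀ i j + kronecker j i * (c i * c′ j * X)))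
      ≈⟨ ∑-cong p (λ i i<p → trans (∑-distrib-+ p) (+-congˡ (trans (∑-kronecker p i (λ j → c i * c′ j * X) i<p) (*-comm _ _)))) ⟩
    ∑ p (λ i → ∑ p (λ j → c i * c′ j * S₀ i j) + X * (c i * c′ i))
      ≈⟨ trans (∑-distrib-+ p) (+-cong (sym (∑-interpolate c c′ _ _)) (sym (*-distribˡ-∑ p X _))) ⟩
    _ ∎
    where
    X : Carrier
    X = π * π * σ₂ * (β * (β + u₁ + u₂))
    S₀ : ℕ → ℕ → Carrier
    S₀ i j = ∑ p (λ a → w a i (π * (0# + u₁)) * w a j (π * (0# + u₂)))

  -- Modulo `π` the weight `w a i` is the Kronecker symbol, so interpolation returns the coefficient
  -- at the node.
  interpolate-mod : ∀ c t a → a ℕ.< p → π * π * interpolate c (π * t) a ≈ π * π * c a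
  interpolate-mod c t a a<p = trans (*-distribˡ-∑ p _ _) (begin
    ∑ p (λ i → π * π * (c i * w a i (π * t)))
      ≈⟨ ∑-cong′ p (λ i → relation (c i * (κ a i * t) - c i * κ a i * κ a i * π * t * t) π³≈0
         (relation (π * π * c i) (kronecker-sym a i)
         (solve 6 (λ r c K L k t → r :* r :* (c :* (K :+ (k :* (r :* t) :- k :* k :* (r :* t) :* (r :* t))))
            := L :* (r :* r :* c) :+ (r :* r :* r :- con (+ 0)) :* (c :* (k :* t) :- c :* k :* k :* r :* t :* t)
               :+ (K :- L) :* (r :* r :* c))
            refl π (c i) (kronecker a i) (kronecker i a) (κ a i) t))) ⟩
    ∑ p (λ i → kronecker i a * (π * π * c i))    ≈⟨ ∑-kronecker p a (λ i → π * π * c i) a<p ⟩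
    π * π * c a                                  ∎)

  -- Up to sign, the contribution of one parameter to A (a + p β) / A β.
  local : (h c : ℕ → Carrier) → Carrier → Carrier → ℕ → Carrier
  local h c u β a = (1# - π * π * (u * u) * (β * σ₂ + h a)) * interpolate c (π * (β + u)) a

  module _ (h c c′ : ℕ → Carrier) (u₁ u₂ : Carrier) where

    private
      Z L : Carrier
      Z = ∑ p (λ a → c a * c′ a)
      L = ∑ p (λ a → h a * (c a * c′ a))

      main : Carrier → Carrier
      main β = ∑ p (λ a → interpolate c (π * (β + u₁)) a * interpolate c′ (π * (β + u₂)) a)

      ∑-local-expand : ∀ β → ∑ p (λ a → local h c u₁ β a * local h c′ u₂ β a)
        ≈ main β - π * π * (u₁ * u₁ + u₂ * u₂) * (β * σ₂ * Z + L)
      ∑-local-expand β = begin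
        _ ≈⟨ ∑-cong p (λ a a<p →
               let I = interpolate c (π * (β + u₁)) a; J = interpolate c′ (π * (β + u₂)) a; s = β * σ₂ + h a in
               relation (π * u₁ * u₁ * u₂ * u₂ * s * s * I * J) π³≈0
               (relation (- ((u₁ * u₁ + u₂ * u₂) * s * J)) (interpolate-mod c (β + u₁) a a<p)
               (relation (- ((u₁ * u₁ + u₂ * u₂) * s * c a)) (interpolate-mod c′ (β + u₂) a a<p)
               (solve 10 (λ t u v b s h I J c d →
                 (con (+ 1) :- t :* t :* (u :* u) :* (b :* s :+ h)) :* I :* ((con (+ 1) :- t :* t :* (v :* v) :* (b :* s :+ h)) :* J)
                 := I :* J :+ ((:- (t :* t :* (u :* u :+ v :* v))) :* (b :* s) :* (c :* d) :+ (:- (t :* t :* (u :* u :+ v :* v))) :* (h :* (c :* d)))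
                    :+ (t :* t :* t :- con (+ 0)) :* (t :* u :* u :* v :* v :* (b :* s :+ h) :* (b :* s :+ h) :* I :* J)
                    :+ (t :* t :* I :- t :* t :* c) :* (:- ((u :* u :+ v :* v) :* (b :* s :+ h) :* J))
                    :+ (t :* t :* J :- t :* t :* d) :* (:- ((u :* u :+ v :* v) :* (b :* s :+ h) :* c)))
               refl π u₁ u₂ β σ₂ (h a) I J (c a) (c′ a))))) ⟩
        ∑ p (λ a → interpolate c (π * (β + u₁)) a * interpolate c′ (π * (β + u₂)) a
                   + (- q * (β * σ₂) * (c a * c′ a) + - q * (h a * (c a * c′ a))))
          ≈⟨ trans (∑-distrib-+ p) (+-congˡ (trans (∑-distrib-+ p) (+-cong (sym (*-distribˡ-∑ p _ _)) (sym (*-distribˡ-∑ p _ _))))) ⟩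
        main β + (- q * (β * σ₂) * Z + - q * L)
          ≈⟨ solve 5 (λ m q x Z L → m :+ (:- q :* x :* Z :+ :- q :* L) := m :- q :* (x :* Z :+ L)) refl (main β) q (β * σ₂) Z L ⟩
        main β - q * (β * σ₂ * Z + L) ∎
        where
        q : Carrier
        q = π * π * (u₁ * u₁ + u₂ * u₂)

    -- Interpolation contributes `β (β + u₁ + u₂)`, the factors with squares contribute
    -- `- β (u₁² + u₂²)`. Their sum involves the parameters only through `u (1 - u)`, which is
    -- invariant under reflection; this allows passing from `u₁`, `u₂` to `r₁`, `r₂` later.
    ∑-local : ∀ β → ∑ p (λ a → local h c u₁ β a * local h c′ u₂ β a)
      ≈ ∑ p (λ a → local h c u₁ 0# a * local h c′ u₂ 0# a)
        + π * π * σ₂ * (β * (u₁ * (1# - u₁) + u₂ * (1# - u₂) + β)) * ∑ p (λ a → c a * c′ a)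
    ∑-local β = begin
      _ ≈⟨ ∑-local-expand β ⟩
      _ ≈⟨ +-congʳ (∑-interpolate-shift c c′ β u₁ u₂) ⟩
      _ ≈⟨ solve 8 (λ m t s b u v Z L →
             m :+ t :* t :* s :* (b :* (b :+ u :+ v)) :* Z :- t :* t :* (u :* u :+ v :* v) :* (b :* s :* Z :+ L)
             := m :- t :* t :* (u :* u :+ v :* v) :* (con (+ 0) :* s :* Z :+ L)
                :+ t :* t :* s :* (b :* (u :* (con (+ 1) :- u) :+ v :* (con (+ 1) :- v) :+ b)) :* Z)
           refl (main 0#) π σ₂ β u₁ u₂ Z L ⟩
      _ ≈⟨ +-congʳ (∑-local-expand 0#) ⟨
      _ ∎

  -- The inverse is the geometric series in `π * t`, which stops after the quadratic term.
  unit-shift : ∀ {x} t → IsUnit x → IsUnit (x + π * t)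
  unit-shift {x} t (v , xv≈1) = v - v * v * (π * t) + v * v * v * (π * t) * (π * t) ,
    relation (1# - v * (π * t) + v * v * (π * t) * (π * t)) xv≈1 (relation (v * v * v * t * t * t) π³≈0
    (solve 4 (λ x v p t → (x :+ p :* t) :* (v :- v :* v :* (p :* t) :+ v :* v :* v :* (p :* t) :* (p :* t))
      := con (+ 1) :+ (x :* v :- con (+ 1)) :* (con (+ 1) :- v :* (p :* t) :+ v :* v :* (p :* t) :* (p :* t))
         :+ (p :* p :* p :- con (+ 0)) :* (v :* v :* v :* t :* t :* t)) refl x v π t))

  unit-difference : ∀ a i t → a ℕ.< p → i ℕ.< p → a ≢ i → IsUnit (fromℕ a + π * t - fromℕ i)
  unit-difference a i t a<p i<p a≢i = unit-resp
    (solve 3 (λ a i e → a :- i :+ e := a :+ e :- i) refl (fromℕ a) (fromℕ i) (π * t))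
    (unit-shift t (κ a i , relation 1# (κ-difference a i a<p i<p) (relation (- 1#) (kronecker-≢ a≢i)
      (solve 4 (λ a i k K → (a :- i) :* k := con (+ 1) :+ (k :* (a :- i) :- (con (+ 1) :- K)) :* con (+ 1) :+ (K :- con (+ 0)) :* (:- con (+ 1)))
        refl (fromℕ a) (fromℕ i) (κ a i) (kronecker a i)))))

  -- The Lagrange basis polynomial for the nodes below `n`, left unnormalised: its value at its own
  -- node is absorbed by the coefficients.
  lagrange : ℕ → ℕ → Carrier → Carrier
  lagrange n i y = ∏ n (λ j → omit i j (y - fromℕ j))

  unit-lagrange : ∀ a t → a ℕ.< p → IsUnit (lagrange p a (fromℕ a + π * t))
  unit-lagrange a t a<p = unit-∏ p _ factor
    where
    factor : ∀ i → i ℕ.< p → IsUnit (omit a i (fromℕ a + π * t - fromℕ i))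
    factor i i<p with a ℕₚ.≟ i
    ... | yes ≡.refl = unit-resp (sym (omit-refl a _)) unit-1
    ... | no a≢i     = unit-resp (sym (omit-≢ _ a≢i)) (unit-difference a i t a<p i<p a≢i)

  -- For `a ≢ i`, each of the two basis polynomials becomes the full product over the nodes once its
  -- missing factor is restored. The factor `y - fromℕ i` is a unit and can be cancelled;
  -- `y - fromℕ a = π * t` is not, and turns into the numerator of `w`.
  lagrange-w : ∀ a i t → a ℕ.< p → i ℕ.< p →
    lagrange p i (fromℕ a + π * t) ≈ lagrange p a (fromℕ a + π * t) * w a i (π * t)
  lagrange-w a i t a<p i<p with a ℕₚ.≟ i
  ... | yes ≡.refl = relation (- (V * (π * t - (κ a a * (π * t)) * (π * t)))) (-‿inverseʳ (ι (a ∸ a))) (relation (- V) (kronecker-refl a)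
        (solve 4 (λ V K k e → V := V :* (K :+ (k :* e :- k :* k :* e :* e)) :+ (k :- con (+ 0)) :* (:- (V :* (e :- (k :* e) :* e))) :+ (K :- con (+ 1)) :* (:- V))
          refl V (kronecker a a) (κ a a) (π * t)))
    where
    V : Carrier
    V = lagrange p a (fromℕ a + π * t)
  ... | no a≢i = unit-cancelʳ (unit-difference a i t a<p i<p a≢i) (begin
    lagrange p i y * (y - fromℕ i)    ≈⟨ ∏-omit p i (λ j → y - fromℕ j) i<p ⟩
    ∏ p (λ j → y - fromℕ j)           ≈⟨ ∏-omit p a (λ j → y - fromℕ j) a<p ⟨
    V * (y - fromℕ a)
      ≈⟨ relation (- (V * (π * t - κ a i * (π * t) * (π * t)))) (κ-difference a i a<p i<p)
         (relation (- (V * (y - fromℕ i - π * t + κ a i * (π * t) * (π * t)))) (kronecker-≢ a≢i)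
         (relation (V * κ a i * κ a i * t * t * t) π³≈0
         (solve 7 (λ V A I r t k K →
           V :* (A :+ r :* t :- A) := V :* (K :+ (k :* (r :* t) :- k :* k :* (r :* t) :* (r :* t))) :* (A :+ r :* t :- I)
             :+ (k :* (A :- I) :- (con (+ 1) :- K)) :* (:- (V :* (r :* t :- k :* (r :* t) :* (r :* t))))
             :+ (K :- con (+ 0)) :* (:- (V :* (A :+ r :* t :- I :- r :* t :+ k :* (r :* t) :* (r :* t))))
             :+ (r :* r :* r :- con (+ 0)) :* (V :* k :* k :* t :* t :* t))
           refl V (fromℕ a) (fromℕ i) π t (κ a i) (kronecker a i)))) ⟩
    V * w a i (π * t) * (y - fromℕ i) ∎)
    where
    y V : Carrier
    y = fromℕ a + π * t
    V = lagrange p a y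

  lagrange-last : ∀ n i y → i ℕ.< n → lagrange (suc n) i y ≈ lagrange n i y * (y - fromℕ n)
  lagrange-last n i y i<n = *-congˡ (omit-≢ _ (ℕₚ.<⇒≢ i<n))

  lagrange-new : ∀ n y → lagrange (suc n) n y ≈ ∏ n (λ j → y - fromℕ j)
  lagrange-new n y = trans (*-cong (∏-omit-outside n n _ ℕₚ.≤-refl) (omit-refl n _)) (*-identityʳ _)

  -- Adding one linear factor and one node at a time avoids any appeal to the uniqueness of
  -- interpolating polynomials, which is delicate in a ring with zero divisors. The bound `k ≤ P`
  -- keeps differences of distinct nodes invertible.
  lagrange-expansion : ∀ (τ : ℕ → Carrier) k → k ℕ.≤ P →
    ∃ λ (c : ℕ → Carrier) → ∀ y → ∏ k (λ n → y - τ n) ≈ ∑ (suc k) (λ i → c i * lagrange (suc k) i y)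
  lagrange-expansion τ zero    _   = (λ _ → 1#) , λ y → solve 0 (con (+ 1) := con (+ 0) :+ con (+ 1) :* (con (+ 1) :* con (+ 1))) refl
  lagrange-expansion τ (suc k) k<P with lagrange-expansion τ k (ℕₚ.<⇒≤ k<P)
  ... | c , expansion = c′ , λ y → begin
    ∏ k (λ n → y - τ n) * (y - τ k)
      ≈⟨ *-congʳ (expansion y) ⟩
    ∑ n (λ i → c i * lagrange n i y) * (y - τ k)
      ≈⟨ *-distribʳ-∑ n _ _ ⟩
    ∑ n (λ i → c i * lagrange n i y * (y - τ k))
      ≈⟨ ∑-cong n (step y) ⟩
    ∑ n (λ i → c′ i * lagrange (suc n) i y + c i * (1# - α i) * lagrange (suc n) n y)
      ≈⟨ trans (∑-distrib-+ n) (+-congˡ (sym (*-distribʳ-∑ n _ _))) ⟩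
    ∑ n (λ i → c′ i * lagrange (suc n) i y) + S * lagrange (suc n) n y
      ≈⟨ +-congˡ (*-congʳ last) ⟨
    ∑ (suc n) (λ i → c′ i * lagrange (suc n) i y) ∎
    where
    n : ℕ
    n = suc k
    -- y - τ k = α i (y - n) + (1 - α i) (y - i).
    α c′ : ℕ → Carrier
    S : Carrier
    α i = (τ k - fromℕ i) * κ n i
    S = ∑ n (λ i → c i * (1# - α i))
    c′ i = c i * α i + kronecker i n * S
    -- The old coefficient `c n` lies outside the range of the expansion and is arbitrary; it is
    -- removed by `κ n n`, which is zero.
    last : c′ n ≈ S
    last = relation (c n * (τ k - fromℕ n)) (-‿inverseʳ (ι (n ∸ n))) (relation S (kronecker-refl n)
      (solve 5 (λ c t k K S → c :* (t :* k) :+ K :* S := S :+ (k :- con (+ 0)) :* (c :* t) :+ (K :- con (+ 1)) :* S)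
        refl (c n) (τ k - fromℕ n) (κ n n) (kronecker n n) S))
    step : ∀ y i → i ℕ.< n → c i * lagrange n i y * (y - τ k)
      ≈ c′ i * lagrange (suc n) i y + c i * (1# - α i) * lagrange (suc n) n y
    step y i i<n =
      relation (- (c′ i)) (lagrange-last n i y i<n)
      (relation (- (c i * (1# - α i))) (trans (lagrange-new n y) (sym (∏-omit n i (λ j → y - fromℕ j) i<n)))
      (relation (- (S * lagrange n i y * (y - fromℕ n))) (kronecker-≢ (ℕₚ.<⇒≢ i<n))
      (relation (c i * lagrange n i y * (τ k - fromℕ i)) (κ-difference n i (s≤s k<P) (ℕₚ.<-trans i<n (s≤s k<P)))
      (relation (- (c i * lagrange n i y * (τ k - fromℕ i))) (kronecker-≢ (≡.≢-sym (ℕₚ.<⇒≢ i<n)))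
      (solve 12 (λ c t y l l′ L k N I K K′ S → c :* l :* (y :- t)
        := (c :* ((t :- I) :* k) :+ K :* S) :* l′ :+ c :* (con (+ 1) :- (t :- I) :* k) :* L
           :+ (l′ :- l :* (y :- N)) :* (:- (c :* ((t :- I) :* k) :+ K :* S))
           :+ (L :- l :* (y :- I)) :* (:- (c :* (con (+ 1) :- (t :- I) :* k)))
           :+ (K :- con (+ 0)) :* (:- (S :* l :* (y :- N)))
           :+ (k :* (N :- I) :- (con (+ 1) :- K′)) :* (c :* l :* (t :- I))
           :+ (K′ :- con (+ 0)) :* (:- (c :* l :* (t :- I))))
        refl (c i) (τ k) y (lagrange n i y) (lagrange (suc n) i y) (lagrange (suc n) n y) (κ n i) (fromℕ n) (fromℕ i)
          (kronecker i n) (kronecker n i) S)))))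

  -- The coefficients are chosen before `a` and `t`. So one family serves all digits `a` and all
  -- `b`, as the comparison of different blocks requires.
  interpolation : ∀ (τ : ℕ → Carrier) → ∃ λ (c : ℕ → Carrier) → ∀ a t → a ℕ.< p →
    ∏ P (λ n → fromℕ a + π * t - τ n) ≈ lagrange p a (fromℕ a + π * t) * interpolate c (π * t) a
  interpolation τ with lagrange-expansion τ P ℕₚ.≤-refl
  ... | c , expansion = c , λ a t a<p → begin
    ∏ P (λ n → fromℕ a + π * t - τ n)
      ≈⟨ expansion (fromℕ a + π * t) ⟩
    ∑ p (λ i → c i * lagrange p i (fromℕ a + π * t))
      ≈⟨ ∑-cong p (λ i i<p → trans (*-congˡ (lagrange-w a i t a<p i<p))
           (solve 3 (λ c V w → c :* (V :* w) := V :* (c :* w)) refl (c i) _ _)) ⟩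
    ∑ p (λ i → lagrange p a (fromℕ a + π * t) * (c i * w a i (π * t)))
      ≈⟨ *-distribˡ-∑ p _ _ ⟨
    lagrange p a (fromℕ a + π * t) * interpolate c (π * t) a ∎

  harmonic₂ : ℕ → Carrier
  harmonic₂ a = ∑ a (λ i → ι (suc i) * ι (suc i))

  σ₂-harmonic : σ₂ ≈ harmonic₂ P
  σ₂-harmonic = begin
    ∑ (suc P) (λ a → κ a 0 * κ a 0)                       ≈⟨ ∑-suc P _ ⟩
    κ 0 0 * κ 0 0 + ∑ P (λ a → κ (suc a) 0 * κ (suc a) 0)  ≈⟨ relation (κ 0 0) (-‿inverseʳ (ι 0)) (solve 2 (λ k s → k :* k :+ s := s :+ (k :- con (+ 0)) :* k) refl (κ 0 0) _) ⟩
    ∑ P (λ a → κ (suc a) 0 * κ (suc a) 0)                 ≈⟨ ∑-cong′ P (λ a → *-cong (κ-zero (suc a)) (κ-zero (suc a))) ⟩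
    harmonic₂ P                                           ∎

  fromℕ-digits : ∀ n i → fromℕ (n ℕ.* p ℕ.+ i) ≈ fromℕ i + π * fromℕ n
  fromℕ-digits n i = begin
    fromℕ (n ℕ.* p ℕ.+ i)           ≈⟨ trans (fromℕ-+ (n ℕ.* p) i) (+-congʳ (fromℕ-* n p)) ⟩
    fromℕ n * fromℕ p + fromℕ i     ≈⟨ +-congʳ (*-congˡ fromℕ-p) ⟩
    fromℕ n * π + fromℕ i           ≈⟨ trans (+-comm _ _) (+-congˡ (*-comm _ _)) ⟩
    fromℕ i + π * fromℕ n           ∎

  unit-coprime : ∀ n i → i ℕ.< P → IsUnit (fromℕ (n ℕ.* p ℕ.+ suc i))
  unit-coprime n i i<P = unit-resp (sym (fromℕ-digits n (suc i))) (unit-shift (fromℕ n) (ι (suc i) , ι-inverse i i<P))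

  unit-∏-coprime : ∀ b a → a ℕ.≤ P → IsUnit (∏-coprime P b a fromℕ)
  unit-∏-coprime b a a≤P = unit-*
    (unit-∏ b _ λ n _ → unit-∏ P _ λ i i<P → unit-coprime n i i<P)
    (unit-∏ a _ λ i i<a → unit-coprime b i (ℕₚ.<-≤-trans i<a a≤P))

  private
    module _ (u : Carrier) where
      G : ℕ → Carrier
      G k = fromℕ k * fromℕ k - π * u * (π * u)

      -- Each factor is `k² (1 - π² u² / k²)`. Products of two corrections vanish, so these add up,
      -- and next to `π²` the number `k` may be replaced by its last digit.
      block : ∀ n m → m ℕ.≤ P → ∏ m (λ i → G (n ℕ.* p ℕ.+ suc i))
        ≈ ∏ m (λ i → fromℕ (n ℕ.* p ℕ.+ suc i)) * ∏ m (λ i → fromℕ (n ℕ.* p ℕ.+ suc i)) * (1# - π * π * (u * u) * harmonic₂ m)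
      block n zero    m≤P = solve 2 (λ t u → con (+ 1) := con (+ 1) :* con (+ 1) :* (con (+ 1) :- t :* t :* (u :* u) :* con (+ 0))) refl π u
      block n (suc m) m<P = trans (*-congʳ (block n m (ℕₚ.<⇒≤ m<P)))
        (relation (π * D * D * u * u * u * u * h + D * D * u * u * x * x * (J * b + b * J + π * b * b)) π³≈0
        (relation (π * π * D * D * u * u * (1# + J * x)) (ι-inverse m m<P)
        (relation (π * π * D * D * u * u * x * x * (z + J + π * b)) (fromℕ-digits n (suc m))
        (solve 8 (λ D z t u h x J b →
          D :* D :* (con (+ 1) :- t :* t :* (u :* u) :* h) :* (z :* z :- t :* u :* (t :* u))
          := D :* z :* (D :* z) :* (con (+ 1) :- t :* t :* (u :* u) :* (h :+ x :* x))
             :+ (t :* t :* t :- con (+ 0)) :* (t :* D :* D :* u :* u :* u :* u :* h :+ D :* D :* u :* u :* x :* x :* (J :* b :+ b :* J :+ t :* b :* b))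
             :+ (J :* x :- con (+ 1)) :* (t :* t :* D :* D :* u :* u :* (con (+ 1) :+ J :* x))
             :+ (z :- (J :+ t :* b)) :* (t :* t :* D :* D :* u :* u :* x :* x :* (z :+ J :+ t :* b)))
          refl D z π u h x J b))))
        where
        D z h x J b : Carrier
        D = ∏ m (λ i → fromℕ (n ℕ.* p ℕ.+ suc i))
        z = fromℕ (n ℕ.* p ℕ.+ suc m)
        h = harmonic₂ m
        x = ι (suc m)
        J = fromℕ (suc m)
        b = fromℕ n

      blocks : ∀ b → ∏ b (λ n → ∏ P (λ i → G (n ℕ.* p ℕ.+ suc i)))
        ≈ ∏ b (λ n → ∏ P (λ i → fromℕ (n ℕ.* p ℕ.+ suc i))) * ∏ b (λ n → ∏ P (λ i → fromℕ (n ℕ.* p ℕ.+ suc i)))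
          * (1# - π * π * (u * u) * (fromℕ b * σ₂))
      blocks zero    = solve 3 (λ t u s → con (+ 1) := con (+ 1) :* con (+ 1) :* (con (+ 1) :- t :* t :* (u :* u) :* (con (+ 0) :* s))) refl π u σ₂
      blocks (suc b) = trans (*-cong (blocks b) (block b P ℕₚ.≤-refl))
        (relation (π * E * E * D * D * u * u * u * u * fromℕ b * σ₂ * h) π³≈0
        (relation (E * E * D * D * π * π * u * u) σ₂-harmonic
        (relation (E * E * D * D * π * π * u * u * σ₂) (fromℕ-suc b)
        (solve 8 (λ E D t u s h b c →
          E :* E :* (con (+ 1) :- t :* t :* (u :* u) :* (b :* s)) :* (D :* D :* (con (+ 1) :- t :* t :* (u :* u) :* h))
          := E :* D :* (E :* D) :* (con (+ 1) :- t :* t :* (u :* u) :* (c :* s))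
             :+ (t :* t :* t :- con (+ 0)) :* (t :* E :* E :* D :* D :* u :* u :* u :* u :* b :* s :* h)
             :+ (s :- h) :* (E :* E :* D :* D :* t :* t :* u :* u)
             :+ (c :- (con (+ 1) :+ b)) :* (E :* E :* D :* D :* t :* t :* u :* u :* s))
          refl E D π u σ₂ h (fromℕ b) (fromℕ (suc b))))))
        where
        E D h : Carrier
        E = ∏ b (λ n → ∏ P (λ i → fromℕ (n ℕ.* p ℕ.+ suc i)))
        D = ∏ P (λ i → fromℕ (b ℕ.* p ℕ.+ suc i))
        h = harmonic₂ P

  ∏-coprime-squares : ∀ u b a → a ℕ.≤ P →
    ∏-coprime P b a (λ k → fromℕ k * fromℕ k - π * u * (π * u))
      ≈ ∏-coprime P b a fromℕ * ∏-coprime P b a fromℕ * (1# - π * π * (u * u) * (fromℕ b * σ₂ + harmonic₂ a))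
  ∏-coprime-squares u b a a≤P = trans (*-cong (blocks u b) (block u b a a≤P))
    (relation (π * E * E * D * D * u * u * u * u * s * h) π³≈0
    (solve 6 (λ E D t u s h →
      E :* E :* (con (+ 1) :- t :* t :* (u :* u) :* s) :* (D :* D :* (con (+ 1) :- t :* t :* (u :* u) :* h))
      := E :* D :* (E :* D) :* (con (+ 1) :- t :* t :* (u :* u) :* (s :+ h))
         :+ (t :* t :* t :- con (+ 0)) :* (t :* E :* E :* D :* D :* u :* u :* u :* u :* s :* h))
      refl E D π u s h))
    where
    E D s h : Carrier
    E = ∏ b (λ n → ∏ P (λ i → fromℕ (n ℕ.* p ℕ.+ suc i)))
    D = ∏ a (λ i → fromℕ (b ℕ.* p ℕ.+ suc i))
    s = fromℕ b * σ₂
    h = harmonic₂ a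

  ι-double : ∀ m n c → m ℕ.< P → n ℕ.< P → fromℕ 2 * fromℕ (suc m) ≈ fromℕ (suc n) + π * c →
    π * π * (ι (suc m) * ι (suc m)) ≈ fromℕ 4 * (π * π * (ι (suc n) * ι (suc n)))
  ι-double m n c m<P n<P 2M≈N =
    relation (π * π * (x + fromℕ 2 * y - π * c * x * y)) x≈
    (relation (π * c * c * x * x * y * y - fromℕ 4 * c * x * y * y) π³≈0
    (solve 4 (λ t c x y → t :* t :* (x :* x) := con (+ 4) :* (t :* t :* (y :* y))
       :+ (x :- (con (+ 2) :* y :- t :* c :* x :* y)) :* (t :* t :* (x :+ con (+ 2) :* y :- t :* c :* x :* y))
       :+ (t :* t :* t :- con (+ 0)) :* (t :* c :* c :* x :* x :* y :* y :- con (+ 4) :* c :* x :* y :* y) ) refl π c x y))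
    where
    x y : Carrier
    x = ι (suc m)
    y = ι (suc n)
    x≈ : x ≈ fromℕ 2 * y - π * c * x * y
    x≈ = relation (- x) (ι-inverse n n<P) (relation (fromℕ 2 * y) (ι-inverse m m<P) (relation (- (x * y)) 2M≈N
      (solve 6 (λ t c x y M N → x := con (+ 2) :* y :- t :* c :* x :* y :+ (N :* y :- con (+ 1)) :* (:- x)
         :+ (M :* x :- con (+ 1)) :* (con (+ 2) :* y) :+ (con (+ 2) :* M :- (N :+ t :* c)) :* (:- (x :* y)))
       refl π c x y (fromℕ (suc m)) (fromℕ (suc n)))))

  -- Doubling permutes the nonzero residues, so σ₂ ≡ 4 σ₂.
  σ₂-vanishes : ∀ h → P ≡ h ℕ.* 2 → 2 ℕ.< P → π * π * σ₂ ≈ 0#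
  -- From `s ≈ 4 s` one gets `3 s ≈ 0`; the hypothesis `2 < P` makes 3 invertible.
  σ₂-vanishes h ≡.refl 2<P = relation (π * π * σ₂) (sym (ι-inverse 2 2<P)) (relation (- ι 3) fourfold
      (solve 2 (λ s x → s := con (+ 0) :+ (con (+ 1) :- con (+ 3) :* x) :* s :+ (s :- con (+ 4) :* s) :* (:- x)) refl (π * π * σ₂) (ι 3)))
    where
    g : ℕ → Carrier
    g i = π * π * (ι (suc i) * ι (suc i))

    σ₂≈∑g : ∀ n → π * π * harmonic₂ n ≈ ∑ n g
    σ₂≈∑g n = *-distribˡ-∑ n _ _

    -- Doubling sends the residues `1` to `h` to the even ones without wrapping, and those above `h`
    -- to the odd ones after one wrap. Hence the carries `0#` and `1#` passed to `ι-double` here and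
    -- in `odd`.
    even : ∀ i → i ℕ.< h → g i ≈ fromℕ 4 * g (i ℕ.* 2 ℕ.+ 1)
    even i i<h = ι-double i (i ℕ.* 2 ℕ.+ 1) 0# (ℕₚ.<-≤-trans i<h (ℕₚ.m≤m*n h 2))
      (≡.subst (ℕ._< h ℕ.* 2) (ℕₚ.+-comm 1 (i ℕ.* 2)) (ℕₚ.*-monoˡ-≤ 2 i<h)) eq
      where
      eq : fromℕ 2 * fromℕ (suc i) ≈ fromℕ (suc (i ℕ.* 2 ℕ.+ 1)) + π * 0#
      eq = begin
        fromℕ 2 * fromℕ (suc i)                     ≈⟨ fromℕ-* 2 (suc i) ⟨
        fromℕ (2 ℕ.* suc i)                         ≡⟨ ≡.cong fromℕ (≡.trans (ℕₚ.*-comm 2 (suc i)) (≡.cong suc (ℕₚ.+-comm 1 (i ℕ.* 2)))) ⟩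
        fromℕ (suc (i ℕ.* 2 ℕ.+ 1))                 ≈⟨ solve 2 (λ x t → x := x :+ t :* con (+ 0)) refl _ π ⟩
        fromℕ (suc (i ℕ.* 2 ℕ.+ 1)) + π * 0#        ∎

    odd : ∀ j → j ℕ.< h → g (h ℕ.+ j) ≈ fromℕ 4 * g (j ℕ.* 2 ℕ.+ 0)
    odd j j<h = ι-double (h ℕ.+ j) (j ℕ.* 2 ℕ.+ 0) 1#
      (≡.subst (h ℕ.+ j ℕ.<_) (≡.trans (≡.cong (h ℕ.+_) (≡.sym (ℕₚ.+-identityʳ h))) (ℕₚ.*-comm 2 h)) (ℕₚ.+-monoʳ-< h j<h))
      (≡.subst (ℕ._< h ℕ.* 2) (≡.sym (ℕₚ.+-identityʳ (j ℕ.* 2))) (ℕₚ.*-monoˡ-< 2 j<h)) eq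
      where
      eq : fromℕ 2 * fromℕ (suc (h ℕ.+ j)) ≈ fromℕ (suc (j ℕ.* 2 ℕ.+ 0)) + π * 1#
      eq = begin
        fromℕ 2 * fromℕ (suc (h ℕ.+ j))                         ≈⟨ fromℕ-* 2 (suc (h ℕ.+ j)) ⟨
        fromℕ (2 ℕ.* suc (h ℕ.+ j))                             ≡⟨ ≡.cong fromℕ (ℕ-solve h j) ⟩
        fromℕ (suc (j ℕ.* 2 ℕ.+ 0) ℕ.+ p)                       ≈⟨ fromℕ-+ (suc (j ℕ.* 2 ℕ.+ 0)) p ⟩
        fromℕ (suc (j ℕ.* 2 ℕ.+ 0)) + fromℕ p                   ≈⟨ +-congˡ (trans fromℕ-p (sym (*-identityʳ π))) ⟩
        fromℕ (suc (j ℕ.* 2 ℕ.+ 0)) + π * 1#                    ∎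

    fourfold : π * π * σ₂ ≈ fromℕ 4 * (π * π * σ₂)
    fourfold = begin
      π * π * σ₂                                            ≈⟨ trans (*-congˡ σ₂-harmonic) (σ₂≈∑g (h ℕ.* 2)) ⟩
      ∑ (h ℕ.* 2) g                                         ≡⟨ ≡.cong (λ n → ∑ n g) (≡.trans (ℕₚ.*-comm h 2) (≡.cong (h ℕ.+_) (ℕₚ.+-identityʳ h))) ⟩
      ∑ (h ℕ.+ h) g                                         ≈⟨ ∑-split h h g ⟩
      ∑ h g + ∑ h (λ j → g (h ℕ.+ j))                       ≈⟨ +-cong (∑-cong h even) (∑-cong h odd) ⟩
      ∑ h (λ j → fromℕ 4 * g (j ℕ.* 2 ℕ.+ 1)) + ∑ h (λ j → fromℕ 4 * g (j ℕ.* 2 ℕ.+ 0))   ≈⟨ ∑-distrib-+ h ⟨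
      ∑ h (λ j → fromℕ 4 * g (j ℕ.* 2 ℕ.+ 1) + fromℕ 4 * g (j ℕ.* 2 ℕ.+ 0))
        ≈⟨ ∑-cong′ h (λ j → solve 2 (λ x y → con (+ 4) :* x :+ con (+ 4) :* y := con (+ 4) :* (con (+ 0) :+ y :+ x)) refl (g (j ℕ.* 2 ℕ.+ 1)) (g (j ℕ.* 2 ℕ.+ 0))) ⟩
      ∑ h (λ j → fromℕ 4 * ∑ 2 (λ i → g (j ℕ.* 2 ℕ.+ i)))   ≈⟨ *-distribˡ-∑ h _ _ ⟨
      fromℕ 4 * ∑ h (λ j → ∑ 2 (λ i → g (j ℕ.* 2 ℕ.+ i)))   ≈⟨ *-congˡ (∑-blocks h 2 g) ⟨
      fromℕ 4 * ∑ (h ℕ.* 2) g                               ≈⟨ *-congˡ (trans (*-congˡ σ₂-harmonic) (σ₂≈∑g (h ℕ.* 2))) ⟨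
      fromℕ 4 * (π * π * σ₂)                                ∎

-- Factorization of rising factorials over an arbitrary commutative ring

module Factorization (R : CommutativeRing 0ℓ 0ℓ) where

  open CommutativeRing R
  open RingOps R
  open RingProperties R
  open import Relation.Binary.Reasoning.Setoid setoid

  -- Shifting a window of consecutive factors changes only its two ends. Both end factors stay
  -- multiplied, as neither need be cancellable.
  ∏-falling : ∀ m y → ∏ (suc m) (λ i → 1# + y - fromℕ i) * (y - fromℕ m) ≈ (1# + y) * ∏ (suc m) (λ i → y - fromℕ i)
  ∏-falling m y = begin
    ∏ (suc m) (λ i → 1# + y - fromℕ i) * (y - fromℕ m)
      ≈⟨ *-congʳ (∏-suc m _) ⟩
    (1# + y - 0#) * ∏ m (λ i → 1# + y - fromℕ (suc i)) * (y - fromℕ m)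
      ≈⟨ *-congʳ (*-cong (solve 1 (λ y → con (+ 1) :+ y :- con (+ 0) := con (+ 1) :+ y) refl y)
           (∏-cong m λ i _ → trans (+-congˡ (-‿cong (fromℕ-suc i)))
             (solve 2 (λ y x → con (+ 1) :+ y :- (con (+ 1) :+ x) := y :- x) refl y (fromℕ i)))) ⟩
    (1# + y) * ∏ m (λ i → y - fromℕ i) * (y - fromℕ m)
      ≈⟨ *-assoc _ _ _ ⟩
    (1# + y) * ∏ (suc m) (λ i → y - fromℕ i) ∎

  ∏-rising : ∀ m z → ∏ m (λ i → 1# + z + fromℕ (suc i)) * (z + 1#) ≈ ∏ m (λ i → z + fromℕ (suc i)) * (z + fromℕ (suc m))
  ∏-rising m z = begin
    ∏ m (λ i → 1# + z + fromℕ (suc i)) * (z + 1#)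
      ≈⟨ *-comm _ _ ⟩
    (z + 1#) * ∏ m (λ i → 1# + z + fromℕ (suc i))
      ≈⟨ *-congˡ (∏-cong m λ i _ → trans
           (solve 2 (λ z x → con (+ 1) :+ z :+ x := z :+ (con (+ 1) :+ x)) refl z (fromℕ (suc i)))
           (+-congˡ (sym (fromℕ-suc (suc i))))) ⟩
    (z + fromℕ 1) * ∏ m (λ i → z + fromℕ (suc (suc i)))
      ≈⟨ ∏-suc m _ ⟨
    ∏ (suc m) (λ i → z + fromℕ (suc i)) ∎

  factorial : ℕ → Carrier
  factorial n = ∏ n (λ i → fromℕ (suc i))

  rising : Carrier → ℕ → Carrier
  rising r k = ∏ k (λ n → r + fromℕ n)

  rising² : Carrier → ℕ → Carrier
  rising² r k = rising r k * rising (1# - r) k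

  rising-cong : ∀ {r r′} k → r ≈ r′ → rising r k ≈ rising r′ k
  rising-cong k r≈r′ = ∏-cong k λ n _ → +-congʳ r≈r′

  rising²-cong : ∀ {r r′} k → r ≈ r′ → rising² r k ≈ rising² r′ k
  rising²-cong k r≈r′ = *-cong (rising-cong k r≈r′) (rising-cong k (+-congˡ (-‿cong r≈r′)))

  rising²-reflect : ∀ r k → rising² (1# - r) k ≈ rising² r k
  rising²-reflect r k = trans (*-comm _ _)
    (*-congʳ (rising-cong k (solve 1 (λ r → con (+ 1) :- (con (+ 1) :- r) := r) refl r)))

  fromℕ-! : ∀ n → fromℕ (n !) ≈ factorial n
  fromℕ-! zero    = refl
  fromℕ-! (suc n) = trans (fromℕ-* (suc n) (n !)) (trans (*-comm _ _) (*-congʳ (fromℕ-! n)))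

  quad : Carrier → Carrier
  quad x = x * x * (x * x)

  fromℕ-quad : ∀ n → fromℕ (n ^ 4) ≈ quad (fromℕ n)
  fromℕ-quad n = trans (fromℕ-* n _) (trans (*-congˡ (trans (fromℕ-* n _) (*-congˡ (trans (fromℕ-* n _) (*-congˡ (fromℕ-* n 1))))))
    (solve 1 (λ x → x :* (x :* (x :* (x :* con (+ 1)))) := x :* x :* (x :* x)) refl (fromℕ n)))

  fromℕ-cube : ∀ n → fromℕ (n ^ 3) ≈ fromℕ n * fromℕ n * fromℕ n
  fromℕ-cube n = trans (fromℕ-* n _) (trans (*-congˡ (trans (fromℕ-* n _) (*-congˡ (fromℕ-* n 1))))
    (solve 1 (λ x → x :* (x :* (x :* con (+ 1))) := x :* x :* x) refl (fromℕ n)))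

  cube-difference : ∀ n {x y q} → x ≈ y + fromℕ n * fromℕ n * fromℕ n * q → x - y ≈ fromℕ (n ^ 3) * q
  cube-difference n {x} {y} {q} e = relation 1# e (relation (- q) (fromℕ-cube n)
    (solve 5 (λ x y t c q → x :- y := c :* q :+ (x :- (y :+ t :* t :* t :* q)) :* con (+ 1) :+ (c :- t :* t :* t) :* (:- q)) refl x y (fromℕ n) (fromℕ (n ^ 3)) q))

  multiple-difference : ∀ {x z t} → x ≈ z * t → x - 0# ≈ t * z
  multiple-difference {x} {z} {t} e = relation 1# e (solve 3 (λ x z t → x :- con (+ 0) := t :* z :+ (x :- z :* t) :* con (+ 1)) refl x z t)

  UpToReflectionR : Carrier → Carrier → Set
  UpToReflectionR u r = u ≈ r ⊎ u ≈ 1# - r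

  rising²-upToReflection : ∀ {u r} k → UpToReflectionR u r → rising² u k ≈ rising² r k
  rising²-upToReflection k (inj₁ u≈r)   = rising²-cong k u≈r
  rising²-upToReflection k (inj₂ u≈1-r) = trans (rising²-cong k u≈1-r) (rising²-reflect _ k)

  product-upToReflection : ∀ {u r} → UpToReflectionR u r → u * (1# - u) ≈ r * (1# - r)
  product-upToReflection (inj₁ u≈r) = *-cong u≈r (+-congˡ (-‿cong u≈r))
  product-upToReflection {u} {r} (inj₂ u≈1-r) = trans (*-cong u≈1-r (+-congˡ (-‿cong u≈1-r)))
    (solve 1 (λ r → (con (+ 1) :- r) :* (con (+ 1) :- (con (+ 1) :- r)) := r :* (con (+ 1) :- r)) refl r)

  dividing : ∀ a q i w x y z → i * q ≈ 1# → a * q ≈ w * x * (y * z) → a ≈ w * x * y * z * i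
  dividing a q i w x y z iq≈1 aq≈ = relation (- a) iq≈1 (relation i aq≈
    (solve 7 (λ a q i w x y z → a := w :* x :* y :* z :* i :+ (i :* q :- con (+ 1)) :* (:- a) :+ (a :* q :- w :* x :* (y :* z)) :* i) refl a q i w x y z))

  inverse-unique : ∀ x v i → x * v ≈ 1# → x * i ≈ 1# → i ≈ v
  inverse-unique x v i xv≈1 xi≈1 = relation (- i) xv≈1 (relation v xi≈1
    (solve 3 (λ x v i → i := v :+ (x :* v :- con (+ 1)) :* (:- i) :+ (x :* i :- con (+ 1)) :* v) refl x v i))

  squares : Carrier → ℕ → Carrier
  squares δ k = fromℕ k * fromℕ k - δ * δ

  -- Since `r = δ - m`, the factors of `rising r x` together with the window on the left run from
  -- `δ - m` up to `δ + x`, and those of `rising (1# - r) x` from `m + 1 - δ` up to `m + x - δ`. The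
  -- `m` factors below `δ` change sign and extend the second run down to `1 - δ`. Pairing `k + δ`
  -- with `k - δ` for `1 ≤ k ≤ x` gives the squares and leaves `δ` and the window on the right.
  rising²-factorization : ∀ r δ m → r + fromℕ m ≈ δ → ∀ x →
    rising² r x * ∏ (suc m) (λ i → fromℕ x + δ - fromℕ i)
      ≈ pow (- 1#) m * δ * ∏ x (λ i → squares δ (suc i)) * ∏ m (λ i → fromℕ x - δ + fromℕ (suc i))
  rising²-factorization r δ m r+m≈δ zero = begin
    1# * 1# * ∏ (suc m) (λ i → 0# + δ - fromℕ i)
      ≈⟨ *-congˡ (∏-suc m _) ⟩
    1# * 1# * ((0# + δ - 0#) * ∏ m (λ i → 0# + δ - fromℕ (suc i)))
      ≈⟨ *-congˡ (*-congˡ (trans (∏-cong m λ i _ → solve 2 (λ d x → con (+ 0) :+ d :- x := :- con (+ 1) :* (con (+ 0) :- d :+ x)) refl δ (fromℕ (suc i))) (∏-distrib-* m))) ⟩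
    1# * 1# * ((0# + δ - 0#) * (pow (- 1#) m * ∏ m (λ i → 0# - δ + fromℕ (suc i))))
      ≈⟨ solve 3 (λ d s Q → con (+ 1) :* con (+ 1) :* ((con (+ 0) :+ d :- con (+ 0)) :* (s :* Q)) := s :* d :* con (+ 1) :* Q) refl δ _ _ ⟩
    pow (- 1#) m * δ * 1# * ∏ m (λ i → 0# - δ + fromℕ (suc i)) ∎
  rising²-factorization r δ m r+m≈δ (suc x) = begin
    a * (r + X) * (b * (1# - r + X)) * ∏ (suc m) (λ i → fromℕ (suc x) + δ - fromℕ i)
      ≈⟨ *-congˡ (∏-cong (suc m) λ i _ → +-congʳ (trans (+-congʳ (fromℕ-suc x)) (+-assoc _ _ _))) ⟩
    a * (r + X) * (b * (1# - r + X)) * F′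
      ≈⟨ relation (a * b * (1# - r + X)) (∏-falling m (X + δ))
         (relation (a * b * (1# - r + X) * F′) r+m≈δ
         (solve 8 (λ a b r M d X F′ F → a :* (r :+ X) :* (b :* (con (+ 1) :- r :+ X)) :* F′
           := a :* b :* F :* (con (+ 1) :+ (X :+ d)) :* (con (+ 1) :- r :+ X)
              :+ (F′ :* (X :+ d :- M) :- (con (+ 1) :+ (X :+ d)) :* F) :* (a :* b :* (con (+ 1) :- r :+ X))
              :+ (r :+ M :- d) :* (a :* b :* (con (+ 1) :- r :+ X) :* F′)) refl a b r (fromℕ m) δ X F′ F)) ⟩
    a * b * F * (1# + (X + δ)) * (1# - r + X)
      ≈⟨ *-congʳ (*-congʳ (rising²-factorization r δ m r+m≈δ x)) ⟩
    s * δ * S * Q * (1# + (X + δ)) * (1# - r + X)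
      ≈⟨ relation (- (s * δ * S * (1# + (X + δ)))) (∏-rising m (X - δ))
         (relation (- (s * δ * S * (1# + (X + δ)) * Q)) (fromℕ-suc m)
         (relation (- (s * δ * S * (1# + (X + δ)) * Q)) r+m≈δ
         (solve 9 (λ s S Q Q′ r M M′ d X → s :* d :* S :* Q :* (con (+ 1) :+ (X :+ d)) :* (con (+ 1) :- r :+ X)
           := s :* d :* (S :* ((con (+ 1) :+ X) :* (con (+ 1) :+ X) :- d :* d)) :* Q′
              :+ (Q′ :* (X :- d :+ con (+ 1)) :- Q :* (X :- d :+ M′)) :* (:- (s :* d :* S :* (con (+ 1) :+ (X :+ d))))
              :+ (M′ :- (con (+ 1) :+ M)) :* (:- (s :* d :* S :* (con (+ 1) :+ (X :+ d)) :* Q))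
              :+ (r :+ M :- d) :* (:- (s :* d :* S :* (con (+ 1) :+ (X :+ d)) :* Q)))
           refl s S Q Q′ r (fromℕ m) (fromℕ (suc m)) δ X))) ⟩
    s * δ * (S * ((1# + X) * (1# + X) - δ * δ)) * Q′
      ≈⟨ *-cong (*-congˡ (*-congˡ (+-congʳ (*-cong (fromℕ-suc x) (fromℕ-suc x)))))
           (∏-cong m λ i _ → trans (+-congʳ (+-congʳ (fromℕ-suc x)))
             (+-congʳ (+-assoc 1# X (- δ)))) ⟨
    s * δ * (S * squares δ (suc x)) * ∏ m (λ i → fromℕ (suc x) - δ + fromℕ (suc i)) ∎
    where
    X a b F F′ s S Q Q′ : Carrier
    X = fromℕ x
    a = rising r x
    b = rising (1# - r) x
    F = ∏ (suc m) (λ i → X + δ - fromℕ i)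
    F′ = ∏ (suc m) (λ i → 1# + (X + δ) - fromℕ i)
    s = pow (- 1#) m
    S = ∏ x (λ i → squares δ (suc i))
    Q = ∏ m (λ i → X - δ + fromℕ (suc i))
    Q′ = ∏ m (λ i → 1# + (X - δ) + fromℕ (suc i))

  module _ (P : ℕ) where

    private
      p : ℕ
      p = suc P

    ∏-multiples : ∀ b a (f : ℕ → Carrier) →
      ∏ (b ℕ.* p ℕ.+ a) (λ i → f (suc i)) ≈ ∏-coprime P b a f * ∏ b (λ n → f (suc n ℕ.* p))
    ∏-multiples b a f = begin
      ∏ (b ℕ.* p ℕ.+ a) (λ i → f (suc i))
        ≈⟨ trans (∏-split (b ℕ.* p) a _) (*-congʳ (∏-blocks b p _)) ⟩
      ∏ b (λ n → ∏ P (λ i → f (suc (n ℕ.* p ℕ.+ i))) * f (suc (n ℕ.* p ℕ.+ P))) * ∏ a (λ i → f (suc (b ℕ.* p ℕ.+ i)))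
        ≈⟨ *-cong (trans (∏-distrib-* b) (*-cong
             (∏-cong b λ n _ → ∏-cong P λ i _ → reflexive (≡.cong f (≡.sym (ℕₚ.+-suc (n ℕ.* p) i))))
             (∏-cong b λ n _ → reflexive (≡.cong (λ k → f (suc k)) (ℕₚ.+-comm (n ℕ.* p) P)))))
             (∏-cong a λ i _ → reflexive (≡.cong f (≡.sym (ℕₚ.+-suc (b ℕ.* p) i)))) ⟩
      ∏ b (λ n → ∏ P (λ i → f (n ℕ.* p ℕ.+ suc i))) * ∏ b (λ n → f (suc n ℕ.* p)) * ∏ a (λ i → f (b ℕ.* p ℕ.+ suc i))
        ≈⟨ solve 3 (λ x y z → x :* y :* z := x :* z :* y) refl _ _ _ ⟩
      ∏-coprime P b a f * ∏ b (λ n → f (suc n ℕ.* p)) ∎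

    factorial-multiples : ∀ b a → factorial (b ℕ.* p ℕ.+ a) ≈ ∏-coprime P b a fromℕ * (pow (fromℕ p) b * factorial b)
    factorial-multiples b a = trans (∏-multiples b a fromℕ)
      (*-congˡ (trans (∏-cong b λ n _ → trans (fromℕ-* (suc n) p) (*-comm _ _)) (∏-distrib-* b)))

    -- The factors y + n - 2δ for 1 ≤ n ≤ m and y - n for m < n ≤ P.
    roots : Carrier → ℕ → ℕ → Carrier
    roots δ m n = if n ℕ.<ᵇ m then δ + δ - fromℕ (suc n) else fromℕ (suc n)

    module _ (r u : Carrier) (m : ℕ) (m≤P : m ℕ.≤ P) (r+m≈pu : r + fromℕ m ≈ fromℕ p * u) where

      private
        π δ : Carrier
        π = fromℕ p
        δ = π * u

      -- Multiplying by the missing factors turns the product over i ≤ m into one over all residues.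
      rising²-digits : ∀ b a → a ℕ.≤ P → let y = fromℕ a + π * (fromℕ b + u) in
        rising² r (b ℕ.* p ℕ.+ a) * ∏ p (λ j → omit a j (y - fromℕ j)) * (π * (fromℕ b + u))
          ≈ pow (- 1#) m * (pow (π * π) b * rising² u b) * ∏-coprime P b a (squares δ) * ∏ P (λ n → y - roots δ m n) * (π * (fromℕ b + u))
      rising²-digits b a a≤P = begin
        rising² r x * V * (π * (fromℕ b + u))
          ≈⟨ trans (*-assoc _ _ _) (*-congˡ (trans (*-congˡ (solve 2 (λ a e → e := a :+ e :- a) refl (fromℕ a) _)) (∏-omit p a (λ j → y - fromℕ j) (s≤s a≤P)))) ⟩
        rising² r x * ∏ p (λ j → y - fromℕ j)
          ≡⟨ ≡.cong (λ k → rising² r x * ∏ (suc k) (λ j → y - fromℕ j)) (≡.sym (ℕₚ.m+[n∸m]≡n m≤P)) ⟩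
        rising² r x * ∏ (suc m ℕ.+ (P ∸ m)) (λ j → y - fromℕ j)
          ≈⟨ *-congˡ (∏-split (suc m) (P ∸ m) _) ⟩
        rising² r x * (∏ (suc m) (λ j → y - fromℕ j) * T)
          ≈⟨ trans (sym (*-assoc _ _ _)) (*-congʳ (*-congˡ (∏-cong (suc m) λ i _ → +-congʳ y≈))) ⟩
        rising² r x * ∏ (suc m) (λ j → fromℕ x + δ - fromℕ j) * T
          ≈⟨ *-congʳ (rising²-factorization r δ m r+m≈pu x) ⟩
        s * δ * ∏ x (λ i → squares δ (suc i)) * ∏ m (λ i → fromℕ x - δ + fromℕ (suc i)) * T
          ≈⟨ *-congʳ (*-cong (*-congˡ (∏-multiples b a (squares δ))) (∏-cong m λ i i<m → low i i<m)) ⟩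
        s * δ * (N * ∏ b (λ n → squares δ (suc n ℕ.* p))) * ∏ m (λ n → y - roots δ m n) * T
          ≈⟨ *-cong (*-congʳ (*-congˡ (*-congˡ (trans (∏-cong b λ n _ → multiple n) (∏-distrib-* b))))) (∏-cong (P ∸ m) λ i _ → high i) ⟩
        s * δ * (N * (ππ * S)) * ∏ m (λ n → y - roots δ m n) * ∏ (P ∸ m) (λ i → y - roots δ m (m ℕ.+ i))
          ≈⟨ trans (*-assoc _ _ _) (*-congˡ (trans (sym (∏-split m (P ∸ m) _)) (reflexive (≡.cong (λ k → ∏ k (λ n → y - roots δ m n)) (ℕₚ.m+[n∸m]≡n m≤P))))) ⟩
        s * δ * (N * (ππ * S)) * q
          -- With `m = 0` and `δ = u`, the factorization reads backwards: the squares at the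
          -- multiples of `p`, freed of their powers of `π`, reassemble to `rising² u b`.
          ≈⟨ relation (- (s * ππ * N * q * π)) (rising²-factorization u u 0 (+-identityʳ u) b)
             (solve 9 (λ s t u N w S q R b →
                s :* (t :* u) :* (N :* (w :* S)) :* q := s :* (w :* R) :* N :* q :* (t :* (b :+ u))
                :+ (R :* (con (+ 1) :* (b :+ u :- con (+ 0))) :- con (+ 1) :* u :* S :* con (+ 1)) :* (:- (s :* w :* N :* q :* t)))
              refl s π u N ππ S q (rising² u b) (fromℕ b)) ⟩
        s * (ππ * rising² u b) * N * q * (π * (fromℕ b + u)) ∎
        where
        x : ℕ
        x = b ℕ.* p ℕ.+ a
        y V T s N ππ S q : Carrier
        y = fromℕ a + π * (fromℕ b + u)
        V = ∏ p (λ j → omit a j (y - fromℕ j))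
        T = ∏ (P ∸ m) (λ i → y - fromℕ (suc m ℕ.+ i))
        s = pow (- 1#) m
        N = ∏-coprime P b a (squares δ)
        ππ = pow (π * π) b
        S = ∏ b (λ n → squares u (suc n))
        q = ∏ P (λ n → y - roots δ m n)
        y≈ : y ≈ fromℕ x + δ
        y≈ = sym (trans (+-congʳ (trans (fromℕ-+ (b ℕ.* p) a) (+-congʳ (fromℕ-* b p))))
          (solve 4 (λ a b t u → b :* t :+ a :+ t :* u := a :+ t :* (b :+ u)) refl (fromℕ a) (fromℕ b) π u))
        low : ∀ i → i ℕ.< m → fromℕ x - δ + fromℕ (suc i) ≈ y - roots δ m i
        low i i<m with i ℕ.<ᵇ m | ℕₚ.<⇒<ᵇ i<m
        ... | true | _ = trans (solve 3 (λ X d k → X :- d :+ k := X :+ d :- (d :+ d :- k)) refl (fromℕ x) δ (fromℕ (suc i))) (+-congʳ (sym y≈))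
        high : ∀ i → y - fromℕ (suc m ℕ.+ i) ≈ y - roots δ m (m ℕ.+ i)
        high i with (m ℕ.+ i) ℕ.<ᵇ m | ℕₚ.<ᵇ⇒< (m ℕ.+ i) m
        ... | false | _ = refl
        ... | true  | m+i<m = contradiction (m+i<m _) (ℕₚ.m+n≮m m i)
        multiple : ∀ n → squares δ (suc n ℕ.* p) ≈ π * π * squares u (suc n)
        multiple n = trans (+-congʳ (*-cong (fromℕ-* (suc n) p) (fromℕ-* (suc n) p)))
          (solve 3 (λ n t u → n :* t :* (n :* t) :- t :* u :* (t :* u) := t :* t :* (n :* n :- u :* u)) refl (fromℕ (suc n)) π u)

-- Numerators and denominators of rationals

toℚᵘ-ℕ→ℚ : ∀ n → ℚ.toℚᵘ (ℕ→ℚ n) ℚᵘ.≃ ℚᵘ.mkℚᵘ (+ n) 0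
toℚᵘ-ℕ→ℚ n = ℚₚ.toℚᵘ-fromℚᵘ (ℚᵘ.mkℚᵘ (+ n) 0)

ℕ→ℚ-suc : ∀ n → ℕ→ℚ (suc n) ≡ 1ℚ ℚ.+ ℕ→ℚ n
ℕ→ℚ-suc n = ℚₚ.toℚᵘ-injective (ℚᵘₚ.≃-trans (toℚᵘ-ℕ→ℚ (suc n)) (ℚᵘₚ.≃-trans step (ℚᵘₚ.≃-trans
  (ℚᵘₚ.+-congʳ (ℚ.toℚᵘ 1ℚ) (ℚᵘₚ.≃-sym (toℚᵘ-ℕ→ℚ n))) (ℚᵘₚ.≃-sym (ℚₚ.toℚᵘ-homo-+ 1ℚ (ℕ→ℚ n))))))
  where
  step : ℚᵘ.mkℚᵘ (+ suc n) 0 ℚᵘ.≃ ℚ.toℚᵘ 1ℚ ℚᵘ.+ ℚᵘ.mkℚᵘ (+ n) 0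
  step = ℚᵘ.*≡* (≡.cong (ℤ._* + 1) (≡.cong (ℤ._+_ (+ 1)) (≡.sym (ℤₚ.*-identityʳ (+ n)))))

ℕ→ℚ-multiple : ∀ n y d → ℕ→ℚ n ≡ y ℚ.* ℕ→ℚ d → + n ℤ.* ↧ y ≡ ↥ y ℤ.* + d
ℕ→ℚ-multiple n y@record{} d eq with ℚᵘₚ.≃-trans (ℚᵘₚ.≃-sym (toℚᵘ-ℕ→ℚ n)) (ℚᵘₚ.≃-trans (ℚₚ.toℚᵘ-cong eq)
  (ℚᵘₚ.≃-trans (ℚₚ.toℚᵘ-homo-* y (ℕ→ℚ d)) (ℚᵘₚ.*-congˡ (toℚᵘ-ℕ→ℚ d))))
... | ℚᵘ.*≡* e = ≡.trans (≡.cong (λ k → + n ℤ.* + k) (≡.sym (ℕₚ.*-identityʳ (↧ₙ y)))) (≡.trans e (ℤₚ.*-identityʳ _))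

↧-1/ : ∀ x .{{_ : ℚ.NonZero x}} → ↧ₙ (1/ x) ≡ ℤ.∣ ↥ x ∣
↧-1/ (mkℚ ℤ.+[1+ _ ] _ _) = ≡.refl
↧-1/ (mkℚ -[1+ _ ]   _ _) = ≡.refl

/-multiple : ∀ x i n → ↥ x ≡ i ℤ.* + n → x ≡ (i ℚ./ ↧ₙ x) ℚ.* ℕ→ℚ n
/-multiple x@(mkℚ m d _) i n m≡in = ℚₚ.toℚᵘ-injective (begin
  ℚᵘ.mkℚᵘ m d                                      ≈⟨ ℚᵘ.*≡* (≡.cong₂ ℤ._*_ m≡in (≡.cong (λ k → + k) (ℕₚ.*-identityʳ (suc d)))) ⟩
  ℚᵘ.mkℚᵘ i d ℚᵘ.* ℚᵘ.mkℚᵘ (+ n) 0                 ≈⟨ ℚᵘₚ.*-cong (ℚₚ.toℚᵘ-fromℚᵘ (ℚᵘ.mkℚᵘ i d)) (toℚᵘ-ℕ→ℚ n) ⟨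
  ℚ.toℚᵘ (i ℚ./ suc d) ℚᵘ.* ℚ.toℚᵘ (ℕ→ℚ n)         ≈⟨ ℚₚ.toℚᵘ-homo-* (i ℚ./ suc d) (ℕ→ℚ n) ⟨
  ℚ.toℚᵘ ((i ℚ./ suc d) ℚ.* ℕ→ℚ n)                 ∎)
  where open ℚᵘₚ.≃-Reasoning

abs-∣ : ∀ a b c k → + a ℤ.* k ≡ + b ℤ.* + c → a ∣ b ℕ.* c
abs-∣ a b c k eq = divides ℤ.∣ k ∣ (begin
  b ℕ.* c                ≡⟨ ℤₚ.abs-* (+ b) (+ c) ⟨
  ℤ.∣ + b ℤ.* + c ∣      ≡⟨ ≡.cong ℤ.∣_∣ eq ⟨
  ℤ.∣ + a ℤ.* k ∣        ≡⟨ ℤₚ.abs-* (+ a) k ⟩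
  a ℕ.* ℤ.∣ k ∣          ≡⟨ ℕₚ.*-comm a ℤ.∣ k ∣ ⟩
  ℤ.∣ k ∣ ℕ.* a          ∎)
  where open ≡.≡-Reasoning

↧-/-∣ : ∀ i n .{{_ : ℕ.NonZero n}} → ↧ₙ (i ℚ./ n) ∣ n
↧-/-∣ i n = ≡.subst (↧ₙ (i ℚ./ n) ∣_) (ℕₚ.*-identityʳ n)
  (abs-∣ (↧ₙ (i ℚ./ n)) n 1 _ (≡.trans (ℚₚ.↧-/ i n) (≡.sym (ℤₚ.*-identityʳ (+ n)))))

-- The divisibility of denominators is what keeps the quotient `z` integral at `p`.
numerator-∣ : ∀ x n → n ∣ ℤ.∣ ↥ x ∣ → ∃ λ z → ↧ₙ z ∣ ↧ₙ x × x ≡ z ℚ.* ℕ→ℚ n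
numerator-∣ x n n∣ with Signed.∣ᵤ⇒∣ {+ n} {↥ x} n∣
... | Signed.divides i eq = i ℚ./ ↧ₙ x , ↧-/-∣ i (↧ₙ x) , /-multiple x i n eq

coprime-∣ : ∀ {p m n} → m ∣ n → Coprime p n → Coprime p m
coprime-∣ m∣n p⊥n (d∣p , d∣m) = p⊥n (d∣p , ∣-trans d∣m m∣n)

-- The ring of rationals with denominator prime to p

module Localization (p : ℕ) (pr : Prime p) where

  ∤⇒coprime : ∀ {n} → p ∤ n → Coprime p n
  ∤⇒coprime p∤n (d∣p , d∣n) with prime⇒irreducible pr d∣p
  ... | inj₁ d≡1    = d≡1
  ... | inj₂ ≡.refl = contradiction d∣n p∤n

  coprime⇒∤ : ∀ {n} → Coprime p n → p ∤ n
  coprime⇒∤ p⊥n p∣n = ¬prime[1] (≡.subst Prime (p⊥n (∣-refl , p∣n)) pr)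

  coprime-* : ∀ {m n} → Coprime p m → Coprime p n → Coprime p (m ℕ.* n)
  coprime-* {m} {n} p⊥m p⊥n = ∤⇒coprime λ p∣mn → case-⊎ (euclidsLemma m n pr p∣mn)
    where
    case-⊎ : ¬ (p ∣ m ⊎ p ∣ n)
    case-⊎ (inj₁ p∣m) = coprime⇒∤ p⊥m p∣m
    case-⊎ (inj₂ p∣n) = coprime⇒∤ p⊥n p∣n

  record Integral : Set where
    no-eta-equality
    constructor _,_
    field
      value    : ℚ
      integral : value ∈ℤ₍ p ₎
  open Integral public

  integral-+ : ∀ {x y} → x ∈ℤ₍ p ₎ → y ∈ℤ₍ p ₎ → x ℚ.+ y ∈ℤ₍ p ₎
  integral-+ {x} {y} x∈ y∈ = coprime-∣ (abs-∣ _ (↧ₙ x) (↧ₙ y) _ (≡.trans (ℚₚ.↧-+ x y) (ℤₚ.pos-* (↧ₙ x) (↧ₙ y)))) (coprime-* x∈ y∈)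

  integral-* : ∀ {x y} → x ∈ℤ₍ p ₎ → y ∈ℤ₍ p ₎ → x ℚ.* y ∈ℤ₍ p ₎
  integral-* {x} {y} x∈ y∈ = coprime-∣ (abs-∣ _ (↧ₙ x) (↧ₙ y) _ (ℚₚ.↧-* x y)) (coprime-* x∈ y∈)

  integral-neg : ∀ {x} → x ∈ℤ₍ p ₎ → ℚ.- x ∈ℤ₍ p ₎
  integral-neg {x} = ≡.subst (Coprime p) (≡.sym (≡.cong ℤ.∣_∣ (ℚₚ.↧-neg x)))

  integral-0 : 0ℚ ∈ℤ₍ p ₎
  integral-0 = ∤⇒coprime λ p∣1 → ¬prime[1] (≡.subst Prime (∣1⇒≡1 p∣1) pr)

  integral-1 : 1ℚ ∈ℤ₍ p ₎
  integral-1 = integral-0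

  open CommutativeRing ℚₚ.+-*-commutativeRing using (+-assoc; +-comm; +-identityˡ; +-identityʳ; -‿inverseˡ; -‿inverseʳ; *-assoc; *-comm; *-identityˡ; *-identityʳ; distribˡ; distribʳ)

  infix 4 _≐_
  -- Only values are compared: `Coprime` is a function type, so two proofs of integrality need not
  -- be propositionally equal.
  record _≐_ (x y : Integral) : Set where
    constructor equal
    field value-≡ : value x ≡ value y
  open _≐_ public

  -- Copatterns keep the operations from unfolding to arithmetic on ℚ during unification.
  infixl 6 _+ᵢ_
  infixl 7 _*ᵢ_
  infix  8 -ᵢ_

  _+ᵢ_ _*ᵢ_ : Integral → Integral → Integral
  value    (x +ᵢ y) = value x ℚ.+ value y
  integral (x +ᵢ y) = integral-+ {value x} {value y} (integral x) (integral y)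
  value    (x *ᵢ y) = value x ℚ.* value y
  integral (x *ᵢ y) = integral-* {value x} {value y} (integral x) (integral y)

  -ᵢ_ : Integral → Integral
  value    (-ᵢ x) = ℚ.- value x
  integral (-ᵢ x) = integral-neg {value x} (integral x)

  integralRing : CommutativeRing 0ℓ 0ℓ
  integralRing = record
    { Carrier = Integral
    ; _≈_ = _≐_
    ; _+_ = _+ᵢ_
    ; _*_ = _*ᵢ_
    ; -_  = -ᵢ_
    ; 0#  = 0ℚ , integral-0
    ; 1#  = 1ℚ , integral-1
    ; isCommutativeRing = record
      { isRing = record
        { +-isAbelianGroup = record
          { isGroup = record
            { isMonoid = record
              { isSemigroup = record
                { isMagma = record
                  { isEquivalence = record
                    { refl  = equal ≡.refl
                    ; sym   = λ (equal e) → equal (≡.sym e)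
                    ; trans = λ (equal e) (equal f) → equal (≡.trans e f) }
                  ; ∙-cong = λ (equal e) (equal f) → equal (≡.cong₂ ℚ._+_ e f) }
                ; assoc = λ x y z → equal (+-assoc (value x) (value y) (value z)) }
              ; identity = (λ x → equal (+-identityˡ (value x))) , (λ x → equal (+-identityʳ (value x))) }
            ; inverse = (λ x → equal (-‿inverseˡ (value x))) , (λ x → equal (-‿inverseʳ (value x)))
            ; ⁻¹-cong = λ (equal e) → equal (≡.cong ℚ.-_ e) }
          ; comm = λ x y → equal (+-comm (value x) (value y)) }
        ; *-cong = λ (equal e) (equal f) → equal (≡.cong₂ ℚ._*_ e f)
        ; *-assoc = λ x y z → equal (*-assoc (value x) (value y) (value z))
        ; *-identity = (λ x → equal (*-identityˡ (value x))) , (λ x → equal (*-identityʳ (value x)))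
        ; distrib = (λ x y z → equal (distribˡ (value x) (value y) (value z)))
                  , (λ x y z → equal (distribʳ (value x) (value y) (value z))) }
      ; *-comm = λ x y → equal (*-comm (value x) (value y)) } }

  private module O = CommutativeRing integralRing
  open RingOps integralRing
  open RingProperties integralRing using (IsUnit; fromℕ-suc)

  value-fromℕ : ∀ n → value (fromℕ n) ≡ ℕ→ℚ n
  value-fromℕ zero    = ≡.refl
  value-fromℕ (suc n) = ≡.trans (value-≡ (fromℕ-suc n)) (≡.trans (≡.cong (1ℚ ℚ.+_) (value-fromℕ n)) (≡.sym (ℕ→ℚ-suc n)))

  integral-1/ : ∀ x .{{_ : ℚ.NonZero x}} → p ∤ ℤ.∣ ↥ x ∣ → 1/ x ∈ℤ₍ p ₎
  integral-1/ x p∤n = ≡.subst (Coprime p) (≡.sym (↧-1/ x)) (∤⇒coprime p∤n)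

  numerator-nonZero : ∀ x → p ∤ ℤ.∣ ↥ x ∣ → ℚ.NonZero x
  numerator-nonZero x p∤n = ℚ.≢-nonZero {x} λ x≡0 → p∤n (≡.subst (λ y → p ∣ ℤ.∣ ↥ y ∣) (≡.sym x≡0) (divides 0 ≡.refl))

  inverse : ∀ x → ℚ.NonZero (value x) → p ∤ ℤ.∣ ↥ value x ∣ → Integral
  inverse x x≢0 p∤n = (1/ value x) {{x≢0}} , integral-1/ (value x) {{x≢0}} p∤n

  *-inverse : ∀ x (x≢0 : ℚ.NonZero (value x)) p∤n → x O.* inverse x x≢0 p∤n O.≈ O.1#
  *-inverse x x≢0 p∤n = equal (ℚₚ.*-inverseʳ (value x) {{x≢0}})

  numerator-unit : ∀ x → p ∤ ℤ.∣ ↥ value x ∣ → IsUnit x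
  numerator-unit x p∤n = inverse x x≢0 p∤n , *-inverse x x≢0 p∤n
    where
    x≢0 : ℚ.NonZero (value x)
    x≢0 = numerator-nonZero (value x) p∤n

  multiple : ∀ x z → ↧ₙ z ∣ ↧ₙ (value x) → value x ≡ z ℚ.* ℕ→ℚ p → ∃ λ z → x O.≈ z O.* fromℕ p
  multiple x z d∣d x≡zp = (z , coprime-∣ d∣d (integral x)) , equal (≡.trans x≡zp (≡.cong (z ℚ.*_) (≡.sym (value-fromℕ p))))

  numerator-multiple : ∀ x → (∃ λ z → ↧ₙ z ∣ ↧ₙ (value x) × value x ≡ z ℚ.* ℕ→ℚ p) → ∃ λ z → x O.≈ z O.* fromℕ p
  numerator-multiple x (z , d∣d , x≡zp) = multiple x z d∣d x≡zp

  -- In lowest terms and with denominator prime to `p`, all depends on whether `p` divides the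
  -- numerator.
  unit-or-multiple : ∀ x → IsUnit x ⊎ ∃ λ z → x O.≈ z O.* fromℕ p
  unit-or-multiple x = cases (p ∣? ℤ.∣ ↥ value x ∣)
    where
    cases : Dec (p ∣ ℤ.∣ ↥ value x ∣) → IsUnit x ⊎ ∃ λ z → x O.≈ z O.* fromℕ p
    cases (no  p∤n) = inj₁ (numerator-unit x p∤n)
    cases (yes p∣n) = inj₂ (numerator-multiple x (numerator-∣ (value x) p p∣n))

  pos⇒nonmultiple : ∀ n → 0 ℕ.< n → n ℕ.< p → ∀ z → ¬ (fromℕ n O.≈ z O.* fromℕ p)
  pos⇒nonmultiple n@(suc _) _ n<p z eq with euclidsLemma n (↧ₙ (value z)) pr p∣
    where
    open ≡.≡-Reasoning
    p∣ : p ∣ n ℕ.* ↧ₙ (value z)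
    p∣ = divides ℤ.∣ ↥ value z ∣ (begin
      n ℕ.* ↧ₙ (value z)              ≡⟨ ℤₚ.abs-* (+ n) (↧ value z) ⟨
      ℤ.∣ + n ℤ.* ↧ value z ∣         ≡⟨ ≡.cong ℤ.∣_∣ (ℕ→ℚ-multiple n (value z) p
        (≡.trans (≡.sym (value-fromℕ n)) (≡.trans (value-≡ eq) (≡.cong (value z ℚ.*_) (value-fromℕ p))))) ⟩
      ℤ.∣ ↥ value z ℤ.* + p ∣         ≡⟨ ℤₚ.abs-* (↥ value z) (+ p) ⟩
      ℤ.∣ ↥ value z ∣ ℕ.* p           ∎)
  ... | inj₁ p∣n = contradiction (∣⇒≤ p∣n) (ℕₚ.<⇒≱ n<p)
  ... | inj₂ p∣d = coprime⇒∤ (integral z) p∣d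

-- `nonmultiple` at 1 says that `p` is not a unit; at the other `n` it selects the unit alternative,
-- which supplies the inverses of the nonzero residues.
record Local (O : CommutativeRing 0ℓ 0ℓ) (p : ℕ) : Set where
  open CommutativeRing O
  open RingOps O
  open RingProperties O
  field
    unit-or-multiple : ∀ x → IsUnit x ⊎ ∃ λ z → x ≈ z * fromℕ p
    nonmultiple      : ∀ n → 0 ℕ.< n → n ℕ.< p → ∀ z → ¬ (fromℕ n ≈ z * fromℕ p)

-- Passage between the local ring and its quotient modulo p³

module Dwork (O : CommutativeRing 0ℓ 0ℓ) (P : ℕ) (local : Local O (suc P)) (0<P : 0 ℕ.< P) where

  open CommutativeRing O
  open RingOps O
  open RingProperties O
  open Factorization O
  open Local local
  open import Relation.Binary.Reasoning.Setoid setoid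

  p : ℕ
  p = suc P

  π : Carrier
  π = fromℕ p

  -- Cancellability without invertibility: powers of `p` and factorials must be removed although
  -- they are not units.
  Regular : Carrier → Set
  Regular z = ∀ {x y} → x * z ≈ y * z → x ≈ y

  regular-* : ∀ {y z} → Regular y → Regular z → Regular (y * z)
  regular-* y-reg z-reg e = y-reg (z-reg (trans (*-assoc _ _ _) (trans e (sym (*-assoc _ _ _)))))

  regular-∏ : ∀ n {f} → (∀ i → Regular (f i)) → Regular (∏ n f)
  regular-∏ zero    f-reg e = trans (sym (*-identityʳ _)) (trans e (*-identityʳ _))
  regular-∏ (suc n) f-reg = regular-* (regular-∏ n f-reg) (f-reg n)

  open Quotient O (π * π * π) using (quotientRing; _≋_; mod; ≈⇒≋)

  private
    ι′ : ∀ x → IsUnit x ⊎ (∃ λ z → x ≈ z * π) → Carrier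
    ι′ x (inj₁ (v , _)) = v
    ι′ x (inj₂ _)       = 0#

    ι : ℕ → Carrier
    ι zero    = 0#
    ι (suc n) = ι′ (fromℕ (suc n)) (unit-or-multiple (fromℕ (suc n)))

    ι-inverse′ : ∀ n → n ℕ.< P → (c : IsUnit (fromℕ (suc n)) ⊎ (∃ λ z → fromℕ (suc n) ≈ z * π)) →
                 fromℕ (suc n) * ι′ (fromℕ (suc n)) c ≈ 1#
    ι-inverse′ n n<P (inj₁ (v , e)) = e
    ι-inverse′ n n<P (inj₂ (z , e)) = contradiction e (nonmultiple (suc n) (s≤s z≤n) (s≤s n<P) z)

    π³≋0 : π * π * π ≋ 0#
    π³≋0 = mod 1# (solve 1 (λ c → c := con (+ 0) :+ c :* con (+ 1)) refl (π * π * π))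

  module B = CommutativeRing quotientRing
  module BP = RingProperties quotientRing

  private
    cubeZero : CubeZero quotientRing P
    cubeZero = record
      { π         = π
      ; π³≈0      = π³≋0
      ; fromℕ-p   = B.refl
      ; ι         = ι
      ; ι-zero    = B.refl
      ; ι-inverse = λ n n<P → ≈⇒≋ (ι-inverse′ n n<P (unit-or-multiple (fromℕ (suc n))))
      }

  module M = Modular quotientRing P cubeZero

  -- Were `x` a multiple of `p`, then 1 would be one too, `p³` being a multiple of `p`.
  unit-lift : ∀ {x} → BP.IsUnit x → IsUnit x
  unit-lift {x} (v , mod q e) = cases (unit-or-multiple x)
    where
    cases : IsUnit x ⊎ (∃ λ z → x ≈ z * π) → IsUnit x
    cases (inj₁ u)       = u
    cases (inj₂ (z , f)) = contradiction
      (relation (- 1#) e (relation v f (solve 5 (λ x v q z t → con (+ 1) := (z :* v :- t :* t :* q) :* t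
        :+ (x :* v :- (con (+ 1) :+ t :* t :* t :* q)) :* (:- con (+ 1)) :+ (x :- z :* t) :* v) refl x v q z π)))
      (nonmultiple 1 (s≤s z≤n) (s≤s 0<P) (z * v - π * π * q))

  -- The terms of H and their base p digits

  module Terms (r₁ r₂ u₁ u₂ : Carrier) (m₁ m₂ : ℕ) (m₁≤P : m₁ ℕ.≤ P) (m₂≤P : m₂ ℕ.≤ P)
    (r₁+m₁≈pu₁ : r₁ + fromℕ m₁ ≈ π * u₁) (r₂+m₂≈pu₂ : r₂ + fromℕ m₂ ≈ π * u₂)
    (p-regular : Regular π) (factorial-regular : ∀ n → Regular (factorial n))
    (u₁-regular : ∀ b → Regular (fromℕ b + u₁)) (u₂-regular : ∀ b → Regular (fromℕ b + u₂))
    (rising²-dash : ∀ b → rising² u₁ b * rising² u₂ b ≈ rising² r₁ b * rising² r₂ b)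
    (dash-sum : u₁ * (1# - u₁) + u₂ * (1# - u₂) ≈ r₁ * (1# - r₁) + r₂ * (1# - r₂))
    where

    -- The division by `k!⁴` is multiplied out, so the existence of such an `A` in this ring is the
    -- integrality of the term.
    IsTerm : ℕ → Carrier → Set
    IsTerm k A = A * quad (factorial k) ≈ rising² r₁ k * rising² r₂ k

    private
      s : Carrier
      s = pow (- 1#) m₁ * pow (- 1#) m₂

      V₁ V₂ D M′ N₁ N₂ q₁ q₂ : ℕ → ℕ → Carrier
      V₁ b a = M.lagrange p a (fromℕ a + π * (fromℕ b + u₁))
      V₂ b a = M.lagrange p a (fromℕ a + π * (fromℕ b + u₂))
      D  b a = ∏-coprime P b a fromℕ
      M′ b a = V₁ b a * V₂ b a * quad (D b a)
      N₁ b a = ∏-coprime P b a (squares (π * u₁))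
      N₂ b a = ∏-coprime P b a (squares (π * u₂))
      q₁ b a = ∏ P (λ n → fromℕ a + π * (fromℕ b + u₁) - roots P (π * u₁) m₁ n)
      q₂ b a = ∏ P (λ n → fromℕ a + π * (fromℕ b + u₂) - roots P (π * u₂) m₂ n)

      digits : ∀ b a A → a ℕ.≤ P → IsTerm b A →
        rising² r₁ (b ℕ.* p ℕ.+ a) * rising² r₂ (b ℕ.* p ℕ.+ a) * (V₁ b a * V₂ b a)
          ≈ s * A * (N₁ b a * N₂ b a * (q₁ b a * q₂ b a)) * quad (pow π b * factorial b)
      digits b a A a≤P A-term = begin
        R₁ * R₂ * (V₁ b a * V₂ b a)
          ≈⟨ solve 4 (λ x y v w → x :* y :* (v :* w) := x :* v :* (y :* w)) refl R₁ R₂ (V₁ b a) (V₂ b a) ⟩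
        R₁ * V₁ b a * (R₂ * V₂ b a)
          -- The factor `π * (fromℕ b + u)`, the one omitted at `j = a`, is not a unit and has to be
          -- cancelled before reduction.
          ≈⟨ *-cong
               (regular-* p-regular (u₁-regular b) (rising²-digits P r₁ u₁ m₁ m₁≤P r₁+m₁≈pu₁ b a a≤P))
               (regular-* p-regular (u₂-regular b) (rising²-digits P r₂ u₂ m₂ m₂≤P r₂+m₂≈pu₂ b a a≤P)) ⟩
        s₁ * (pow (π * π) b * U₁) * N₁ b a * q₁ b a * (s₂ * (pow (π * π) b * U₂) * N₂ b a * q₂ b a)
          ≈⟨ *-cong (*-congʳ (*-congʳ (*-congˡ (*-congʳ (∏-distrib-* b))))) (*-congʳ (*-congʳ (*-congˡ (*-congʳ (∏-distrib-* b))))) ⟩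
        s₁ * (pow π b * pow π b * U₁) * N₁ b a * q₁ b a * (s₂ * (pow π b * pow π b * U₂) * N₂ b a * q₂ b a)
          -- Here the permutation of the parameters enters: the multiples of `p` produce the term of
          -- index `b` for the same parameters.
          ≈⟨ relation (quad (pow π b) * s * (N₁ b a * N₂ b a * (q₁ b a * q₂ b a))) (trans (rising²-dash b) (sym A-term))
             (solve 11 (λ s s′ w U U′ N N′ q q′ A f →
               s :* (w :* w :* U) :* N :* q :* (s′ :* (w :* w :* U′) :* N′ :* q′)
               := s :* s′ :* A :* (N :* N′ :* (q :* q′)) :* (w :* f :* (w :* f) :* (w :* f :* (w :* f)))
                  :+ (U :* U′ :- A :* (f :* f :* (f :* f))) :* (w :* w :* (w :* w) :* (s :* s′) :* (N :* N′ :* (q :* q′))))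
             refl s₁ s₂ (pow π b) U₁ U₂ (N₁ b a) (N₂ b a) (q₁ b a) (q₂ b a) A (factorial b)) ⟩
        s * A * (N₁ b a * N₂ b a * (q₁ b a * q₂ b a)) * quad (pow π b * factorial b) ∎
        where
        R₁ R₂ U₁ U₂ s₁ s₂ : Carrier
        R₁ = rising² r₁ (b ℕ.* p ℕ.+ a)
        R₂ = rising² r₂ (b ℕ.* p ℕ.+ a)
        U₁ = rising² u₁ b
        U₂ = rising² u₂ b
        s₁ = pow (- 1#) m₁
        s₂ = pow (- 1#) m₂

      quad-factorial : ∀ b a → quad (factorial (b ℕ.* p ℕ.+ a)) ≈ quad (D b a) * quad (pow π b * factorial b)
      quad-factorial b a = trans (*-cong (*-cong e e) (*-cong e e))
        (solve 2 (λ d f → d :* f :* (d :* f) :* (d :* f :* (d :* f)) := d :* d :* (d :* d) :* (f :* f :* (f :* f))) refl (D b a) (pow π b * factorial b))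
        where
        e : factorial (b ℕ.* p ℕ.+ a) ≈ D b a * (pow π b * factorial b)
        e = factorial-multiples P b a

      quad-regular : ∀ b → Regular (quad (pow π b * factorial b))
      quad-regular b = regular-* (regular-* f-reg f-reg) (regular-* f-reg f-reg)
        where
        f-reg : Regular (pow π b * factorial b)
        f-reg = regular-* (regular-∏ b λ _ → p-regular) (factorial-regular b)

      M′-unit-mod : ∀ b a → a ℕ.≤ P → BP.IsUnit (M′ b a)
      M′-unit-mod b a a≤P = BP.unit-*
        (BP.unit-* (M.unit-lagrange a _ (s≤s a≤P)) (M.unit-lagrange a _ (s≤s a≤P)))
        (BP.unit-* (BP.unit-* D-unit D-unit) (BP.unit-* D-unit D-unit))
        where
        D-unit : BP.IsUnit (D b a)
        D-unit = M.unit-∏-coprime b a a≤P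

    -- The common factor `F` holds all powers of `π` and is cancelled by regularity. The remaining
    -- denominator `M′ b a` consists of factors prime to `p`.
    term-digits : ∀ b a A A′ → a ℕ.≤ P → IsTerm b A → IsTerm (b ℕ.* p ℕ.+ a) A′ →
      A′ * M′ b a ≈ s * A * (N₁ b a * N₂ b a * (q₁ b a * q₂ b a))
    term-digits b a A A′ a≤P A-term A′-term = quad-regular b (begin
      A′ * M′ b a * F
        ≈⟨ relation (- (A′ * V₁ b a * V₂ b a)) (quad-factorial b a) (relation (V₁ b a * V₂ b a) A′-term
           (solve 7 (λ A v w d f F R → A :* (v :* w :* d) :* f := R :* (v :* w)
             :+ (F :- d :* f) :* (:- (A :* v :* w)) :+ (A :* F :- R) :* (v :* w)) refl
             A′ (V₁ b a) (V₂ b a) (quad (D b a)) F (quad (factorial (b ℕ.* p ℕ.+ a))) _)) ⟩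
      rising² r₁ (b ℕ.* p ℕ.+ a) * rising² r₂ (b ℕ.* p ℕ.+ a) * (V₁ b a * V₂ b a)
        ≈⟨ digits b a A a≤P A-term ⟩
      s * A * (N₁ b a * N₂ b a * (q₁ b a * q₂ b a)) * F ∎)
      where
      F : Carrier
      F = quad (pow π b * factorial b)

    -- `M′ b a` is a unit modulo `p³`, hence a unit, so dividing by it preserves integrality.
    term-exists-digits : ∀ b a → a ℕ.≤ P → ∃ (IsTerm b) → ∃ (IsTerm (b ℕ.* p ℕ.+ a))
    term-exists-digits b a a≤P (A , A-term) = A′ (unit-lift (M′-unit-mod b a a≤P))
      where
      A′ : IsUnit (M′ b a) → ∃ (IsTerm (b ℕ.* p ℕ.+ a))
      A′ (v , Mv≈1) = s * A * Q * v , (begin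
        s * A * Q * v * quad (factorial (b ℕ.* p ℕ.+ a))
          ≈⟨ relation (s * A * Q * v) (quad-factorial b a)
             (relation (- (v * quad (D b a))) (digits b a A a≤P A-term)
             (relation R Mv≈1
             (solve 8 (λ x v F d f R V W → x :* v :* F := R :+ (F :- d :* f) :* (x :* v)
               :+ (R :* (V :* W) :- x :* f) :* (:- (v :* d)) :+ (V :* W :* d :* v :- con (+ 1)) :* R) refl
             (s * A * Q) v (quad (factorial (b ℕ.* p ℕ.+ a))) (quad (D b a)) (quad (pow π b * factorial b)) R (V₁ b a) (V₂ b a)))) ⟩
        R ∎)
        where
        Q R : Carrier
        Q = N₁ b a * N₂ b a * (q₁ b a * q₂ b a)
        R = rising² r₁ (b ℕ.* p ℕ.+ a) * rising² r₂ (b ℕ.* p ℕ.+ a)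

    term-exists : ∀ k → ∃ (IsTerm k)
    term-exists = <-rec (λ k → ∃ (IsTerm k)) step
      where
      step : ∀ k → (∀ {j} → j ℕ.< k → ∃ (IsTerm j)) → ∃ (IsTerm k)
      -- Zero is its own quotient by `p`, hence a case apart; its term is the empty product.
      step zero      rec = 1# , solve 0 (con (+ 1) :* (con (+ 1) :* con (+ 1) :* (con (+ 1) :* con (+ 1))) := con (+ 1) :* con (+ 1) :* (con (+ 1) :* con (+ 1))) refl
      step k@(suc _) rec = ≡.subst (∃ ∘ IsTerm) (≡.trans (ℕₚ.+-comm (k / p ℕ.* p) (k % p)) (≡.sym (m≡m%n+[m/n]*n k p)))
        (term-exists-digits (k / p) (k % p) (ℕₚ.≤-pred (m%n<n k p)) (rec (m/n<m k p (s≤s 0<P))))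

    A : ℕ → Carrier
    A k = proj₁ (term-exists k)

    A-term : ∀ k → IsTerm k (A k)
    A-term k = proj₂ (term-exists k)

    private
      X Y : Carrier
      X = r₁ * (1# - r₁)
      Y = r₂ * (1# - r₂)

    A-zero : A 0 ≈ 1#
    A-zero = trans (solve 1 (λ x → x := x :* (con (+ 1) :* con (+ 1) :* (con (+ 1) :* con (+ 1)))) refl (A 0))
      (trans (A-term 0) (solve 0 (con (+ 1) :* con (+ 1) :* (con (+ 1) :* con (+ 1)) := con (+ 1)) refl))

    -- The factors pair up as `(r + c) (1 - r + c) = r (1 - r) + c (1 + c)`. This recurrence serves
    -- the primes 2 and 3, where `σ₂` need not vanish modulo `p`.
    A-suc : ∀ c → A (suc c) * quad (1# + fromℕ c) ≈ A c * ((X + fromℕ c * (1# + fromℕ c)) * (Y + fromℕ c * (1# + fromℕ c)))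
    A-suc c = regular-* (regular-* f-reg f-reg) (regular-* f-reg f-reg) (begin
      A (suc c) * quad (1# + fromℕ c) * quad f
        ≈⟨ solve 3 (λ a x f → a :* (x :* x :* (x :* x)) :* (f :* f :* (f :* f)) := a :* (f :* x :* (f :* x) :* (f :* x :* (f :* x)))) refl (A (suc c)) (1# + fromℕ c) f ⟩
      A (suc c) * quad (f * (1# + fromℕ c))
        ≈⟨ *-congˡ (*-cong (*-cong e e) (*-cong e e)) ⟨
      A (suc c) * quad (factorial (suc c))
        ≈⟨ A-term (suc c) ⟩
      rising² r₁ (suc c) * rising² r₂ (suc c)
        ≈⟨ relation (- ((X + fromℕ c * (1# + fromℕ c)) * (Y + fromℕ c * (1# + fromℕ c)))) (A-term c)
           (solve 9 (λ a F g h g′ h′ r r′ c → g :* (r :+ c) :* (h :* (con (+ 1) :- r :+ c)) :* (g′ :* (r′ :+ c) :* (h′ :* (con (+ 1) :- r′ :+ c)))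
             := a :* ((r :* (con (+ 1) :- r) :+ c :* (con (+ 1) :+ c)) :* (r′ :* (con (+ 1) :- r′) :+ c :* (con (+ 1) :+ c))) :* F
                :+ (a :* F :- g :* h :* (g′ :* h′)) :* (:- ((r :* (con (+ 1) :- r) :+ c :* (con (+ 1) :+ c)) :* (r′ :* (con (+ 1) :- r′) :+ c :* (con (+ 1) :+ c)))))
             refl (A c) (quad f) (rising r₁ c) (rising (1# - r₁) c) (rising r₂ c) (rising (1# - r₂) c) r₁ r₂ (fromℕ c)) ⟩
      A c * ((X + fromℕ c * (1# + fromℕ c)) * (Y + fromℕ c * (1# + fromℕ c))) * quad f ∎)
      where
      f : Carrier
      f = factorial c
      f-reg : Regular f
      f-reg = factorial-regular c
      e : factorial (suc c) ≈ f * (1# + fromℕ c)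
      e = *-congˡ (fromℕ-suc c)

    private
      c₁ c₂ : ℕ → Carrier
      c₁ = proj₁ (M.interpolation (roots P (π * u₁) m₁))
      c₂ = proj₁ (M.interpolation (roots P (π * u₂) m₂))

      local₁ local₂ : Carrier → ℕ → Carrier
      local₁ = M.local M.harmonic₂ c₁ u₁
      local₂ = M.local M.harmonic₂ c₂ u₂

    -- Modulo `p³`, the products of squares contribute `D⁴` and the products `q₁`, `q₂` contribute
    -- `V₁` and `V₂`; exactly `M′ b a` can be cancelled.
    term-mod : ∀ b a → a ℕ.≤ P → A (b ℕ.* p ℕ.+ a) ≋ s * A b * (local₁ (fromℕ b) a * local₂ (fromℕ b) a)
    term-mod b a a≤P = BP.unit-cancelʳ (M′-unit-mod b a a≤P) (B.trans
      (≈⇒≋ (term-digits b a (A b) (A (b ℕ.* p ℕ.+ a)) a≤P (A-term b) (A-term (b ℕ.* p ℕ.+ a))))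
      (B.trans (B.*-congˡ (B.*-cong
        (B.*-cong (M.∏-coprime-squares u₁ b a a≤P) (M.∏-coprime-squares u₂ b a a≤P))
        (B.*-cong (proj₂ (M.interpolation (roots P (π * u₁) m₁)) a (fromℕ b + u₁) (s≤s a≤P))
                  (proj₂ (M.interpolation (roots P (π * u₂) m₂)) a (fromℕ b + u₂) (s≤s a≤P)))))
      (≈⇒≋ (solve 8 (λ x D v w e f I J → x :* (D :* D :* e :* (D :* D :* f) :* (v :* I :* (w :* J)))
          := x :* (e :* I :* (f :* J)) :* (v :* w :* (D :* D :* (D :* D)))) refl (s * A b) (D b a) (V₁ b a) (V₂ b a)
          (1# - π * π * (u₁ * u₁) * (fromℕ b * M.σ₂ + M.harmonic₂ a)) (1# - π * π * (u₂ * u₂) * (fromℕ b * M.σ₂ + M.harmonic₂ a))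
          (M.interpolate c₁ (π * (fromℕ b + u₁)) a) (M.interpolate c₂ (π * (fromℕ b + u₂)) a)))))

    private
      ππ : Carrier
      ππ = π * π

      -- What ∑-local leaves; it vanishes through σ₂ if p ≥ 5, and through A b if p ≤ 3.
      correction : ℕ → Carrier
      correction b = ππ * M.σ₂ * (A b * (fromℕ b * (X + Y + fromℕ b)))

      -- Modulo `p` one has `r = - m`.
      residue : ∀ r u m → r + fromℕ m ≈ π * u → ππ * (r * (1# - r)) ≋ - (ππ * (fromℕ m * (1# + fromℕ m)))
      residue r u m r+m≈pu = BP.relation (ππ * (1# - r + fromℕ m)) (≈⇒≋ r+m≈pu) (BP.relation (u * (1# - r + fromℕ m)) π³≋0
        (≈⇒≋ (solve 4 (λ t r u m → t :* t :* (r :* (con (+ 1) :- r)) := :- (t :* t :* (m :* (con (+ 1) :+ m)))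
          :+ (r :+ m :- t :* u) :* (t :* t :* (con (+ 1) :- r :+ m)) :+ (t :* t :* t :- con (+ 0)) :* (u :* (con (+ 1) :- r :+ m)))
          refl π r u (fromℕ m))))

      consecutive-even : ∀ c → ∃ λ e → fromℕ c * (1# + fromℕ c) ≈ fromℕ 2 * e
      consecutive-even zero    = 0# , solve 0 (con (+ 0) :* (con (+ 1) :+ con (+ 0)) := con (+ 2) :* con (+ 0)) refl
      consecutive-even (suc c) = step (consecutive-even c)
        where
        step : (∃ λ e → fromℕ c * (1# + fromℕ c) ≈ fromℕ 2 * e) → ∃ λ e → fromℕ (suc c) * (1# + fromℕ (suc c)) ≈ fromℕ 2 * e
        step (e , even) = e + (1# + fromℕ c) ,
          relation (1# + fromℕ (suc c) + (1# + fromℕ c)) (fromℕ-suc c) (relation 1# even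
            (solve 3 (λ c c′ e → c′ :* (con (+ 1) :+ c′) := con (+ 2) :* (e :+ (con (+ 1) :+ c))
              :+ (c′ :- (con (+ 1) :+ c)) :* (con (+ 1) :+ c′ :+ (con (+ 1) :+ c)) :+ (c :* (con (+ 1) :+ c) :- con (+ 2) :* e) :* con (+ 1))
              refl (fromℕ c) (fromℕ (suc c)) e))

      -- Let `b = 1 + c`. Modulo 2 the numbers `X`, `Y` and `c b` vanish, so the correction reduces
      -- to `A b` times `b²`. Since `c b` divides `b⁴ - b²`, the exponent may be raised to four, and
      -- `A-suc` then produces the factor `X + c b`. No distinction by the parity of `b` is needed.
      correction-2 : π ≈ fromℕ 2 → ∀ b → correction b ≋ 0#
      correction-2 π≈2 zero    = ≈⇒≋ (solve 3 (λ s a x → s :* (a :* (con (+ 0) :* (x :+ con (+ 0)))) := con (+ 0)) refl (ππ * M.σ₂) (A 0) (X + Y))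
      correction-2 π≈2 (suc c) =
        BP.relation (ππ * M.σ₂ * a * (X + Y + fromℕ (suc c) + (1# + C))) (≈⇒≋ (fromℕ-suc c))
        (BP.relation (M.σ₂ * a * β + M.σ₂ * A c * (Y + C * β)) (vanish r₁ u₁ m₁ r₁+m₁≈pu₁)
        (BP.relation (M.σ₂ * a * β) (vanish r₂ u₂ m₂ r₂+m₂≈pu₂)
        (BP.relation (- (M.σ₂ * a * β * (1# + β)) + M.σ₂ * A c * (Y + C * β)) (even c)
        (BP.relation (M.σ₂ * ππ) (≈⇒≋ (A-suc c))
        (≈⇒≋ (solve 8 (λ t s a a₀ C b X Y → t :* s :* (a :* (b :* (X :+ Y :+ b))) :=
          con (+ 0) :+ (b :- (con (+ 1) :+ C)) :* (t :* s :* a :* (X :+ Y :+ b :+ (con (+ 1) :+ C)))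
          :+ (t :* X :- con (+ 0)) :* (s :* a :* (con (+ 1) :+ C) :+ s :* a₀ :* (Y :+ C :* (con (+ 1) :+ C)))
          :+ (t :* Y :- con (+ 0)) :* (s :* a :* (con (+ 1) :+ C))
          :+ (t :* (C :* (con (+ 1) :+ C)) :- con (+ 0)) :* (:- (s :* a :* (con (+ 1) :+ C) :* (con (+ 1) :+ (con (+ 1) :+ C))) :+ s :* a₀ :* (Y :+ C :* (con (+ 1) :+ C)))
          :+ (a :* ((con (+ 1) :+ C) :* (con (+ 1) :+ C) :* ((con (+ 1) :+ C) :* (con (+ 1) :+ C))) :- a₀ :* ((X :+ C :* (con (+ 1) :+ C)) :* (Y :+ C :* (con (+ 1) :+ C)))) :* (s :* t))
          refl ππ M.σ₂ a (A c) C (fromℕ (suc c)) X Y))))))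
        where
        a C β : Carrier
        a = A (suc c)
        C = fromℕ c
        β = 1# + C
        even : ∀ c → ππ * (fromℕ c * (1# + fromℕ c)) ≋ 0#
        even c = step (consecutive-even c)
          where
          step : (∃ λ e → fromℕ c * (1# + fromℕ c) ≈ fromℕ 2 * e) → ππ * (fromℕ c * (1# + fromℕ c)) ≋ 0#
          step (e , ev) = BP.relation e π³≋0 (≈⇒≋ (relation ππ ev (relation (- (ππ * e)) π≈2
            (solve 4 (λ t x T e → t :* t :* x := con (+ 0) :+ (t :* t :* t :- con (+ 0)) :* e :+ (x :- T :* e) :* (t :* t) :+ (t :- T) :* (:- (t :* t :* e)))
              refl π (fromℕ c * (1# + fromℕ c)) (fromℕ 2) e))))
        vanish : ∀ r u m → r + fromℕ m ≈ π * u → ππ * (r * (1# - r)) ≋ 0#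
        vanish r u m h = B.trans (residue r u m h) (BP.relation (- 1#) (even m)
          (≈⇒≋ (solve 1 (λ x → :- x := con (+ 0) :+ (x :- con (+ 0)) :* (:- con (+ 1))) refl (ππ * (fromℕ m * (1# + fromℕ m))))))

      module Three (π≈3 : π ≈ fromℕ 3) (P≡2 : P ≡ 2) where

        -- For `m = 0, 1, 2` the value `- m (m + 1)` is `0, -2, -6`, which modulo 3 is `0, 1, 0`.
        residue-01 : ∀ r u m → m ℕ.≤ P → r + fromℕ m ≈ π * u → (ππ * (r * (1# - r)) ≋ 0#) ⊎ (ππ * (r * (1# - r)) ≋ ππ * 1#)
        residue-01 r u m m≤P h = cases m (≡.subst (m ℕ.≤_) P≡2 m≤P) (residue r u m h)
          where
          cases : ∀ m → m ℕ.≤ 2 → ∀ {x} → x ≋ - (ππ * (fromℕ m * (1# + fromℕ m))) → (x ≋ 0#) ⊎ (x ≋ ππ * 1#)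
          cases 0 _ e = inj₁ (B.trans e (≈⇒≋ (solve 1 (λ t → :- (t :* (con (+ 0) :* (con (+ 1) :+ con (+ 0)))) := con (+ 0)) refl ππ)))
          cases 1 _ e = inj₂ (B.trans e (BP.relation (- 1#) π³≋0 (≈⇒≋ (relation ππ π≈3
            (solve 1 (λ t → :- (t :* t :* (con (+ 1) :* (con (+ 1) :+ con (+ 1)))) := t :* t :* con (+ 1)
              :+ (t :* t :* t :- con (+ 0)) :* (:- con (+ 1)) :+ (t :- con (+ 3)) :* (t :* t)) refl π)))))
          cases 2 _ e = inj₁ (B.trans e (BP.relation (- fromℕ 2) π³≋0 (≈⇒≋ (relation (fromℕ 2 * ππ) π≈3
            (solve 1 (λ t → :- (t :* t :* (con (+ 2) :* (con (+ 1) :+ con (+ 2)))) := con (+ 0)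
              :+ (t :* t :* t :- con (+ 0)) :* (:- con (+ 2)) :+ (t :- con (+ 3)) :* (con (+ 2) :* (t :* t))) refl π)))))
          cases (suc (suc (suc _))) (s≤s (s≤s ())) e

        X-cases : (ππ * X ≋ 0#) ⊎ (ππ * X ≋ ππ * 1#)
        X-cases = residue-01 r₁ u₁ m₁ m₁≤P r₁+m₁≈pu₁

        Y-cases : (ππ * Y ≋ 0#) ⊎ (ππ * Y ≋ ππ * 1#)
        Y-cases = residue-01 r₂ u₂ m₂ m₂≤P r₂+m₂≈pu₂

        -- With `v = ± 1` the fourth power of `w` is 1 modulo `p`, so the recurrence determines `a`
        -- modulo `p`.
        divisible : ∀ {a a′ w x y} v → v * v ≈ 1# → ππ * w ≋ ππ * v → ππ * x ≋ 0# → a * quad w ≈ a′ * (x * y) → ππ * a ≋ 0#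
        divisible {a} {a′} {w} {x} {y} v v²≈1 w≋v x≋0 rec =
          BP.relation (- (ππ * a * (1# + v * v))) (≈⇒≋ v²≈1)
          (BP.relation (- (a * (v + w) * (v * v + w * w))) w≋v
          (BP.relation (a′ * y) x≋0
          (BP.relation ππ (≈⇒≋ rec)
          (≈⇒≋ (solve 7 (λ t a a′ w x y v → t :* a := con (+ 0)
            :+ (v :* v :- con (+ 1)) :* (:- (t :* a :* (con (+ 1) :+ v :* v)))
            :+ (t :* w :- t :* v) :* (:- (a :* (v :+ w) :* (v :* v :+ w :* w)))
            :+ (t :* x :- con (+ 0)) :* (a′ :* y)
            :+ (a :* (w :* w :* (w :* w)) :- a′ :* (x :* y)) :* t) refl ππ a a′ w x y v)))))

        from-A : ∀ b → ππ * A b ≋ 0# → correction b ≋ 0#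
        from-A b e = BP.relation (M.σ₂ * (fromℕ b * (X + Y + fromℕ b))) e
          (≈⇒≋ (solve 4 (λ t s a x → t :* s :* (a :* x) := con (+ 0) :+ (t :* a :- con (+ 0)) :* (s :* x)) refl ππ M.σ₂ (A b) (fromℕ b * (X + Y + fromℕ b))))

        1²≈1 : 1# * 1# ≈ 1#
        1²≈1 = *-identityˡ 1#

        [-1]²≈1 : - 1# * - 1# ≈ 1#
        [-1]²≈1 = solve 0 (:- con (+ 1) :* (:- con (+ 1)) := con (+ 1)) refl

        module _ (z : ℕ) (z≋0 : ππ * fromℕ z ≋ 0#) where

          private
            C : Carrier
            C = fromℕ z

            C₁ : fromℕ (suc z) ≈ 1# + C
            C₁ = fromℕ-suc z

            w₁ : ππ * (1# + C) ≋ ππ * 1#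
            w₁ = BP.relation 1# z≋0 (≈⇒≋ (solve 2 (λ t c → t :* (con (+ 1) :+ c) := t :* con (+ 1) :+ (t :* c :- con (+ 0)) :* con (+ 1)) refl ππ C))

            w₂ : ππ * (1# + fromℕ (suc z)) ≋ ππ * - 1#
            w₂ = BP.relation 1# z≋0 (BP.relation 1# π³≋0 (≈⇒≋ (relation ππ C₁ (relation (- ππ) π≈3
              (solve 3 (λ t c c′ → t :* t :* (con (+ 1) :+ c′) := t :* t :* (:- con (+ 1)) :+ (t :* t :* c :- con (+ 0)) :* con (+ 1)
                :+ (t :* t :* t :- con (+ 0)) :* con (+ 1) :+ (c′ :- (con (+ 1) :+ c)) :* (t :* t) :+ (t :- con (+ 3)) :* (:- (t :* t))) refl π C (fromℕ (suc z)))))))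

            x₁ : ∀ {x} → ππ * x ≋ 0# → ππ * (x + C * (1# + C)) ≋ 0#
            x₁ {x} e = BP.relation 1# e (BP.relation (1# + C) z≋0
              (≈⇒≋ (solve 3 (λ t x c → t :* (x :+ c :* (con (+ 1) :+ c)) := con (+ 0) :+ (t :* x :- con (+ 0)) :* con (+ 1) :+ (t :* c :- con (+ 0)) :* (con (+ 1) :+ c)) refl ππ x C)))

            x₂ : ∀ {x} → ππ * x ≋ ππ * 1# → ππ * (x + fromℕ (suc z) * (1# + fromℕ (suc z))) ≋ 0#
            x₂ {x} e = BP.relation 1# e (BP.relation (fromℕ (suc z)) w₂ (BP.relation (- 1#) z≋0 (≈⇒≋ (relation (- ππ) C₁
              (solve 4 (λ t x c c′ → t :* (x :+ c′ :* (con (+ 1) :+ c′)) := con (+ 0) :+ (t :* x :- t :* con (+ 1)) :* con (+ 1)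
                :+ (t :* (con (+ 1) :+ c′) :- t :* (:- con (+ 1))) :* c′ :+ (t :* c :- con (+ 0)) :* (:- con (+ 1))
                :+ (c′ :- (con (+ 1) :+ c)) :* (:- t)) refl ππ x C (fromℕ (suc z)))))))

            swap : ∀ {l a x y} → l ≈ a * (x * y) → l ≈ a * (y * x)
            swap e = trans e (*-congˡ (*-comm _ _))

          A₁ˣ : ππ * X ≋ 0# → ππ * A (suc z) ≋ 0#
          A₁ˣ e = divisible 1# 1²≈1 w₁ (x₁ e) (A-suc z)

          A₁ʸ : ππ * Y ≋ 0# → ππ * A (suc z) ≋ 0#
          A₁ʸ e = divisible 1# 1²≈1 w₁ (x₁ e) (swap (A-suc z))

          correction₀ : correction z ≋ 0#
          correction₀ = BP.relation (M.σ₂ * A z * (X + Y + C)) z≋0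
            (≈⇒≋ (solve 5 (λ t s a x c → t :* s :* (a :* (c :* (x :+ c))) := con (+ 0) :+ (t :* c :- con (+ 0)) :* (s :* a :* (x :+ c))) refl ππ M.σ₂ (A z) (X + Y) C))

          -- The step from `z` has the factors `X` and `Y` modulo 3, so `A (suc z)` vanishes if one
          -- of them does. Otherwise both are 1 and `X + Y + b` is 3.
          correction₁ : correction (suc z) ≋ 0#
          correction₁ = cases X-cases Y-cases
            where
            cases : (ππ * X ≋ 0#) ⊎ (ππ * X ≋ ππ * 1#) → (ππ * Y ≋ 0#) ⊎ (ππ * Y ≋ ππ * 1#) → correction (suc z) ≋ 0#
            cases (inj₁ e) _        = from-A (suc z) (A₁ˣ e)
            cases _        (inj₁ e) = from-A (suc z) (A₁ʸ e)
            cases (inj₂ e) (inj₂ f) = BP.relation k e (BP.relation k f (BP.relation k w₁ (BP.relation k π³≋0 (≈⇒≋ (relation (ππ * k) C₁ (relation (- (ππ * k)) π≈3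
              (solve 7 (λ t s a X Y c b → t :* t :* s :* (a :* (b :* (X :+ Y :+ b))) := con (+ 0) :+ (t :* t :* X :- t :* t :* con (+ 1)) :* (s :* a :* b)
                :+ (t :* t :* Y :- t :* t :* con (+ 1)) :* (s :* a :* b) :+ (t :* t :* (con (+ 1) :+ c) :- t :* t :* con (+ 1)) :* (s :* a :* b)
                :+ (t :* t :* t :- con (+ 0)) :* (s :* a :* b) :+ (b :- (con (+ 1) :+ c)) :* (t :* t :* (s :* a :* b)) :+ (t :- con (+ 3)) :* (:- (t :* t :* (s :* a :* b))))
                refl π M.σ₂ (A (suc z)) X Y C (fromℕ (suc z)))))))))
              where
              k : Carrier
              k = M.σ₂ * A (suc z) * fromℕ (suc z)

          -- The step from `z + 1` has the factors `X + 2` and `Y + 2` modulo 3, so a value 1 of `X`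
          -- or `Y` suffices. If both are 0, the preceding term vanishes already and the recurrence
          -- passes this on.
          correction₂ : correction (suc (suc z)) ≋ 0#
          correction₂ = from-A (suc (suc z)) (cases X-cases Y-cases)
            where
            cases : (ππ * X ≋ 0#) ⊎ (ππ * X ≋ ππ * 1#) → (ππ * Y ≋ 0#) ⊎ (ππ * Y ≋ ππ * 1#) → ππ * A (suc (suc z)) ≋ 0#
            cases (inj₂ e) _        = divisible (- 1#) [-1]²≈1 w₂ (x₂ e) (A-suc (suc z))
            cases _        (inj₂ e) = divisible (- 1#) [-1]²≈1 w₂ (x₂ e) (swap (A-suc (suc z)))
            cases (inj₁ e) (inj₁ _) = divisible (- 1#) [-1]²≈1 w₂ (A₁ˣ e) (trans (A-suc (suc z)) (sym (*-identityˡ _)))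

        correction-3 : ∀ b → correction b ≋ 0#
        correction-3 b = cases (b / p) (b % p) (m%n<n b p) (m≡m%n+[m/n]*n b p)
          where
          cases : ∀ q r → r ℕ.< p → b ≡ r ℕ.+ q ℕ.* p → correction b ≋ 0#
          cases q r r<p ≡.refl = digit r (≡.subst (λ n → r ℕ.< suc n) P≡2 r<p)
            where
            z≋0 : ππ * fromℕ (q ℕ.* p) ≋ 0#
            z≋0 = BP.relation (fromℕ q) π³≋0 (≈⇒≋ (relation ππ (fromℕ-* q p)
              (solve 3 (λ t q z → t :* t :* z := con (+ 0) :+ (t :* t :* t :- con (+ 0)) :* q :+ (z :- q :* t) :* (t :* t)) refl π (fromℕ q) (fromℕ (q ℕ.* p)))))
            digit : ∀ r → r ℕ.< 3 → correction (r ℕ.+ q ℕ.* p) ≋ 0#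
            digit 0 _ = correction₀ (q ℕ.* p) z≋0
            digit 1 _ = correction₁ (q ℕ.* p) z≋0
            digit 2 _ = correction₂ (q ℕ.* p) z≋0
            digit (suc (suc (suc _))) (s≤s (s≤s (s≤s ())))

    module _ (P-cases : P ≡ 1 ⊎ P ≡ 2 ⊎ ∃ λ h → P ≡ h ℕ.* 2 × 2 ℕ.< P) where

      private
        correction-vanishes : ∀ b → correction b ≋ 0#
        correction-vanishes b = cases P-cases
          where
          cases : P ≡ 1 ⊎ P ≡ 2 ⊎ (∃ λ h → P ≡ h ℕ.* 2 × 2 ℕ.< P) → correction b ≋ 0#
          cases (inj₁ P≡1)                        = correction-2 (reflexive (≡.cong (λ n → fromℕ (suc n)) P≡1)) b
          cases (inj₂ (inj₁ P≡2))                 = Three.correction-3 (reflexive (≡.cong (λ n → fromℕ (suc n)) P≡2)) P≡2 b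
          cases (inj₂ (inj₂ (h , P≡2h , 2<P))) = B.trans (B.*-congʳ (M.σ₂-vanishes h P≡2h 2<P)) (≈⇒≋ (zeroˡ _))

      ∑-block : ∀ b → ∑ p (λ a → A (b ℕ.* p ℕ.+ a)) ≋ A b * ∑ p A
      ∑-block b = B.trans (expand b) (B.trans (B.*-congˡ (M.∑-local M.harmonic₂ c₁ c₂ u₁ u₂ (fromℕ b)))
        (B.trans (BP.relation (s * Z) (correction-vanishes b) (BP.relation (ππ * M.σ₂ * A b * fromℕ b * s * Z) (≈⇒≋ dash-sum)
          (BP.relation (- (s * A b * L)) (≈⇒≋ A-zero)
          (≈⇒≋ (solve 10 (λ t σ s a a₀ c x X L Z → s :* a :* (L :+ t :* σ :* (c :* (x :+ c)) :* Z)
            := a :* (s :* a₀ :* L) :+ (t :* σ :* (a :* (c :* (X :+ c))) :- con (+ 0)) :* (s :* Z)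
               :+ (x :- X) :* (t :* σ :* a :* c :* s :* Z) :+ (a₀ :- con (+ 1)) :* (:- (s :* a :* L)))
            refl ππ M.σ₂ s (A b) (A 0) (fromℕ b) (u₁ * (1# - u₁) + u₂ * (1# - u₂)) (X + Y) L Z)))))
        -- At `b = 0` the index `0 * p + a` computes to `a`, so that the sum is `∑ p A`; the extra
        -- factor `A 0` was matched by `A-zero`.
        (B.sym (B.*-congˡ (expand 0)))))
        where
        L Z : Carrier
        L = ∑ p (λ a → local₁ 0# a * local₂ 0# a)
        Z = ∑ p (λ a → c₁ a * c₂ a)
        expand : ∀ b → ∑ p (λ a → A (b ℕ.* p ℕ.+ a)) ≋ s * A b * ∑ p (λ a → local₁ (fromℕ b) a * local₂ (fromℕ b) a)
        expand b = B.trans (BP.∑-cong p λ a a<p → term-mod b a (ℕₚ.≤-pred a<p)) (B.sym (BP.*-distribˡ-∑ p _ _))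

      ∑-A-multiplicative : ∀ N → ∑ (N ℕ.* p) A ≋ ∑ N A * ∑ p A
      ∑-A-multiplicative N = B.trans (≈⇒≋ (∑-blocks N p A))
        (B.trans (BP.∑-cong′ N ∑-block) (B.sym (BP.*-distribʳ-∑ N _ _)))

-- The action of p on the admissible parameters

-- rising² takes the same values at r and at 1 - r.
UpToReflection : ℚ → ℚ → Set
UpToReflection u r = u ≡ r ⊎ u ≡ 1ℚ ℚ.- r

upToReflection? : ∀ u r → Dec (UpToReflection u r)
upToReflection? u r = u ℚₚ.≟ r ⊎-dec u ℚₚ.≟ (1ℚ ℚ.- r)

-- For `ρ = p % ↧ₙ r` this makes `p * dash r c - r` an integer. Only `p` modulo the denominator
-- enters, so finitely many checks cover all primes.
DashResidue : (ρ : ℕ) (r : ℚ) → Fin (↧ₙ r) → Set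
DashResidue ρ r c = (ρ ℕ.* toℕ c) % ↧ₙ r ≡ ℤ.∣ ↥ r ∣

dash : (r : ℚ) → Fin (↧ₙ r) → ℚ
dash r c = + toℕ c ℚ./ ↧ₙ r

-- Decided by evaluation. It succeeds because the units modulo 2, 3, 4 and 6 are only `± 1`: each
-- parameter is fixed up to reflection.
ratio-dash : All (λ r → ∀ (ρ : Fin (↧ₙ r)) → Coprime (toℕ ρ) (↧ₙ r) →
  ∃ λ c → DashResidue (toℕ ρ) r c × UpToReflection (dash r c) r) ratios
ratio-dash = from-yes (all? (λ r → Finₚ.all? {n = ↧ₙ r} λ ρ → coprime? (toℕ ρ) (↧ₙ r) →-dec
  Finₚ.any? λ c → (toℕ ρ ℕ.* toℕ c) % ↧ₙ r ℕₚ.≟ ℤ.∣ ↥ r ∣ ×-dec upToReflection? (dash r c) r) ratios)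

-- Modulo 5, 8, 10 and 12 there are four units, and the numerators of `r`, `1 - r`, `r′`, `1 - r′`
-- are all of them. Multiplication by a unit commutes with reflection, so it fixes or exchanges the
-- two reflection pairs.
pair-dash : All (λ (r , r′) → ↧ₙ r ≡ ↧ₙ r′ × ∀ (ρ : Fin (↧ₙ r)) → Coprime (toℕ ρ) (↧ₙ r) →
  ∃ λ c → DashResidue (toℕ ρ) r c × ∃ λ c′ → DashResidue (toℕ ρ) r′ c′ ×
  ( UpToReflection (dash r c) r × UpToReflection (dash r′ c′) r′
  ⊎ UpToReflection (dash r c) r′ × UpToReflection (dash r′ c′) r)) pairs
pair-dash = from-yes (all? (λ (r , r′) → ↧ₙ r ℕₚ.≟ ↧ₙ r′ ×-dec Finₚ.all? {n = ↧ₙ r} λ ρ → coprime? (toℕ ρ) (↧ₙ r) →-dec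
  Finₚ.any? λ c → (toℕ ρ ℕ.* toℕ c) % ↧ₙ r ℕₚ.≟ ℤ.∣ ↥ r ∣ ×-dec
  Finₚ.any? λ c′ → (toℕ ρ ℕ.* toℕ c′) % ↧ₙ r′ ℕₚ.≟ ℤ.∣ ↥ r′ ∣ ×-dec
  (upToReflection? (dash r c) r ×-dec upToReflection? (dash r′ c′) r′
  ⊎-dec upToReflection? (dash r c) r′ ×-dec upToReflection? (dash r′ c′) r)) pairs)

dash-equation : ∀ r {n} (c m p : ℕ) → ↥ r ≡ + n → n ℕ.+ m ℕ.* ↧ₙ r ≡ p ℕ.* c → r ℚ.+ ℕ→ℚ m ≡ ℕ→ℚ p ℚ.* (+ c ℚ./ ↧ₙ r)
dash-equation r@(mkℚ _ d _) {n} c m p r≡n n+md≡pc = ℚₚ.toℚᵘ-injective (begin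
  ℚ.toℚᵘ (r ℚ.+ ℕ→ℚ m)                            ≈⟨ ℚₚ.toℚᵘ-homo-+ r (ℕ→ℚ m) ⟩
  ℚ.toℚᵘ r ℚᵘ.+ ℚ.toℚᵘ (ℕ→ℚ m)                    ≈⟨ ℚᵘₚ.+-congʳ (ℚ.toℚᵘ r) (toℚᵘ-ℕ→ℚ m) ⟩
  ℚᵘ.mkℚᵘ (↥ r) d ℚᵘ.+ ℚᵘ.mkℚᵘ (+ m) 0            ≈⟨ ℚᵘ.*≡* (≡.cong₂ ℤ._*_ numerators (≡.cong +_ (ℕₚ.*-comm 1 (suc d)))) ⟩
  ℚᵘ.mkℚᵘ (+ p) 0 ℚᵘ.* ℚᵘ.mkℚᵘ (+ c) d            ≈⟨ ℚᵘₚ.*-cong (toℚᵘ-ℕ→ℚ p) (ℚₚ.toℚᵘ-fromℚᵘ (ℚᵘ.mkℚᵘ (+ c) d)) ⟨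
  ℚ.toℚᵘ (ℕ→ℚ p) ℚᵘ.* ℚ.toℚᵘ (+ c ℚ./ suc d)      ≈⟨ ℚₚ.toℚᵘ-homo-* (ℕ→ℚ p) (+ c ℚ./ suc d) ⟨
  ℚ.toℚᵘ (ℕ→ℚ p ℚ.* (+ c ℚ./ suc d))              ∎)
  where
  open ℚᵘₚ.≃-Reasoning
  numerators : ↥ r ℤ.* + 1 ℤ.+ + m ℤ.* + suc d ≡ + p ℤ.* + c
  numerators = ≡.trans (≡.cong₂ ℤ._+_ (≡.trans (ℤₚ.*-identityʳ (↥ r)) r≡n) (≡.sym (ℤₚ.pos-* m (suc d))))
    (≡.trans (≡.cong +_ n+md≡pc) (ℤₚ.pos-* p c))

pos⇒↥≡+∣↥∣ : ∀ r → ℚ.Positive r → ↥ r ≡ + ℤ.∣ ↥ r ∣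
pos⇒↥≡+∣↥∣ (mkℚ (+ _) _ _) _ = ≡.refl

coprime-% : ∀ p d .{{_ : ℕ.NonZero d}} → Coprime p d → Coprime (p % d) d
coprime-% p d p⊥d {k} (k∣p%d , k∣d) = p⊥d (≡.subst (k ∣_) (≡.trans (ℕₚ.+-comm (p / d ℕ.* d) (p % d)) (≡.sym (m≡m%n+[m/n]*n p d)))
  (∣m∣n⇒∣m+n (∣n⇒∣m*n (p / d) k∣d) k∣p%d) , k∣d)

-- p u ≡ r modulo the integers, the representative u of [0 , 1) being Dwork's r′.
record Dash (p : ℕ) (r u : ℚ) : Set where
  field
    m        : ℕ
    m<p      : m ℕ.< p
    equation : r ℚ.+ ℕ→ℚ m ≡ ℕ→ℚ p ℚ.* u
    ↧u∣↧r   : ↧ₙ u ∣ ↧ₙ r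

-- `m` is the integer part of `p c / d`, where `d` is the denominator; it is below `p` because
-- `c < d`.
dash-residue : ∀ p r → ℕ.NonZero p → ℚ.Positive r → ∀ c → DashResidue (p % ↧ₙ r) r c → Dash p r (dash r c)
dash-residue p r p≢0 r>0 c residue = record
  { m        = m
  ; m<p      = ℕₚ.*-cancelʳ-< d m p (ℕₚ.≤-<-trans m*d≤pc (ℕₚ.*-monoʳ-< p {{p≢0}} (toℕ<n c)))
  ; equation = dash-equation r (toℕ c) m p (pos⇒↥≡+∣↥∣ r r>0) pc≡
  ; ↧u∣↧r    = ↧-/-∣ (+ toℕ c) d
  }
  where
  d m : ℕ
  d = ↧ₙ r
  m = (p ℕ.* toℕ c) / d
  pc%d : (p ℕ.* toℕ c) % d ≡ ℤ.∣ ↥ r ∣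
  pc%d = begin
    (p ℕ.* toℕ c) % d                           ≡⟨ %-distribˡ-* p (toℕ c) d ⟩
    ((p % d) ℕ.* (toℕ c % d)) % d               ≡⟨ ≡.cong (λ k → (k ℕ.* (toℕ c % d)) % d) (m%n%n≡m%n p d) ⟨
    ((p % d % d) ℕ.* (toℕ c % d)) % d           ≡⟨ %-distribˡ-* (p % d) (toℕ c) d ⟨
    ((p % d) ℕ.* toℕ c) % d                     ≡⟨ residue ⟩
    ℤ.∣ ↥ r ∣                                   ∎
    where open ≡.≡-Reasoning
  pc≡ : ℤ.∣ ↥ r ∣ ℕ.+ m ℕ.* d ≡ p ℕ.* toℕ c
  pc≡ = ≡.trans (≡.cong (ℕ._+ m ℕ.* d) (≡.sym pc%d)) (≡.sym (m≡m%n+[m/n]*n (p ℕ.* toℕ c) d))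
  m*d≤pc : m ℕ.* d ≤ p ℕ.* toℕ c
  m*d≤pc = ≡.subst (m ℕ.* d ≤_) pc≡ (ℕₚ.m≤n+m (m ℕ.* d) ℤ.∣ ↥ r ∣)

record DashPair (p : ℕ) (r₁ r₂ : ℚ) : Set where
  field
    u₁ u₂ : ℚ
    dash₁ : Dash p r₁ u₁
    dash₂ : Dash p r₂ u₂
    same  : UpToReflection u₁ r₁ × UpToReflection u₂ r₂ ⊎ UpToReflection u₁ r₂ × UpToReflection u₂ r₁

residueFin : ∀ p r → Fin (↧ₙ r)
residueFin p r = fromℕ< (m%n<n p (↧ₙ r))

toℕ-residueFin : ∀ p r → toℕ (residueFin p r) ≡ p % ↧ₙ r
toℕ-residueFin p r = toℕ-fromℕ< (m%n<n p (↧ₙ r))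

ratio-dash-p : ∀ p → ℕ.NonZero p → ∀ {r} → r ∈ ratios → Coprime p (↧ₙ r) → ℚ.Positive r → ∃ λ u → Dash p r u × UpToReflection u r
ratio-dash-p p p≢0 {r} r∈ p⊥d r>0 = result (lookup ratio-dash r∈ (residueFin p r)
    (≡.subst (λ k → Coprime k (↧ₙ r)) (≡.sym (toℕ-residueFin p r)) (coprime-% p (↧ₙ r) p⊥d)))
  where
  result : (∃ λ c → DashResidue (toℕ (residueFin p r)) r c × UpToReflection (dash r c) r) → ∃ λ u → Dash p r u × UpToReflection u r
  result (c , residue , refl-or-not) = dash r c ,
    dash-residue p r p≢0 r>0 c (≡.subst (λ k → DashResidue k r c) (toℕ-residueFin p r) residue) , refl-or-not

dash-pair : ∀ p → ℕ.NonZero p → ∀ {r₁ r₂} → Admissible r₁ r₂ → Coprime p (↧ₙ r₁) → Coprime p (↧ₙ r₂) →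
            ℚ.Positive r₁ → ℚ.Positive r₂ → DashPair p r₁ r₂
dash-pair p p≢0 (inj₁ (r₁∈ , r₂∈)) p⊥d₁ p⊥d₂ r₁>0 r₂>0 =
  result (ratio-dash-p p p≢0 r₁∈ p⊥d₁ r₁>0) (ratio-dash-p p p≢0 r₂∈ p⊥d₂ r₂>0)
  where
  result : ∀ {r₁ r₂} → (∃ λ u → Dash p r₁ u × UpToReflection u r₁) → (∃ λ u → Dash p r₂ u × UpToReflection u r₂) → DashPair p r₁ r₂
  result (u₁ , dash₁ , same₁) (u₂ , dash₂ , same₂) =
    record { u₁ = u₁ ; u₂ = u₂ ; dash₁ = dash₁ ; dash₂ = dash₂ ; same = inj₁ (same₁ , same₂) }
dash-pair p p≢0 {r₁} {r₂} (inj₂ r∈) p⊥d₁ p⊥d₂ r₁>0 r₂>0 = common (lookup pair-dash r∈)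
  where
  common : (↧ₙ r₁ ≡ ↧ₙ r₂ × ∀ (ρ : Fin (↧ₙ r₁)) → Coprime (toℕ ρ) (↧ₙ r₁) →
    ∃ λ c → DashResidue (toℕ ρ) r₁ c × ∃ λ c′ → DashResidue (toℕ ρ) r₂ c′ ×
    ( UpToReflection (dash r₁ c) r₁ × UpToReflection (dash r₂ c′) r₂
    ⊎ UpToReflection (dash r₁ c) r₂ × UpToReflection (dash r₂ c′) r₁)) → DashPair p r₁ r₂
  common (d₁≡d₂ , residues) = result (residues (residueFin p r₁)
      (≡.subst (λ k → Coprime k (↧ₙ r₁)) (≡.sym (toℕ-residueFin p r₁)) (coprime-% p (↧ₙ r₁) p⊥d₁)))
    where
    p%d : toℕ (residueFin p r₁) ≡ p % ↧ₙ r₂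
    p%d = ≡.trans (toℕ-residueFin p r₁) (%-congʳ {o = p} d₁≡d₂)
    result : (∃ λ c → DashResidue (toℕ (residueFin p r₁)) r₁ c × ∃ λ c′ → DashResidue (toℕ (residueFin p r₁)) r₂ c′ ×
      ( UpToReflection (dash r₁ c) r₁ × UpToReflection (dash r₂ c′) r₂
      ⊎ UpToReflection (dash r₁ c) r₂ × UpToReflection (dash r₂ c′) r₁)) → DashPair p r₁ r₂
    result (c , residue , c′ , residue′ , same) = record
      { u₁ = dash r₁ c ; u₂ = dash r₂ c′
      ; dash₁ = dash-residue p r₁ p≢0 r₁>0 c (≡.subst (λ k → DashResidue k r₁ c) (toℕ-residueFin p r₁) residue)
      ; dash₂ = dash-residue p r₂ p≢0 r₂>0 c′ (≡.subst (λ k → DashResidue k r₂ c′) p%d residue′)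
      ; same = same }

1/n*n≡1 : ∀ n .{{_ : ℕ.NonZero n}} → (+ 1 ℚ./ n) ℚ.* ℕ→ℚ n ≡ 1ℚ
1/n*n≡1 n@(suc k) = ℚₚ.toℚᵘ-injective (begin
  ℚ.toℚᵘ ((+ 1 ℚ./ n) ℚ.* ℕ→ℚ n)                 ≈⟨ ℚₚ.toℚᵘ-homo-* (+ 1 ℚ./ n) (ℕ→ℚ n) ⟩
  ℚ.toℚᵘ (+ 1 ℚ./ n) ℚᵘ.* ℚ.toℚᵘ (ℕ→ℚ n)         ≈⟨ ℚᵘₚ.*-cong (ℚₚ.toℚᵘ-fromℚᵘ (ℚᵘ.mkℚᵘ (+ 1) k)) (toℚᵘ-ℕ→ℚ n) ⟩
  ℚᵘ.mkℚᵘ (+ 1) k ℚᵘ.* ℚᵘ.mkℚᵘ (+ n) 0           ≈⟨ ℚᵘ.*≡* (≡.trans (ℤₚ.*-identityʳ _) (≡.cong (λ k → + 1 ℤ.* + k) (≡.sym (ℕₚ.*-identityʳ n)))) ⟩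
  ℚ.toℚᵘ 1ℚ                                      ∎)
  where open ℚᵘₚ.≃-Reasoning

dividing-by-ℕ : ∀ a n .{{_ : ℕ.NonZero n}} w x y z → a ℚ.* ℕ→ℚ n ≡ w ℚ.* x ℚ.* (y ℚ.* z) → a ≡ w ℚ.* x ℚ.* y ℚ.* z ℚ.* (+ 1 ℚ./ n)
dividing-by-ℕ a n w x y z = Factorization.dividing ℚₚ.+-*-commutativeRing a (ℕ→ℚ n) (+ 1 ℚ./ n) w x y z (1/n*n≡1 n)

parity : ∀ n → ∃ λ h → n ≡ h ℕ.* 2 ⊎ n ≡ suc (h ℕ.* 2)
parity zero    = 0 , inj₁ ≡.refl
parity (suc n) = step (parity n)
  where
  step : (∃ λ h → n ≡ h ℕ.* 2 ⊎ n ≡ suc (h ℕ.* 2)) → ∃ λ h → suc n ≡ h ℕ.* 2 ⊎ suc n ≡ suc (h ℕ.* 2)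
  step (h , inj₁ e) = h , inj₂ (≡.cong suc e)
  step (h , inj₂ e) = suc h , inj₁ (≡.cong suc e)

-- The even `P` of the last case is what the doubling argument for `σ₂` splits into halves.
prime-cases : ∀ {P} → Prime (suc P) → P ≡ 1 ⊎ P ≡ 2 ⊎ ∃ λ h → P ≡ h ℕ.* 2 × 2 ℕ.< P
prime-cases {0} pr = contradiction pr ¬prime[1]
prime-cases {1} pr = inj₁ ≡.refl
prime-cases {2} pr = inj₂ (inj₁ ≡.refl)
prime-cases {P@(suc (suc (suc _)))} pr = inj₂ (inj₂ (cases (parity P)))
  where
  cases : (∃ λ h → P ≡ h ℕ.* 2 ⊎ P ≡ suc (h ℕ.* 2)) → ∃ λ h → P ≡ h ℕ.* 2 × 2 ℕ.< P
  cases (h , inj₁ e) = h , e , s≤s (s≤s (s≤s z≤n))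
  cases (h , inj₂ e) = even (prime⇒irreducible pr (divides (suc h) (≡.cong suc e)))
    where
    even : 2 ≡ 1 ⊎ 2 ≡ suc P → ∃ λ h → P ≡ h ℕ.* 2 × 2 ℕ.< P
    even (inj₁ ())
    even (inj₂ ())

-- From integral elements back to rationals

module Values (p : ℕ) (pr : Prime p) where

  open Localization p pr
  private
    module O = CommutativeRing integralRing
    module Q = RingProperties ℚₚ.+-*-commutativeRing
    module QF = Factorization ℚₚ.+-*-commutativeRing
  open RingOps integralRing
  open RingProperties integralRing
  open Factorization integralRing

  value-rising : ∀ r k → value (rising r k) ≡ poch (value r) k
  value-rising r zero    = ≡.refl
  value-rising r (suc k) = ≡.cong₂ ℚ._*_ (value-rising r k) (≡.cong (value r ℚ.+_) (value-fromℕ k))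

  value-quad-factorial : ∀ k → value (quad (factorial k)) ≡ ℕ→ℚ ((k !) ^ 4)
  value-quad-factorial k = ≡.trans (value-≡ (O.sym e)) (value-fromℕ ((k !) ^ 4))
    where
    f : fromℕ (k !) O.≈ factorial k
    f = fromℕ-! k
    e : fromℕ ((k !) ^ 4) O.≈ quad (factorial k)
    e = O.trans (fromℕ-quad (k !)) (O.*-cong (O.*-cong f f) (O.*-cong f f))

  value-term : ∀ r₁ r₂ k A → A O.* quad (factorial k) O.≈ rising² r₁ k O.* rising² r₂ k → value A ≡ term (value r₁) (value r₂) k
  value-term r₁ r₂ k A e = dividing-by-ℕ (value A) ((k !) ^ 4) {{m^n≢0 (k !) 4 {{k ℕₚ.!≢0}}}}
    (poch (value r₁) k) (poch (1ℚ ℚ.- value r₁) k) (poch (value r₂) k) (poch (1ℚ ℚ.- value r₂) k)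
    (≡.trans (≡.cong (value A ℚ.*_) (≡.sym (value-quad-factorial k))) (≡.trans (value-≡ e)
      (≡.cong₂ ℚ._*_ (≡.cong₂ ℚ._*_ (value-rising r₁ k) (value-rising (O.1# O.- r₁) k))
                     (≡.cong₂ ℚ._*_ (value-rising r₂ k) (value-rising (O.1# O.- r₂) k)))))

  -- Cancellation takes place in the field of rationals. Positivity certifies that `z` is nonzero,
  -- and it is at hand for `p`, for factorials and for `b + u` alike.
  positive-regular : ∀ z → ℚ.Positive (value z) → ∀ {x y} → x O.* z O.≈ y O.* z → x O.≈ y
  positive-regular z z>0 {x} {y} e = equal (Q.unit-cancelʳ {value x} {value y} {value z}
    ((1/ value z) {{ℚₚ.pos⇒nonZero (value z) {{z>0}}}} , ℚₚ.*-inverseʳ (value z) {{ℚₚ.pos⇒nonZero (value z) {{z>0}}}}) (value-≡ e))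

  sum-value : ∀ n (f : ℕ → Integral) → sum {n} (λ k → value (f (toℕ k))) ≡ value (∑ n f)
  sum-value zero    f = ≡.refl
  sum-value (suc n) f = ≡.trans (≡.cong (value (f 0) ℚ.+_) (sum-value n (f ∘ suc))) (≡.sym (value-≡ (∑-suc n f)))

  sum-cong : ∀ n {f g : ℕ → ℚ} → (∀ k → f k ≡ g k) → sum {n} (λ k → f (toℕ k)) ≡ sum {n} (λ k → g (toℕ k))
  sum-cong zero    f≡g = ≡.refl
  sum-cong (suc n) f≡g = ≡.cong₂ ℚ._+_ (f≡g 0) (sum-cong n (f≡g ∘ suc))

  value-inverse : ∀ x y v q .{{_ : ℚ.NonZero q}} → q ≡ value y → y O.* v O.≈ O.1# → value x ÷ q ≡ value (x O.* v)
  value-inverse x y v q q≡y yv≈1 = ≡.cong (value x ℚ.*_)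
    (QF.inverse-unique q (value v) (1/ q) (≡.trans (≡.cong (ℚ._* value v) q≡y) (value-≡ yv≈1)) (ℚₚ.*-inverseʳ q))

  open Quotient integralRing (fromℕ p O.* fromℕ p O.* fromℕ p) using (_≋_; mod)

  difference-of-≋ : ∀ {x y} → x ≋ y → ∃ λ z → z ∈ℤ₍ p ₎ × value x ℚ.- value y ≡ ℕ→ℚ (p ^ 3) ℚ.* z
  difference-of-≋ {x} {y} (mod q e) = value q , integral q ,
    ≡.trans (value-≡ d) (≡.cong (ℚ._* value q) (value-fromℕ (p ^ 3)))
    where
    d : x O.- y O.≈ fromℕ (p ^ 3) O.* q
    d = cube-difference p {x} {y} {q} e

  ≋⇒≡mod : ∀ {x y q q′} → x ≋ y → q ≡ value x → q′ ≡ value y → q ≡ q′ [ℤ₍ p ₎mod p ^ 3 ]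
  ≋⇒≡mod {x} {y} x≋y ≡.refl ≡.refl = record { x-integral = integral x ; y-integral = integral y ; difference = difference-of-≋ x≋y }

  multiple⇒≡0mod : ∀ {x q} → (∃ λ z → x O.≈ z O.* fromℕ p) → q ≡ value x → q ≡ 0ℚ [ℤ₍ p ₎mod p ]
  multiple⇒≡0mod {x} (z , e) ≡.refl = record { x-integral = integral x ; y-integral = integral-0 ; difference = value z , integral z ,
    ≡.trans (value-≡ d) (≡.cong (ℚ._* value z) (value-fromℕ p)) }
    where
    d : x O.- O.0# O.≈ fromℕ p O.* z
    d = multiple-difference {x} {z} {fromℕ p} e

-- Quotients of successive values of H

module Ratios (P : ℕ) (pr : Prime (suc P)) (r₁ r₂ : ℚ) (adm : Admissible r₁ r₂)
  (p∤lcm : suc P ∤ leastCommonDenominator r₁ r₂) where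

  private
    p : ℕ
    p = suc P

  open Localization p pr
  open Values p pr
  open RingOps integralRing
  open RingProperties integralRing using (IsUnit; unit-1; unit-*; unit-resp)
  open Factorization integralRing
  open CommutativeRing integralRing
    using (_+_; _*_; _-_; 1#; _≈_; sym; trans; *-cong; +-cong; *-comm; +-identityˡ; *-assoc; *-congʳ; *-congˡ)

  private
    p⊥d₁ : Coprime p (↧ₙ r₁)
    p⊥d₁ = ∤⇒coprime λ p∣d → p∤lcm (∣-trans p∣d (m∣lcm[m,n] (↧ₙ r₁) (↧ₙ r₂)))

    p⊥d₂ : Coprime p (↧ₙ r₂)
    p⊥d₂ = ∤⇒coprime λ p∣d → p∤lcm (∣-trans p∣d (n∣lcm[m,n] (↧ₙ r₁) (↧ₙ r₂)))

    r₁-unit : InUnitInterval r₁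
    r₁-unit = proj₁ (admissible-inUnitInterval adm)

    r₂-unit : InUnitInterval r₂
    r₂-unit = proj₂ (admissible-inUnitInterval adm)

    open DashPair (dash-pair p _ adm p⊥d₁ p⊥d₂ (ℚ.positive (proj₁ r₁-unit)) (ℚ.positive (proj₁ r₂-unit)))
    module D₁ = Dash dash₁
    module D₂ = Dash dash₂

    R₁ R₂ U₁ U₂ : Integral
    R₁ = r₁ , p⊥d₁
    R₂ = r₂ , p⊥d₂
    U₁ = u₁ , coprime-∣ D₁.↧u∣↧r p⊥d₁
    U₂ = u₂ , coprime-∣ D₂.↧u∣↧r p⊥d₂

    lift-equation : ∀ r u m → value r ℚ.+ ℕ→ℚ m ≡ ℕ→ℚ p ℚ.* value u → r + fromℕ m ≈ fromℕ p * u
    lift-equation r u m e = equal (≡.trans (≡.cong (value r ℚ.+_) (value-fromℕ m))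
      (≡.trans e (≡.cong (ℚ._* value u) (≡.sym (value-fromℕ p)))))

    lift-reflection : ∀ u r → UpToReflection (value u) (value r) → UpToReflectionR u r
    lift-reflection u r (inj₁ e) = inj₁ (equal e)
    lift-reflection u r (inj₂ e) = inj₂ (equal e)

    reflection-positive : ∀ {u r} → InUnitInterval r → UpToReflection u r → ℚ.Positive u
    reflection-positive (0<r , r<1) (inj₁ ≡.refl) = ℚ.positive 0<r
    reflection-positive (0<r , r<1) (inj₂ ≡.refl) = 1-r-positive r<1

    u-positive : ℚ.Positive u₁ × ℚ.Positive u₂
    u-positive = cases same
      where
      cases : UpToReflection u₁ r₁ × UpToReflection u₂ r₂ ⊎ UpToReflection u₁ r₂ × UpToReflection u₂ r₁ → ℚ.Positive u₁ × ℚ.Positive u₂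
      cases (inj₁ (e , f)) = reflection-positive r₁-unit e , reflection-positive r₂-unit f
      cases (inj₂ (e , f)) = reflection-positive r₂-unit e , reflection-positive r₁-unit f

    same-rising² : ∀ b → rising² U₁ b * rising² U₂ b ≈ rising² R₁ b * rising² R₂ b
    same-rising² b = cases same
      where
      cases : UpToReflection u₁ r₁ × UpToReflection u₂ r₂ ⊎ UpToReflection u₁ r₂ × UpToReflection u₂ r₁ →
              rising² U₁ b * rising² U₂ b ≈ rising² R₁ b * rising² R₂ b
      cases (inj₁ (e , f)) = *-cong (rising²-upToReflection b (lift-reflection U₁ R₁ e)) (rising²-upToReflection b (lift-reflection U₂ R₂ f))
      cases (inj₂ (e , f)) = trans (*-cong (rising²-upToReflection b (lift-reflection U₁ R₂ e)) (rising²-upToReflection b (lift-reflection U₂ R₁ f))) (*-comm _ _)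

    same-sum : U₁ * (1# - U₁) + U₂ * (1# - U₂) ≈ R₁ * (1# - R₁) + R₂ * (1# - R₂)
    same-sum = cases same
      where
      open CommutativeRing integralRing using (+-comm)
      cases : UpToReflection u₁ r₁ × UpToReflection u₂ r₂ ⊎ UpToReflection u₁ r₂ × UpToReflection u₂ r₁ →
              U₁ * (1# - U₁) + U₂ * (1# - U₂) ≈ R₁ * (1# - R₁) + R₂ * (1# - R₂)
      cases (inj₁ (e , f)) = +-cong (product-upToReflection (lift-reflection U₁ R₁ e)) (product-upToReflection (lift-reflection U₂ R₂ f))
      cases (inj₂ (e , f)) = trans (+-cong (product-upToReflection (lift-reflection U₁ R₂ e)) (product-upToReflection (lift-reflection U₂ R₁ f))) (+-comm _ _)

    0<P : ∀ {P} → Prime (suc P) → 0 ℕ.< P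
    0<P {zero}  pr = contradiction pr ¬prime[1]
    0<P {suc P} _  = s≤s z≤n

    fromℕ-regular : ∀ n → ∀ {x y} → x * fromℕ (suc n) ≈ y * fromℕ (suc n) → x ≈ y
    fromℕ-regular n = positive-regular (fromℕ (suc n)) (≡.subst ℚ.Positive (≡.sym (value-fromℕ (suc n))) (ℚₚ.normalize-pos (suc n) 1))

    +-regular : ∀ u → ℚ.Positive (value u) → ∀ b → ∀ {x y} → x * (fromℕ b + u) ≈ y * (fromℕ b + u) → x ≈ y
    +-regular u u>0 b = positive-regular (fromℕ b + u) (≡.subst (λ x → ℚ.Positive (x ℚ.+ value u)) (≡.sym (value-fromℕ b))
      (ℚₚ.nonNeg+pos⇒pos (ℕ→ℚ b) {{ℚₚ.normalize-nonNeg b 1}} (value u) {{u>0}}))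

    local : Local integralRing p
    local = record { unit-or-multiple = unit-or-multiple ; nonmultiple = pos⇒nonmultiple }

    module W = Dwork integralRing P local (0<P pr)

    factorial-regular : ∀ n → W.Regular (factorial n)
    factorial-regular n = W.regular-∏ n λ i → fromℕ-regular i

    open W.Terms R₁ R₂ U₁ U₂ D₁.m D₂.m (ℕₚ.≤-pred D₁.m<p) (ℕₚ.≤-pred D₂.m<p)
      (lift-equation R₁ U₁ D₁.m D₁.equation) (lift-equation R₂ U₂ D₂.m D₂.equation) (fromℕ-regular P) factorial-regular
      (+-regular U₁ (proj₁ u-positive)) (+-regular U₂ (proj₂ u-positive)) same-rising² same-sum
      using (A; A-term; ∑-A-multiplicative)

    open Quotient integralRing (fromℕ p * fromℕ p * fromℕ p) using (_≋_; ≈⇒≋)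

    value-A : ∀ k → value (A k) ≡ term r₁ r₂ k
    value-A k = value-term R₁ R₂ k (A k) (A-term k)

  H-value : ∀ N → H r₁ r₂ N ≡ value (∑ N A)
  H-value N = ≡.trans (sum-cong N (λ k → ≡.sym (value-A k))) (sum-value N A)

  h : ℕ → Integral
  h t = ∑ (p ^ t) A

  h-step : ∀ t → h (suc t) ≋ h t * ∑ p A
  h-step t = ≡.subst (λ n → ∑ n A ≋ h t * ∑ p A) (ℕₚ.*-comm (p ^ t) p) (∑-A-multiplicative (prime-cases pr) (p ^ t))

  module _ (H≢0mod : ¬ (H r₁ r₂ p ≡ 0ℚ [ℤ₍ p ₎mod p ])) where

    h₁-unit : IsUnit (∑ p A)
    h₁-unit = cases (unit-or-multiple (∑ p A))
      where
      cases : IsUnit (∑ p A) ⊎ (∃ λ z → ∑ p A ≈ z * fromℕ p) → IsUnit (∑ p A)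
      cases (inj₁ u) = u
      cases (inj₂ z) = contradiction (multiple⇒≡0mod z (H-value p)) H≢0mod

    unit-≋ : ∀ {x y} → x ≋ y → IsUnit y → IsUnit x
    unit-≋ {x} x≋y (v , yv≈1) = W.unit-lift (v , W.B.trans (W.B.*-congʳ x≋y) (≈⇒≋ yv≈1))

    A₀-unit : IsUnit (A 0)
    A₀-unit = unit-resp {1#} {A 0} (equal (≡.sym (value-A 0))) unit-1

    -- Starting from `A 0`, which is 1, units propagate along `h-step` because a unit modulo `p³` is
    -- a unit. This places all denominators of the theorem among the units.
    h-unit : ∀ t → IsUnit (h t)
    h-unit zero    = unit-resp (sym (+-identityˡ (A 0))) A₀-unit
    h-unit (suc t) = unit-≋ (h-step t) (unit-* (h-unit t) h₁-unit)

    -- The right side does not depend on `t`, so consecutive quotients agree.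
    quotient-≋ : ∀ t → h (suc t) * proj₁ (h-unit t) ≋ ∑ p A
    quotient-≋ t = W.B.trans (W.B.*-congʳ (h-step t)) (≈⇒≋ (cancel (proj₂ (h-unit t))))
      where
      cancel : ∀ {x y v} → x * v ≈ 1# → x * y * v ≈ y
      cancel {x} {y} {v} e = trans (*-congʳ (*-comm x y)) (trans (*-assoc y x v) (trans (*-congˡ e) (CommutativeRing.*-identityʳ integralRing y)))

    quotients : ∀ t (nz : ℚ.NonZero (H r₁ r₂ (p ^ suc t))) (nz′ : ℚ.NonZero (H r₁ r₂ (p ^ t))) →
      (H r₁ r₂ (p ^ suc (suc t)) ÷ H r₁ r₂ (p ^ suc t)) {{nz}} ≡ (H r₁ r₂ (p ^ suc t) ÷ H r₁ r₂ (p ^ t)) {{nz′}} [ℤ₍ p ₎mod p ^ 3 ]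
    quotients t nz nz′ = ≋⇒≡mod (W.B.trans (quotient-≋ (suc t)) (W.B.sym (quotient-≋ t))) (quotient (suc t) nz) (quotient t nz′)
      where
      quotient : ∀ t (nz : ℚ.NonZero (H r₁ r₂ (p ^ t))) → (H r₁ r₂ (p ^ suc t) ÷ H r₁ r₂ (p ^ t)) {{nz}} ≡ value (h (suc t) * proj₁ (h-unit t))
      quotient t nz = ≡.trans (≡.cong (λ x → (x ÷ H r₁ r₂ (p ^ t)) {{nz}}) (H-value (p ^ suc t)))
        (value-inverse (h (suc t)) (h t) (proj₁ (h-unit t)) (H r₁ r₂ (p ^ t)) {{nz}} (H-value (p ^ t)) (proj₂ (h-unit t)))

mainTheorem2 : ∀ (r₁ r₂ : ℚ) (adm : Admissible r₁ r₂)
    (p : ℕ) (pr : Prime p) →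
    p ∤ leastCommonDenominator r₁ r₂ →
    ¬ (H r₁ r₂ p ≡ 0ℚ [ℤ₍ p ₎mod p ]) →
    ∀ (s : ℕ) → 1 ≤ s →
    let H≢0-at = λ t → H≢0 adm (p ^ t) {{m^n≢0 p t {{prime⇒nonZero pr}}}} in
    (H r₁ r₂ (p ^ suc s) ÷ H r₁ r₂ (p ^ s)) {{H≢0-at s}}
    ≡ (H r₁ r₂ (p ^ s) ÷ H r₁ r₂ (p ^ (s ∸ 1))) {{H≢0-at (s ∸ 1)}}
    [ℤ₍ p ₎mod p ^ 3 ]
mainTheorem2 r₁ r₂ adm zero      pr p∤lcm H≢0mod s       1≤s = contradiction pr ¬prime[0]
mainTheorem2 r₁ r₂ adm p@(suc P) pr p∤lcm H≢0mod (suc t) 1≤s =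
  Ratios.quotients P pr r₁ r₂ adm p∤lcm H≢0mod t
    (H≢0 adm (p ^ suc t) {{m^n≢0 p (suc t) {{prime⇒nonZero pr}}}}) (H≢0 adm (p ^ t) {{m^n≢0 p t {{prime⇒nonZero pr}}}})
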